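{- Let $(\hat G,\hat T)$ be a bipartite graft. If $(\hat G,\hat T)$ is a synthesis of a skeleton comb $(G,T;A,B)$ and a set of tooth grafts $\{(G_v,T_v;r_v):v\in B\}$, then $A$ is a maximal bipartitic extreme set of $(\hat G,\hat T)$ with empty fringe, i.e. $C_A=\emptyset$. Conversely, if $A$ is a maximal bipartitic extreme set of $(\hat G,\hat T)$, then the graft obtained from $(\hat G,\hat T)$ by fringe removal (deleting all vertices of $C_A$ and removing them from $\hat T$) is a synthesis of a skeleton comb whose spine set is $A$ and a set of tooth grafts.
   Context: All graphs are finite (parallel edges allowed). A graft is a pair $(G,T)$ with $T\subseteq V(G)$; a join is $F\subseteq E(G)$ such that each vertex is incident to an odd number of edges of $F$ iff it lies in $T$; a minimum join is one of minimum size. A bipartite graft has $G$ bipartite with given color classes. For $F\subseteq E$ and a subgraph $Q$, $w_F(Q)=|E(Q)\setminus F|-|E(Q)\cap F|$; $\lambda_{(G,T),F}(x,y)$ is the minimum of $w_F(P)$ over paths $P$ between $x$ and $y$ ($0$ if $x=y$); for a minimum join it does not depend on the choice of $F$. $\delta_G(Y)$: edges with exactly one end in $Y$; $E_G[Y,Z]$: edges joining $Y$ and $Z$. A comb $(G,T;A,B)$ is a bipartite graft with color classes $A$ (spine set) and $B$ (tooth set) such that every minimum join $F$ satisfies $|\delta_G(v)\cap F|=1$ for all $v\in B$. A graft $(H,S)$ is primal with respect to $r$ if $\lambda_{(H,S),F'}(r,x)\le0$ for all $x$; then $A_{(H,S)}(r):=\{x:\lambda_{(H,S),F'}(r,x)=0\}$.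 Graft contraction: identify a vertex set $Y$ into one vertex (deleting edges inside $Y$), the new vertex being terminal iff $|Y\cap S|$ is odd. Synthesis: given a comb $(G,T;A,B)$ and, for each $v\in B$, a bipartite graft $(G_v,T_v)$ with color classes $A_v,B_v$, primal with respect to $r_v\in A_v$ (all pairwise disjoint and disjoint from $G$), a bipartite graft $(\hat G,\hat T)$ is a synthesis if (1) each $G_v$ is a subgraph of $\hat G$ with the edges of $\hat G$ inside $V(G_v)$ exactly $E(G_v)$ and $\hat T\cap V(G_v)=T_v\Delta\{r_v\}$; (2) contracting each $V(G_v)$ into $v$ yields exactly $(G,T)$; (3) $\delta_{\hat G}(V(G_v))=E_{\hat G}[A,A_{(G_v,T_v)}(r_v)]$. A set $X$ is extreme if $\lambda(x,y)\ge0$ for all $x,y\in X$; bipartitic if contained in a color class; maximal bipartitic extreme if not properly contained in another bipartitic extreme set. $D_X:=\{y\notin X:\min_{x\in X}\lambda(x,y)<0\}$, $C_X:=V\setminus X\setminus D_X$ (the fringe of $X$).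
   Formalization: A synthesis is additionally required to have color classes A ∪ ⋃B_v and ⋃A_v; for disconnected grafts with other given color classes A need not lie in one color class. The graft is assumed to have a join, so that λ is defined. -}

module Defs where

open import Data.Nat using (ℕ; zero; suc; _≤_)
open import Data.Integer using (ℤ; +_; -[1+_]) renaming (_+_ to _+ℤ_; _≤_ to _≤ℤ_)
open import Data.Bool using (Bool; true; false; if_then_else_; _∧_; _∨_; not; _xor_)
open import Data.Fin using (Fin; _≟_) renaming (zero to fz; suc to fs)
open import Data.Product using (Σ; ∃; _×_; _,_; proj₁; proj₂; map)
open import Data.Sum using (_⊎_)
open import Data.List using (List; []; _∷_)
open import Data.List.Relation.Unary.Unique.Propositional using (Unique)
open import Relation.Nullary using (¬_)
open import Relation.Nullary.Decidable using (⌊_⌋)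
open import Relation.Binary.PropositionalEquality using (_≡_; _≢_)

finSum : ∀ k → (Fin k → ℕ) → ℕ
finSum zero f = 0
finSum (suc k) f = f fz Data.Nat.+ finSum k (λ i → f (fs i))

count : ∀ {k} → (Fin k → Bool) → ℕ
count {k} p = finSum k (λ i → if p i then 1 else 0)

isOdd : ℕ → Bool
isOdd zero = false
isOdd (suc n) = not (isOdd n)

_==_ : ∀ {k} → Fin k → Fin k → Bool
a == b = ⌊ a ≟ b ⌋

record Graph : Set where
  field
    nV nE : ℕ
    ends  : Fin nE → Fin nV × Fin nV
open Graph public

VSet : Graph → Set
VSet G = Fin (nV G) → Bool

ESet : Graph → Set
ESet G = Fin (nE G) → Bool

_⊆_ : ∀ {k} → (Fin k → Bool) → (Fin k → Bool) → Set
X ⊆ Y = ∀ x → X x ≡ true → Y x ≡ true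

incident : (G : Graph) → Fin (nE G) → Fin (nV G) → Bool
incident G e x = (proj₁ (ends G e) == x) ∨ (proj₂ (ends G e) == x)

degIn : (G : Graph) → ESet G → Fin (nV G) → ℕ
degIn G F x = count (λ e → F e ∧ incident G e x)

IsJoin : (G : Graph) → VSet G → ESet G → Set
IsJoin G T F = ∀ x → isOdd (degIn G F x) ≡ T x

IsMinJoin : (G : Graph) → VSet G → ESet G → Set
IsMinJoin G T F = IsJoin G T F × (∀ F' → IsJoin G T F' → count F ≤ count F')

HasJoin : (G : Graph) → VSet G → Set
HasJoin G T = ∃ λ F → IsJoin G T F

Links : (G : Graph) → Fin (nE G) → Fin (nV G) → Fin (nV G) → Set
Links G e x y = ends G e ≡ (x , y) ⊎ ends G e ≡ (y , x)

data Walk (G : Graph) : Fin (nV G) → Fin (nV G) → Set where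
  stop : ∀ x → Walk G x x
  step : ∀ {x y z} (e : Fin (nE G)) → Links G e x y → Walk G y z → Walk G x z

verts : ∀ {G x y} → Walk G x y → List (Fin (nV G))
verts (stop x) = x ∷ []
verts (step {x = x} e _ w) = x ∷ verts w

IsPath : ∀ {G x y} → Walk G x y → Set
IsPath w = Unique (verts w)

weight : ∀ {G x y} → ESet G → Walk G x y → ℤ
weight F (stop x) = + 0
weight F (step e _ w) = (if F e then -[1+ 0 ] else + 1) +ℤ weight F w

LamLe : (G : Graph) → ESet G → Fin (nV G) → Fin (nV G) → ℤ → Set
LamLe G F x y k = Σ (Walk G x y) λ P → IsPath P × (weight F P ≤ℤ k)

LamGe : (G : Graph) → ESet G → Fin (nV G) → Fin (nV G) → ℤ → Set
LamGe G F x y k = ∀ (P : Walk G x y) → IsPath P → k ≤ℤ weight F P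

LamEq : (G : Graph) → ESet G → Fin (nV G) → Fin (nV G) → ℤ → Set
LamEq G F x y k = LamLe G F x y k × LamGe G F x y k

record BGraft : Set where
  field
    graph : Graph
    T     : VSet graph
    col   : VSet graph
    bip   : ∀ e → col (proj₂ (ends graph e)) ≡ not (col (proj₁ (ends graph e)))
open BGraft public

MinJoin : (H : BGraft) → ESet (graph H) → Set
MinJoin H = IsMinJoin (graph H) (T H)

-- Comb (G,T;A,B): spine set A = col⁻¹(false), tooth set B = col⁻¹(true);
-- every minimum join has exactly one edge at each tooth vertex.
IsComb : BGraft → Set
IsComb G = ∀ F → MinJoin G F → ∀ v → col G v ≡ true → degIn (graph G) F v ≡ 1

-- (H,S) primal w.r.t. r, witnessed by a minimum join F
PrimalWrt : (H : BGraft) → ESet (graph H) → Fin (nV (graph H)) → Set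
PrimalWrt H F r = ∀ x → LamLe (graph H) F r x (+ 0)

-- x ∈ A_{(H,S)}(r)  (computed with the minimum join F)
InAr : (H : BGraft) → ESet (graph H) → Fin (nV (graph H)) → Fin (nV (graph H)) → Set
InAr H F r x = LamEq (graph H) F r x (+ 0)

ExtremeWrt : (H : BGraft) → ESet (graph H) → VSet (graph H) → Set
ExtremeWrt H F X = ∀ x y → X x ≡ true → X y ≡ true → LamGe (graph H) F x y (+ 0)

IsExtreme : (H : BGraft) → VSet (graph H) → Set
IsExtreme H X = Σ (ESet (graph H)) λ F → MinJoin H F × ExtremeWrt H F X

Bipartitic : (H : BGraft) → VSet (graph H) → Set
Bipartitic H X = Σ Bool λ c → ∀ x → X x ≡ true → col H x ≡ c

MaxBipExtreme : (H : BGraft) → VSet (graph H) → Set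
MaxBipExtreme H X =
  Bipartitic H X × IsExtreme H X ×
  (∀ Y → Bipartitic H Y → IsExtreme H Y → X ⊆ Y → Y ⊆ X)

-- y ∈ D_X  (w.r.t. minimum join F)
InD : (H : BGraft) → ESet (graph H) → VSet (graph H) → Fin (nV (graph H)) → Set
InD H F X y = X y ≡ false × Σ (Fin (nV (graph H))) λ x → X x ≡ true × LamLe (graph H) F x y -[1+ 0 ]

InC : (H : BGraft) → ESet (graph H) → VSet (graph H) → Fin (nV (graph H)) → Set
InC H F X y = X y ≡ false × ¬ InD H F X y

FringeEmpty : (H : BGraft) → VSet (graph H) → Set
FringeEmpty H X = ∀ F → MinJoin H F → ∀ y → ¬ InC H F X y

-- H is (an isomorphic copy of) the induced subgraph of G on {x : P x}:
-- ι, κ are injective, with images exactly P resp. the edges with both ends in P.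

record InducedOn (G : Graph) (P : Fin (nV G) → Set) (H : Graph) : Set where
  field
    ι      : Fin (nV H) → Fin (nV G)
    ι-inj  : ∀ x y → ι x ≡ ι y → x ≡ y
    ι-img  : ∀ x → P x → ∃ λ y → ι y ≡ x
    ι-in   : ∀ y → P (ι y)
    κ      : Fin (nE H) → Fin (nE G)
    κ-inj  : ∀ e f → κ e ≡ κ f → e ≡ f
    κ-img  : ∀ e → P (proj₁ (ends G e)) → P (proj₂ (ends G e)) → ∃ λ f → κ f ≡ e
    κ-ends : ∀ f → ends G (κ f) ≡ map ι ι (ends H f)
open InducedOn public

-- G is obtained from Ĝ by contracting each fibre π⁻¹(w) to the vertex w
-- (deleting edges inside a fibre; parity rule for terminals).
record ContractsTo (Ĝ : Graph) (T̂ : VSet Ĝ) (G : Graph) (TG : VSet G) (π : Fin (nV Ĝ) → Fin (nV G)) : Set where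
  field
    π-surj : ∀ w → ∃ λ x → π x ≡ w
    σ      : Fin (nE G) → Fin (nE Ĝ)
    σ-inj  : ∀ e f → σ e ≡ σ f → e ≡ f
    σ-img  : ∀ e → π (proj₁ (ends Ĝ e)) ≢ π (proj₂ (ends Ĝ e)) → ∃ λ g → σ g ≡ e
    σ-out  : ∀ g → π (proj₁ (ends Ĝ (σ g))) ≢ π (proj₂ (ends Ĝ (σ g)))
    σ-ends : ∀ g → ends G g ≡ map π π (ends Ĝ (σ g))
    term   : ∀ w → TG w ≡ isOdd (count (λ x → (π x == w) ∧ T̂ x))
open ContractsTo public

record Tooth (Ĝ : BGraft) (S : VSet (graph Ĝ)) {nG : ℕ}
             (π : Fin (nV (graph Ĝ)) → Fin nG) (v : Fin nG) : Set where
  field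
    H     : BGraft                       -- (G_v, T_v) with colour classes A_v = col⁻¹(false), B_v
    r     : Fin (nV (graph H))
    r∈A   : col H r ≡ false
    emb   : InducedOn (graph Ĝ) (λ x → π x ≡ v) (graph H)
    termv : ∀ y → T Ĝ (ι emb y) ≡ T H y xor (y == r)
    Fv    : ESet (graph H)
    Fv-min : MinJoin H Fv
    primal : PrimalWrt H Fv r
    -- condition (3): δ(V(G_v)) = E[A, A_{(G_v,T_v)}(r_v)]
    cond3 : ∀ e → (((π (proj₁ (ends (graph Ĝ) e)) == v) xor (π (proj₂ (ends (graph Ĝ) e)) == v)) ≡ true
                   → Σ _ λ a → Σ _ λ y → S a ≡ true × InAr H Fv r y × Links (graph Ĝ) e a (ι emb y))
                  × (∀ a y → S a ≡ true → InAr H Fv r y → Links (graph Ĝ) e a (ι emb y)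
                   → ((π (proj₁ (ends (graph Ĝ) e)) == v) xor (π (proj₂ (ends (graph Ĝ) e)) == v)) ≡ true)
open Tooth public

record Synthesis (Ĝ : BGraft) (S : VSet (graph Ĝ)) : Set where
  field
    G      : BGraft                          -- skeleton (G,T;A,B), A = col⁻¹(false)
    comb   : IsComb G
    π      : Fin (nV (graph Ĝ)) → Fin (nV (graph G))
    contr  : ContractsTo (graph Ĝ) (T Ĝ) (graph G) (T G) π
    A-single : ∀ x y → col G (π x) ≡ false → π x ≡ π y → x ≡ y
    spine  : ∀ x → S x ≡ not (col G (π x))
    teeth  : ∀ v → col G v ≡ true → Tooth Ĝ S π v
    -- colour classes of Ĝ are A ∪ ⋃ B_v and ⋃ A_v
    colour : Σ Bool λ c → (∀ x → S x ≡ true → col Ĝ x ≡ c)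
               × (∀ v (p : col G v ≡ true) → ∀ y →
                    col Ĝ (ι (emb (teeth v p)) y) ≡ (col (H (teeth v p)) y xor not c))
open Synthesis public

{-# OPTIONS --safe #-}
module Submission where

open import Defs
open import Level using (0ℓ)
open import Algebra.Bundles using (CommutativeMonoid; CommutativeRing)
open import Axiom.UniquenessOfIdentityProofs.WithK using (uip)
open import Data.Bool using (Bool; true; false; if_then_else_; _∧_; _∨_; not; _xor_)
import Data.Bool.Properties as 𝔹
open import Data.Bool.Properties using (xor-∧-commutativeRing; ∧-zeroʳ; ∧-identityʳ; ∧-comm; xor-same; xor-comm; xor-assoc; xor-identityʳ; ¬-not)
open import Data.Empty using (⊥; ⊥-elim)
open import Data.Fin using (Fin; _≟_) renaming (zero to fz; suc to fs)
open import Data.Fin.Properties using (any?; all?; suc-injective)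
open import Data.Fin.Subset.Properties using (anySubset?)
open import Data.Integer using (ℤ; +_; -[1+_]; +≤+; -≤-; -<+; +<+; -_) renaming (_+_ to _+ℤ_; _≤_ to _≤ℤ_)
import Data.Integer as ℤ using (_<_)
import Data.Integer.Properties as ℤ
open import Data.List using ([]; _∷_)
open import Data.List.Membership.Propositional using (_∈_)
import Data.List.Membership.DecPropositional as DecMem
open import Data.List.Relation.Unary.All using ([]; _∷_)
import Data.List.Relation.Unary.All as All
open import Data.List.Relation.Unary.All.Properties using (¬Any⇒All¬)
open import Data.List.Relation.Unary.AllPairs using ([]; _∷_)
open import Data.List.Relation.Unary.Any using (here; there)
open import Data.Nat using (ℕ; zero; suc; _+_; _≤_; _<_; z≤n; s≤s) renaming (_≟_ to _≟ℕ_)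
open import Data.Nat.Properties hiding (_≟_; suc-injective)
open import Data.Nat.Tactic.RingSolver using (solve-∀)
open import Data.Product using (Σ; ∃; _×_; _,_; proj₁; proj₂)
open import Data.Sum using (_⊎_; inj₁; inj₂; [_,_]′)
open import Data.Vec using (lookup; tabulate)
open import Data.Vec.Properties using (lookup∘tabulate)
open import Function using (_∘_)
open import Relation.Nullary using (¬_; Dec; yes; no)
open import Relation.Nullary.Decidable using (⌊_⌋; _×-dec_; _→-dec_; map′)
open import Relation.Binary.PropositionalEquality using (_≡_; _≢_; refl; sym; trans; cong; cong₂; subst; _≗_; module ≡-Reasoning)

-- For a set M of vertices, size all edge sets by their parities off M only ("joins modulo M").  A
-- minimum join F is minimum modulo M as soon as M is extreme, and toggling a path of F ⊕ J in both F
-- and J keeps |F| + |J|; this exchange replaces distances by sizes throughout.  Its main consequence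
-- is Apart: if ℓ u is the least size of a join of T ⊕ {u} modulo M and all ℓ on a component of the
-- graph minus M are below |F|, then no join of T ⊕ {y} ⊕ {z} with y, z in that component is as small
-- as ℓ y + ℓ z − |F|.
-- For M = A this forces exactly one edge of F between A and each component of the graph minus A, and
-- makes the component primal with respect to the end of that edge: these are the teeth.  Maximality
-- of A and parity make the fringe an independent set, joined only to A and only by edges outside F.
-- Conversely, Apart for M = {r} in a tooth, with ℓ ≤ |F| and a bound weaker by 2, shows that the
-- vertices at distance 0 from r form an extreme set, so every join modulo A has at least one edge
-- more than F_v among the edges meeting the tooth; a minimum join of the comb, completed inside the
-- teeth, attains this bound.

Sub : ℕ → Set
Sub k = Fin k → Bool

infixl 6 _⊕_
infixl 7 _⊓_

_⊕_ : ∀ {k} → Sub k → Sub k → Sub k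
(p ⊕ q) i = p i xor q i

_⊓_ : ∀ {k} → Sub k → Sub k → Sub k
(p ⊓ q) i = p i ∧ q i

∁ : ∀ {k} → Sub k → Sub k
∁ p i = not (p i)

∅ : ∀ {k} → Sub k
∅ _ = false

⁅_⁆ : ∀ {k} → Fin k → Sub k
⁅ a ⁆ i = a == i

==-refl : ∀ {k} (a : Fin k) → (a == a) ≡ true
==-refl a with a ≟ a
... | yes _  = refl
... | no a≢a = ⊥-elim (a≢a refl)

==-≢ : ∀ {k} {a b : Fin k} → a ≢ b → (a == b) ≡ false
==-≢ {a = a} {b} a≢b with a ≟ b
... | yes a≡b = ⊥-elim (a≢b a≡b)
... | no _    = refl

==-≡ : ∀ {k} {a b : Fin k} → (a == b) ≡ true → a ≡ b
==-≡ {a = a} {b} h with a ≟ b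
... | yes p = p

==-≢⁻ : ∀ {k} {a b : Fin k} → (a == b) ≡ false → a ≢ b
==-≢⁻ {a = a} h refl with trans (sym h) (==-refl a)
... | ()

==-sym : ∀ {k} (a b : Fin k) → (a == b) ≡ (b == a)
==-sym a b with a ≟ b
... | yes refl = sym (==-refl a)
... | no a≢b = sym (==-≢ (a≢b ∘ sym))

==-inj : ∀ {k l} (ι : Fin k → Fin l) → (∀ x y → ι x ≡ ι y → x ≡ y) → ∀ x y → (ι x == ι y) ≡ (x == y)
==-inj ι inj x y with x ≟ y
... | yes refl = ==-refl (ι x)
... | no x≢y = ==-≢ (x≢y ∘ inj x y)

conflict : {A : Set} {b : Bool} → b ≡ true → b ≡ false → A
conflict refl ()

∧-true : ∀ a {b} → a ∧ b ≡ true → a ≡ true × b ≡ true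
∧-true true h = refl , h

-- Boolean identities are decided by evaluating both sides at all arguments.

BoolFn : ℕ → Set
BoolFn zero    = Bool
BoolFn (suc n) = Bool → BoolFn n

AgreeEverywhere : ∀ n → BoolFn n → BoolFn n → Set
AgreeEverywhere zero    a b = a ≡ b
AgreeEverywhere (suc n) f g = ∀ x → AgreeEverywhere n (f x) (g x)

agree? : ∀ n → BoolFn n → BoolFn n → Bool
agree? zero    a b = not (a xor b)
agree? (suc n) f g = agree? n (f true) (g true) ∧ agree? n (f false) (g false)

taut : ∀ n (f g : BoolFn n) → agree? n f g ≡ true → AgreeEverywhere n f g
taut zero    true  true  h = refl
taut zero    false false h = refl
taut (suc n) f g h x with agree? n (f true) (g true) in h₁ | agree? n (f false) (g false) in h₂
taut (suc n) f g h true  | true | true = taut n (f true) (g true) h₁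
taut (suc n) f g h false | true | true = taut n (f false) (g false) h₂

-- Finite sums over 𝔽₂ and cardinalities

module FinSum (M : CommutativeMonoid 0ℓ 0ℓ) where
  open CommutativeMonoid M renaming (refl to ≈-refl; sym to ≈-sym; trans to ≈-trans)
  open import Algebra.Properties.CommutativeMonoid.Sum M public

  sum-zero : ∀ {k} (f : Fin k → Carrier) → (∀ i → f i ≈ ε) → sum f ≈ ε
  sum-zero {k} f f≈ε = ≈-trans (sum-cong-≋ f≈ε) (sum-replicate-zero k)

  sum-one : ∀ {k} (f : Fin k → Carrier) (j : Fin k) → (∀ i → i ≢ j → f i ≈ ε) → sum f ≈ f j
  sum-one f fz h =
    ≈-trans (∙-congˡ (sum-zero (f ∘ fs) (λ i → h (fs i) (λ ())))) (identityʳ (f fz))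
  sum-one f (fs j) h =
    ≈-trans (∙-cong (h fz (λ ())) (sum-one (f ∘ fs) j (λ i i≢j → h (fs i) (i≢j ∘ suc-injective))))
            (identityˡ (f (fs j)))

  private
    pick : Bool → Carrier → Carrier
    pick b a = if b then a else ε

    pick-≡ : ∀ {k} {i j : Fin k} a → i ≡ j → pick (i == j) a ≈ a
    pick-≡ {i = i} a refl rewrite ==-refl i = ≈-refl

    pick-≢ : ∀ {k} {i j : Fin k} a → i ≢ j → pick (i == j) a ≈ ε
    pick-≢ a i≢j rewrite ==-≢ i≢j = ≈-refl

    pick-ε : ∀ b {a} → a ≈ ε → pick b a ≈ ε
    pick-ε true  h = h
    pick-ε false h = ≈-refl

  sum-reindex : ∀ {m k} (κ : Fin m → Fin k) → (∀ e f → κ e ≡ κ f → e ≡ f) → (A : Fin k → Carrier) →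
                (∀ e → (∃ λ f → κ f ≡ e) ⊎ A e ≈ ε) → sum A ≈ sum (A ∘ κ)
  sum-reindex κ κ-inj A supp =
    ≈-trans (sum-cong-≋ spread)
    (≈-trans (∑-comm (λ e f → pick (κ f == e) (A e)))
             (sum-cong-≋ collect))
    where
    spread : ∀ e → A e ≈ sum (λ f → pick (κ f == e) (A e))
    spread e with supp e
    ... | inj₁ (f , refl) = ≈-sym (≈-trans
            (sum-one (λ f′ → pick (κ f′ == κ f) (A (κ f))) f (λ f′ f′≢f → pick-≢ _ (f′≢f ∘ κ-inj f′ f)))
            (pick-≡ {i = κ f} _ refl))
    ... | inj₂ z = ≈-trans z (≈-sym (sum-zero _ (λ f → pick-ε (κ f == e) z)))
    collect : ∀ f → sum (λ e → pick (κ f == e) (A e)) ≈ A (κ f)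
    collect f = ≈-trans (sum-one (λ e → pick (κ f == e) (A e)) (κ f) (λ e e≢ → pick-≢ _ (e≢ ∘ sym)))
                        (pick-≡ {i = κ f} _ refl)

  sum-comm-fibres : ∀ {k l} (o : Fin k → Fin l) (A : Fin k → Carrier) →
                    sum A ≈ sum (λ v → sum (λ e → if o e == v then A e else ε))
  sum-comm-fibres o A =
    ≈-trans (sum-cong-≋ (λ e → ≈-sym (≈-trans
              (sum-one (λ v → pick (o e == v) (A e)) (o e) (λ v v≢ → pick-≢ _ (v≢ ∘ sym)))
              (pick-≡ {i = o e} _ refl))))
            (∑-comm (λ e v → pick (o e == v) (A e)))

module ℕΣ = FinSum +-0-commutativeMonoid
module 𝔽₂Σ = FinSum (CommutativeRing.+-commutativeMonoid xor-∧-commutativeRing)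

abstract

  ⨁ : ∀ {k} → Sub k → Bool
  ⨁ = 𝔽₂Σ.sum

  ⨁-cong : ∀ {k} {p q : Sub k} → p ≗ q → ⨁ p ≡ ⨁ q
  ⨁-cong = 𝔽₂Σ.sum-cong-≗

  ⨁-⊕ : ∀ {k} (p q : Sub k) → ⨁ (p ⊕ q) ≡ ⨁ p xor ⨁ q
  ⨁-⊕ = 𝔽₂Σ.∑-distrib-+

  ⨁-zero : ∀ {k} {p : Sub k} → (∀ i → p i ≡ false) → ⨁ p ≡ false
  ⨁-zero {p = p} = 𝔽₂Σ.sum-zero p

  ⨁-one : ∀ {k} {p : Sub k} (j : Fin k) → (∀ i → i ≢ j → p i ≡ false) → ⨁ p ≡ p j
  ⨁-one {p = p} = 𝔽₂Σ.sum-one p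

  ⨁-comm : ∀ {k l} (f : Fin k → Fin l → Bool) → ⨁ (λ i → ⨁ (f i)) ≡ ⨁ (λ j → ⨁ (λ i → f i j))
  ⨁-comm = 𝔽₂Σ.∑-comm

  ⨁-reindex : ∀ {m k} (κ : Fin m → Fin k) → (∀ e f → κ e ≡ κ f → e ≡ f) → (p : Sub k) →
              (∀ e → (∃ λ f → κ f ≡ e) ⊎ p e ≡ false) → ⨁ p ≡ ⨁ (p ∘ κ)
  ⨁-reindex = 𝔽₂Σ.sum-reindex

  ⨁-witness : ∀ {k} (p : Sub k) → ⨁ p ≡ true → ∃ λ i → p i ≡ true
  ⨁-witness {suc k} p h with p fz in p₀
  ... | true = fz , p₀
  ... | false with ⨁-witness (p ∘ fs) h
  ...   | i , q = fs i , q

  isOdd-count : ∀ {k} (p : Sub k) → isOdd (count p) ≡ ⨁ p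
  isOdd-count {zero}  p = refl
  isOdd-count {suc k} p with p fz
  ... | true  = cong not (isOdd-count (p ∘ fs))
  ... | false = isOdd-count (p ∘ fs)

⨁-∧ˡ : ∀ {k} b (p : Sub k) → b ∧ ⨁ p ≡ ⨁ (λ i → b ∧ p i)
⨁-∧ˡ true  p = refl
⨁-∧ˡ false p = sym (⨁-zero (λ _ → refl))

⨁-⁅⁆ : ∀ {k} (a : Fin k) (χ : Sub k) → ⨁ (χ ⊓ ⁅ a ⁆) ≡ χ a
⨁-⁅⁆ a χ = trans (⨁-one a (λ i i≢a → trans (cong (χ i ∧_) (==-≢ (i≢a ∘ sym))) (∧-zeroʳ (χ i))))
                 (trans (cong (χ a ∧_) (==-refl a)) (∧-identityʳ (χ a)))

⟦_⟧ : Bool → ℕ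
⟦ b ⟧ = if b then 1 else 0

finSum≡sum : ∀ k (f : Fin k → ℕ) → finSum k f ≡ ℕΣ.sum f
finSum≡sum zero    f = refl
finSum≡sum (suc k) f = cong (λ c → f fz + c) (finSum≡sum k (f ∘ fs))

count≡ : ∀ {k} (p : Sub k) → count p ≡ ℕΣ.sum (⟦_⟧ ∘ p)
count≡ {k} p = finSum≡sum k (⟦_⟧ ∘ p)

count-cong : ∀ {k} {p q : Sub k} → p ≗ q → count p ≡ count q
count-cong {p = p} {q} h = trans (count≡ p) (trans (ℕΣ.sum-cong-≗ (cong ⟦_⟧ ∘ h)) (sym (count≡ q)))

count-exchange : ∀ {k} (p q p′ q′ : Sub k) → (∀ i → ⟦ p i ⟧ + ⟦ q i ⟧ ≡ ⟦ p′ i ⟧ + ⟦ q′ i ⟧) →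
                 count p + count q ≡ count p′ + count q′
count-exchange p q p′ q′ h = begin
  count p + count q                              ≡⟨ cong₂ _+_ (count≡ p) (count≡ q) ⟩
  ℕΣ.sum (⟦_⟧ ∘ p) + ℕΣ.sum (⟦_⟧ ∘ q)            ≡⟨ ℕΣ.∑-distrib-+ (⟦_⟧ ∘ p) (⟦_⟧ ∘ q) ⟨
  ℕΣ.sum (λ i → ⟦ p i ⟧ + ⟦ q i ⟧)               ≡⟨ ℕΣ.sum-cong-≗ h ⟩
  ℕΣ.sum (λ i → ⟦ p′ i ⟧ + ⟦ q′ i ⟧)             ≡⟨ ℕΣ.∑-distrib-+ (⟦_⟧ ∘ p′) (⟦_⟧ ∘ q′) ⟩
  ℕΣ.sum (⟦_⟧ ∘ p′) + ℕΣ.sum (⟦_⟧ ∘ q′)          ≡⟨ cong₂ _+_ (count≡ p′) (count≡ q′) ⟨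
  count p′ + count q′                            ∎
  where open ≡-Reasoning

count-zero : ∀ {k} (p : Sub k) → (∀ i → p i ≡ false) → count p ≡ 0
count-zero p h = trans (count≡ p) (ℕΣ.sum-zero _ (λ i → cong ⟦_⟧ (h i)))

count-∅ : ∀ k → count {k} ∅ ≡ 0
count-∅ k = count-zero {k} ∅ (λ _ → refl)

count-⁅⁆ : ∀ {k} (a : Fin k) → count ⁅ a ⁆ ≡ 1
count-⁅⁆ a = trans (count≡ ⁅ a ⁆) (trans (ℕΣ.sum-one _ a (λ i i≢a → cong ⟦_⟧ (==-≢ (i≢a ∘ sym))))
                                         (cong ⟦_⟧ (==-refl a)))

count-mono : ∀ {k} {p q : Sub k} → p ⊆ q → count p ≤ count q
count-mono {k} {p} {q} p⊆q = subst (count p ≤_) split (m≤m+n (count p) (count (q ⊓ ∁ p)))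
  where
  pointwise : ∀ i → ⟦ p i ⟧ + ⟦ q i ∧ not (p i) ⟧ ≡ ⟦ q i ⟧ + ⟦ false ⟧
  pointwise i with p i in pᵢ | q i in qᵢ
  ... | true  | true  = refl
  ... | true  | false = conflict (p⊆q i pᵢ) qᵢ
  ... | false | true  = refl
  ... | false | false = refl
  split : count p + count (q ⊓ ∁ p) ≡ count q
  split = trans (count-exchange p (q ⊓ ∁ p) q ∅ pointwise)
                (trans (cong (λ c → count q + c) (count-∅ k)) (+-identityʳ _))

count-positive : ∀ {k} (p : Sub k) i → p i ≡ true → 1 ≤ count p
count-positive p i h = subst (_≤ count p) (count-⁅⁆ i)
  (count-mono {p = ⁅ i ⁆} (λ j i≡j → subst (λ j → p j ≡ true) (==-≡ i≡j) h))

count-toggle-in : ∀ {k} (J : Sub k) e → J e ≡ true → suc (count (J ⊕ ⁅ e ⁆)) ≡ count J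
count-toggle-in {k} J e Je = begin
  suc (count (J ⊕ ⁅ e ⁆))         ≡⟨ +-comm 1 _ ⟩
  count (J ⊕ ⁅ e ⁆) + 1           ≡⟨ cong (λ c → count (J ⊕ ⁅ e ⁆) + c) (count-⁅⁆ e) ⟨
  count (J ⊕ ⁅ e ⁆) + count ⁅ e ⁆ ≡⟨ count-exchange (J ⊕ ⁅ e ⁆) ⁅ e ⁆ J ∅ pointwise ⟩
  count J + count {k} ∅ ≡⟨ cong (λ c → count J + c) (count-∅ k) ⟩
  count J + 0                     ≡⟨ +-identityʳ _ ⟩
  count J                         ∎
  where
  open ≡-Reasoning
  pointwise : ∀ f → ⟦ J f xor (e == f) ⟧ + ⟦ e == f ⟧ ≡ ⟦ J f ⟧ + 0
  pointwise f with e ≟ f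
  ... | yes refl rewrite Je = refl
  ... | no _ = cong (λ b → ⟦ b ⟧ + 0) (xor-identityʳ (J f))

count-toggle-out : ∀ {k} (J : Sub k) e → J e ≡ false → count (J ⊕ ⁅ e ⁆) ≡ suc (count J)
count-toggle-out J e Je = trans
  (sym (count-toggle-in (J ⊕ ⁅ e ⁆) e (cong₂ _xor_ Je (==-refl e))))
  (cong suc (count-cong (λ f → trans (xor-assoc (J f) _ _)
                                     (trans (cong (J f xor_) (xor-same (e == f))) (xor-identityʳ (J f))))))

count-toggle-≤ : ∀ {k} (J : Sub k) e → count (J ⊕ ⁅ e ⁆) ≤ suc (count J)
count-toggle-≤ J e with J e in Je
... | true  = ≤-trans (n≤1+n _) (≤-trans (≤-reflexive (count-toggle-in J e Je)) (n≤1+n _))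
... | false = ≤-reflexive (count-toggle-out J e Je)

count-reindex : ∀ {m k} (κ : Fin m → Fin k) → (∀ e f → κ e ≡ κ f → e ≡ f) → (p : Sub k) →
                (∀ e → p e ≡ true → ∃ λ f → κ f ≡ e) → count p ≡ count (p ∘ κ)
count-reindex κ κ-inj p supp =
  trans (count≡ p) (trans (ℕΣ.sum-reindex κ κ-inj (⟦_⟧ ∘ p) supp′) (sym (count≡ (p ∘ κ))))
  where
  supp′ : ∀ e → (∃ λ f → κ f ≡ e) ⊎ ⟦ p e ⟧ ≡ 0
  supp′ e with p e in pₑ
  ... | true  = inj₁ (supp e pₑ)
  ... | false = inj₂ refl

sum-mono : ∀ {k} (f g : Fin k → ℕ) → (∀ i → f i ≤ g i) → ℕΣ.sum f ≤ ℕΣ.sum g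
sum-mono {zero}  f g h = z≤n
sum-mono {suc k} f g h = +-mono-≤ (h fz) (sum-mono (f ∘ fs) (g ∘ fs) (h ∘ fs))

sum-strict : ∀ {k} (f g : Fin k → ℕ) → (∀ i → f i ≤ g i) → ∀ j → f j < g j → ℕΣ.sum f < ℕΣ.sum g
sum-strict f g h fz     lt = +-mono-<-≤ lt (sum-mono (f ∘ fs) (g ∘ fs) (h ∘ fs))
sum-strict f g h (fs j) lt = +-mono-≤-< (h fz) (sum-strict (f ∘ fs) (g ∘ fs) (h ∘ fs) j lt)

module Blocks {k l} (o : Fin k → Fin l) where

  block : Fin l → Sub k
  block v e = o e == v

  count-blocks : (p : Sub k) → count p ≡ ℕΣ.sum (λ v → count (p ⊓ block v))
  count-blocks p = trans (count≡ p) (trans (ℕΣ.sum-comm-fibres o (⟦_⟧ ∘ p))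
    (ℕΣ.sum-cong-≗ (λ v → trans (ℕΣ.sum-cong-≗ (λ e → pointwise (p e) (o e == v))) (sym (count≡ (p ⊓ block v))))))
    where
    pointwise : ∀ a b → (if b then ⟦ a ⟧ else 0) ≡ ⟦ a ∧ b ⟧
    pointwise true  true  = refl
    pointwise true  false = refl
    pointwise false true  = refl
    pointwise false false = refl

  count-blocks-≤ : (p q : Sub k) → (∀ v → count (p ⊓ block v) ≤ count (q ⊓ block v)) → count p ≤ count q
  count-blocks-≤ p q h = subst (_≤ count q) (sym (count-blocks p))
    (≤-trans (sum-mono _ _ h) (≤-reflexive (sym (count-blocks q))))

  count-blocks-< : (p q : Sub k) → (∀ v → count (p ⊓ block v) ≤ count (q ⊓ block v)) →
                   ∀ v → count (p ⊓ block v) < count (q ⊓ block v) → count p < count q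
  count-blocks-< p q h v lt = subst (_< count q) (sym (count-blocks p))
    (≤-trans (sum-strict _ _ h v lt) (≤-reflexive (sym (count-blocks q))))

inc : (G : Graph) → Fin (nE G) → Sub (nV G)
inc G e = ⁅ proj₁ (ends G e) ⁆ ⊕ ⁅ proj₂ (ends G e) ⁆

∂ : (G : Graph) → ESet G → VSet G
∂ G J x = ⨁ (λ e → J e ∧ inc G e x)

∂-cong : (G : Graph) {J K : ESet G} → J ≗ K → ∂ G J ≗ ∂ G K
∂-cong G h x = ⨁-cong (λ e → cong (_∧ inc G e x) (h e))

∂-⊕ : (G : Graph) (J K : ESet G) → ∂ G (J ⊕ K) ≗ ∂ G J ⊕ ∂ G K
∂-⊕ G J K x = trans (⨁-cong (λ e → taut 3 (λ a b c → (a xor b) ∧ c) (λ a b c → (a ∧ c) xor (b ∧ c)) refl (J e) (K e) (inc G e x)))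
                    (⨁-⊕ _ _)

∂-⁅⁆ : (G : Graph) (e : Fin (nE G)) → ∂ G ⁅ e ⁆ ≗ inc G e
∂-⁅⁆ G e x = trans (⨁-cong (λ f → ∧-comm (e == f) (inc G f x))) (⨁-⁅⁆ e (λ f → inc G f x))

cut : (G : Graph) → VSet G → ESet G
cut G χ e = χ (proj₁ (ends G e)) xor χ (proj₂ (ends G e))

⨁-∂ : (G : Graph) (χ : VSet G) (J : ESet G) → ⨁ (χ ⊓ ∂ G J) ≡ ⨁ (J ⊓ cut G χ)
⨁-∂ G χ J = begin
  ⨁ (χ ⊓ ∂ G J)                                    ≡⟨ ⨁-cong (λ x → ⨁-∧ˡ (χ x) _) ⟩
  ⨁ (λ x → ⨁ (λ e → χ x ∧ (J e ∧ inc G e x)))      ≡⟨ ⨁-comm _ ⟩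
  ⨁ (λ e → ⨁ (λ x → χ x ∧ (J e ∧ inc G e x)))      ≡⟨ ⨁-cong perEdge ⟩
  ⨁ (J ⊓ cut G χ)                                  ∎
  where
  open ≡-Reasoning
  perEdge : ∀ e → ⨁ (λ x → χ x ∧ (J e ∧ inc G e x)) ≡ J e ∧ cut G χ e
  perEdge e = let a = proj₁ (ends G e); b = proj₂ (ends G e) in begin
    ⨁ (λ x → χ x ∧ (J e ∧ inc G e x))
      ≡⟨ ⨁-cong (λ x → taut 4 (λ c j s t → c ∧ (j ∧ (s xor t))) (λ c j s t → j ∧ ((c ∧ s) xor (c ∧ t))) refl
                         (χ x) (J e) (a == x) (b == x)) ⟩
    ⨁ (λ x → J e ∧ ((χ ⊓ ⁅ a ⁆) ⊕ (χ ⊓ ⁅ b ⁆)) x)  ≡⟨ ⨁-∧ˡ (J e) _ ⟨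
    J e ∧ ⨁ ((χ ⊓ ⁅ a ⁆) ⊕ (χ ⊓ ⁅ b ⁆))            ≡⟨ cong (J e ∧_) (⨁-⊕ (χ ⊓ ⁅ a ⁆) (χ ⊓ ⁅ b ⁆)) ⟩
    J e ∧ (⨁ (χ ⊓ ⁅ a ⁆) xor ⨁ (χ ⊓ ⁅ b ⁆))        ≡⟨ cong₂ (λ s t → J e ∧ (s xor t)) (⨁-⁅⁆ a χ) (⨁-⁅⁆ b χ) ⟩
    J e ∧ cut G χ e                                ∎

any-subset? : ∀ {k} (P : Sub k → Set) → (∀ {p q} → p ≗ q → P p → P q) → (∀ p → Dec (P p)) → Dec (∃ P)
any-subset? P resp P? = map′ (λ (s , Ps) → lookup s , Ps)
                             (λ (p , Pp) → tabulate p , resp (sym ∘ lookup∘tabulate p) Pp)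
                             (anySubset? (λ s → P? (lookup s)))

Minimal : ∀ {k} → (Sub k → Set) → Sub k → Set
Minimal P J = P J × (∀ J′ → P J′ → count J ≤ count J′)

abstract

  minimal : ∀ {k} (P : Sub k → Set) → (∀ {p q} → p ≗ q → P p → P q) → (∀ p → Dec (P p)) → ∃ P → ∃ (Minimal P)
  minimal {k} P resp P? (J₀ , PJ₀) = go (count J₀) J₀ PJ₀ ≤-refl
    where
    go : ∀ m J → P J → count J ≤ m → ∃ (Minimal P)
    go m J PJ bound with any-subset? (λ K → P K × count K < count J)
                          (λ p≗q (Pp , lt) → resp p≗q Pp , subst (_< count J) (count-cong p≗q) lt)
                          (λ K → P? K ×-dec (count K <? count J))
    ... | no  none = J , PJ , λ J′ PJ′ → ≮⇒≥ (λ lt → none (J′ , PJ′ , lt))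
    go zero    J PJ bound | yes (K , PK , lt) = ⊥-elim (n≮0 (≤-trans lt bound))
    go (suc m) J PJ bound | yes (K , PK , lt) = go m K PK (≤-pred (≤-trans lt bound))

Off : ∀ {k} → Sub k → Sub k → Sub k → Set
Off M A B = ∀ x → M x ≡ false → A x ≡ B x

off? : ∀ {k} (M A B : Sub k) → Dec (Off M A B)
off? M A B = all? (λ x → (M x 𝔹.≟ false) →-dec (A x 𝔹.≟ B x))

≗⇒Off : ∀ {k} {M A B : Sub k} → A ≗ B → Off M A B
≗⇒Off h x _ = h x

Off-trans : ∀ {k} {M A B C : Sub k} → Off M A B → Off M B C → Off M A C
Off-trans h h′ x m = trans (h x m) (h′ x m)

count-exchange-⊕ : ∀ {k} (A B P : Sub k) → P ⊆ (A ⊕ B) → count (A ⊕ P) + count (B ⊕ P) ≡ count A + count B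
count-exchange-⊕ A B P P⊆ = count-exchange (A ⊕ P) (B ⊕ P) A B pointwise
  where
  table : ∀ a b p → (p ≡ true → a xor b ≡ true) → ⟦ a xor p ⟧ + ⟦ b xor p ⟧ ≡ ⟦ a ⟧ + ⟦ b ⟧
  table true  true  true  h = conflict (h refl) refl
  table true  false true  h = refl
  table false true  true  h = refl
  table false false true  h = conflict (h refl) refl
  table true  true  false h = refl
  table true  false false h = refl
  table false true  false h = refl
  table false false false h = refl
  pointwise : ∀ i → ⟦ A i xor P i ⟧ + ⟦ B i xor P i ⟧ ≡ ⟦ A i ⟧ + ⟦ B i ⟧
  pointwise i = table (A i) (B i) (P i) (P⊆ i)

-- Paths in edge sets

module _ {G : Graph} where

  inc-links : ∀ {e x y} → Links G e x y → inc G e ≗ ⁅ x ⁆ ⊕ ⁅ y ⁆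
  inc-links (inj₁ refl) z = refl
  inc-links {e} (inj₂ refl) z = xor-comm (proj₁ (ends G e) == z) _

  links-sym : ∀ {e x y} → Links G e x y → Links G e y x
  links-sym (inj₁ h) = inj₂ h
  links-sym (inj₂ h) = inj₁ h

  other-end : ∀ e u → inc G e u ≡ true → ∃ λ w → Links G e u w × w ≢ u
  other-end e u h with proj₁ (ends G e) ≟ u | proj₂ (ends G e) ≟ u
  ... | yes refl | no b≢u   = proj₂ (ends G e) , inj₁ refl , b≢u
  ... | no a≢u   | yes refl = proj₁ (ends G e) , inj₂ refl , a≢u

  edgeSet : ∀ {x y} → Walk G x y → ESet G
  edgeSet (stop x)     f = false
  edgeSet (step e _ w) f = (e == f) ∨ edgeSet w f

  start∈verts : ∀ {x y} (w : Walk G x y) → x ∈ verts w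
  start∈verts (stop x)     = here refl
  start∈verts (step e _ w) = here refl

  inc-end : ∀ {e x y} z → Links G e x y → inc G e z ≡ true → z ≡ x ⊎ z ≡ y
  inc-end {e} {x} {y} z l h with x ≟ z | y ≟ z | trans (sym (inc-links l z)) h
  ... | yes p | _     | _ = inj₁ (sym p)
  ... | no _  | yes q | _ = inj₂ (sym q)

  edge-ends∈verts : ∀ {x y} (w : Walk G x y) f z → edgeSet w f ≡ true → inc G f z ≡ true → z ∈ verts w
  edge-ends∈verts (step e l w) f z h hz with e ≟ f
  ... | no _ = there (edge-ends∈verts w f z h hz)
  ... | yes refl with inc-end z l hz
  ...   | inj₁ refl = here refl
  ...   | inj₂ refl = there (start∈verts w)

  ≢⇒inc : ∀ {e x y} → Links G e x y → x ≢ y → inc G e x ≡ true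
  ≢⇒inc {x = x} l x≢y = trans (inc-links l x) (cong₂ _xor_ (==-refl x) (==-≢ (x≢y ∘ sym)))

  first-edge-fresh : ∀ {x y z} {e} {l : Links G e x y} {w : Walk G y z} → IsPath (step e l w) → edgeSet w e ≡ false
  first-edge-fresh {x} {e = e} {l} {w} (x∉w ∷ _) with edgeSet w e in h
  ... | false = refl
  ... | true  = ⊥-elim (All.lookup x∉w (edge-ends∈verts w e x h
                  (≢⇒inc l (All.lookup x∉w (start∈verts w)))) refl)

  edgeSet-step : ∀ {x y z} e (l : Links G e x y) (w : Walk G y z) → IsPath (step e l w) →
                 edgeSet (step e l w) ≗ edgeSet w ⊕ ⁅ e ⁆
  edgeSet-step e l w p f with e ≟ f
  ... | yes refl rewrite first-edge-fresh {l = l} {w} p = refl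
  ... | no _ = sym (xor-identityʳ (edgeSet w f))

  ∂-path : ∀ {x y} (w : Walk G x y) → IsPath w → ∂ G (edgeSet w) ≗ ⁅ x ⁆ ⊕ ⁅ y ⁆
  ∂-path (stop x) p z = trans (⨁-zero (λ _ → refl)) (sym (xor-same (x == z)))
  ∂-path {x} {y} (step {y = x′} e l w) p@(_ ∷ pw) z = begin
    ∂ G (edgeSet (step e l w)) z                      ≡⟨ ∂-cong G (edgeSet-step e l w p) z ⟩
    ∂ G (edgeSet w ⊕ ⁅ e ⁆) z                         ≡⟨ ∂-⊕ G (edgeSet w) ⁅ e ⁆ z ⟩
    ∂ G (edgeSet w) z xor ∂ G ⁅ e ⁆ z                 ≡⟨ cong₂ _xor_ (∂-path w pw z) (trans (∂-⁅⁆ G e z) (inc-links l z)) ⟩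
    ((x′ == z) xor (y == z)) xor ((x == z) xor (x′ == z))
      ≡⟨ taut 3 (λ a b c → (a xor b) xor (c xor a)) (λ a b c → c xor b) refl (x′ == z) (y == z) (x == z) ⟩
    (x == z) xor (y == z)                             ∎
    where open ≡-Reasoning

  count-path : ∀ {x y} (F : ESet G) (w : Walk G x y) → IsPath w →
               + count (F ⊕ edgeSet w) ≡ + count F +ℤ weight F w
  count-path F (stop x) p = trans (cong +_ (count-cong {q = F} (λ f → xor-identityʳ (F f)))) (sym (ℤ.+-identityʳ _))
  count-path F (step e l w) p@(_ ∷ pw) = begin
    + count (F ⊕ edgeSet (step e l w))               ≡⟨ cong +_ (count-cong (λ f → trans (cong (F f xor_) (edgeSet-step e l w p f)) (sym (xor-assoc (F f) _ _)))) ⟩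
    + count ((F ⊕ edgeSet w) ⊕ ⁅ e ⁆)                ≡⟨ toggle (F e) refl ⟩
    sign (F e) +ℤ + count (F ⊕ edgeSet w)            ≡⟨ cong (sign (F e) +ℤ_) (count-path F w pw) ⟩
    sign (F e) +ℤ (+ count F +ℤ weight F w)          ≡⟨ ℤ.+-assoc (sign (F e)) _ _ ⟨
    (sign (F e) +ℤ + count F) +ℤ weight F w          ≡⟨ cong (_+ℤ weight F w) (ℤ.+-comm (sign (F e)) _) ⟩
    (+ count F +ℤ sign (F e)) +ℤ weight F w          ≡⟨ ℤ.+-assoc (+ count F) (sign (F e)) _ ⟩
    + count F +ℤ (sign (F e) +ℤ weight F w)          ∎
    where
    open ≡-Reasoning
    sign : Bool → ℤ
    sign b = if b then -[1+ 0 ] else + 1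
    Fe : (F ⊕ edgeSet w) e ≡ F e
    Fe = trans (cong (F e xor_) (first-edge-fresh {l = l} {w} p)) (xor-identityʳ (F e))
    toggle : ∀ b → F e ≡ b → + count ((F ⊕ edgeSet w) ⊕ ⁅ e ⁆) ≡ sign b +ℤ + count (F ⊕ edgeSet w)
    toggle true  h = cong (λ c → -[1+ 0 ] +ℤ + c) (count-toggle-in (F ⊕ edgeSet w) e (trans Fe h))
    toggle false h = cong +_ (count-toggle-out (F ⊕ edgeSet w) e (trans Fe h))

  suffix : ∀ {x y u} (w : Walk G x y) → IsPath w → u ∈ verts w →
           Σ (Walk G u y) λ w′ → IsPath w′ × edgeSet w′ ⊆ edgeSet w
  suffix (stop x)       p (here refl) = stop x , p , λ _ h → h
  suffix w@(step _ _ _) p (here refl) = w , p , λ _ h → h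
  suffix (step e l w) (_ ∷ p) (there u∈w) with suffix w p u∈w
  ... | w′ , p′ , sub = w′ , p′ , λ f h → weaken (e == f) (sub f h)
    where
    weaken : ∀ a {b} → b ≡ true → a ∨ b ≡ true
    weaken true  _ = refl
    weaken false h = h

  record OddPath (J : ESet G) (u : Fin (nV G)) : Set where
    field
      {target} : Fin (nV G)
      walk     : Walk G u target
      isPath   : IsPath walk
      target≢  : target ≢ u
      target-odd : ∂ G J target ≡ true
      inside   : edgeSet walk ⊆ J

    path : ESet G
    path = edgeSet walk

    ∂path : ∂ G path ≗ ⁅ u ⁆ ⊕ ⁅ target ⁆
    ∂path = ∂-path walk isPath

  abstract
    -- Follow an edge of J from u to w.  If w is not itself odd, delete that edge: w becomes
    -- odd and u even, so a path found from w in the rest ends at an odd vertex of J other than u.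
    oddPath : ∀ (J : ESet G) u → ∂ G J u ≡ true → OddPath J u
    oddPath J₀ u₀ = go (count J₀) J₀ u₀ ≤-refl
      where
      open DecMem (_≟_ {nV G}) using (_∈?_)
      go : ∀ m J u → count J ≤ m → ∂ G J u ≡ true → OddPath J u
      go m J u bound odd with ⨁-witness (λ e → J e ∧ inc G e u) odd
      ... | e , h with J e in Je | inc G e u in eu
      ...   | true | true with other-end e u eu
      ...     | w , l , w≢u with ∂ G J w in ∂w
      ...       | true = record
                  { walk = step e l (stop w)
                  ; isPath = ((w≢u ∘ sym) ∷ []) ∷ [] ∷ []
                  ; target≢ = w≢u
                  ; target-odd = ∂w
                  ; inside = λ f h → subst (λ f → J f ≡ true) (==-≡ (trans (sym (𝔹.∨-identityʳ (e == f))) h)) Je }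
      ...       | false with m | subst (_≤ m) (sym (count-toggle-in J e Je)) bound
      ...         | suc m′ | s≤s bound′ = extend (go m′ J′ w bound′ oddw)
        where
        J′ : ESet G
        J′ = J ⊕ ⁅ e ⁆
        ∂J′ : ∀ z → ∂ G J′ z ≡ ∂ G J z xor ((u == z) xor (w == z))
        ∂J′ z = trans (∂-⊕ G J ⁅ e ⁆ z) (cong (∂ G J z xor_) (trans (∂-⁅⁆ G e z) (inc-links l z)))
        oddw : ∂ G J′ w ≡ true
        oddw = trans (∂J′ w) (cong₂ _xor_ ∂w (cong₂ _xor_ (==-≢ (w≢u ∘ sym)) (==-refl w)))
        evenu : ∂ G J′ u ≡ false
        evenu = trans (∂J′ u) (cong₂ _xor_ odd (cong₂ _xor_ (==-refl u) (==-≢ w≢u)))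
        J′⊆J : J′ ⊆ J
        J′⊆J f h with e ≟ f
        ... | yes refl = Je
        ... | no _ = trans (sym (xor-identityʳ (J f))) h
        extend : OddPath J′ w → OddPath J u
        extend Q = reroute (u ∈? verts walk)
          where
          open OddPath Q
          v≢u : target ≢ u
          v≢u v≡u = conflict target-odd (trans (cong (∂ G J′) v≡u) evenu)
          v-odd : ∂ G J target ≡ true
          v-odd = trans (sym (trans (∂J′ target)
                    (trans (cong (∂ G J target xor_) (cong₂ _xor_ (==-≢ (v≢u ∘ sym)) (==-≢ (target≢ ∘ sym))))
                           (xor-identityʳ _)))) target-odd
          inside′ : edgeSet (step e l walk) ⊆ J
          inside′ f h with e ≟ f
          ... | yes refl = Je
          ... | no _ = J′⊆J f (inside f h)
          reroute : Dec (u ∈ verts walk) → OddPath J u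
          reroute (no u∉) = record
            { walk = step e l walk ; isPath = ¬Any⇒All¬ _ u∉ ∷ isPath
            ; target≢ = v≢u ; target-odd = v-odd ; inside = inside′ }
          reroute (yes u∈) with suffix walk isPath u∈
          ... | w′ , p′ , sub = record
            { walk = w′ ; isPath = p′
            ; target≢ = v≢u ; target-odd = v-odd ; inside = λ f h → J′⊆J f (inside f (sub f h)) }

-- Distances as sizes of joins

+ℤ-cancelˡ-≤ : ∀ a {b c} → a +ℤ b ≤ℤ a +ℤ c → b ≤ℤ c
+ℤ-cancelˡ-≤ a {b} {c} h = ℤ.≤-trans (ℤ.≤-reflexive (sym (drop b)))
  (ℤ.≤-trans (ℤ.+-monoʳ-≤ (- a) h) (ℤ.≤-reflexive (drop c)))
  where
  drop : ∀ d → - a +ℤ (a +ℤ d) ≡ d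
  drop d = trans (sym (ℤ.+-assoc (- a) a d)) (trans (cong (_+ℤ d) (ℤ.+-inverseˡ a)) (ℤ.+-identityˡ d))

≤ℤ⇒≤ : ∀ {a b} → + a ≤ℤ + b +ℤ + 0 → a ≤ b
≤ℤ⇒≤ {a} {b} h with subst (+ a ≤ℤ_) (ℤ.+-identityʳ (+ b)) h
... | +≤+ a≤b = a≤b

≤⇒≤ℤ : ∀ {a b} → a ≤ b → + a ≤ℤ + b +ℤ + 0
≤⇒≤ℤ {a} {b} a≤b = subst (+ a ≤ℤ_) (sym (ℤ.+-identityʳ (+ b))) (+≤+ a≤b)

≤ℤ⇒< : ∀ {a b} → + a ≤ℤ + b +ℤ -[1+ 0 ] → a < b
≤ℤ⇒< {b = suc b} (+≤+ a≤b) = s≤s a≤b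

<⇒≤ℤ : ∀ {a b} → a < b → + a ≤ℤ + b +ℤ -[1+ 0 ]
<⇒≤ℤ (s≤s a≤b) = +≤+ a≤b

record IsLeast (G : Graph) (M T : VSet G) (F : ESet G) : Set where
  field
    join  : ∂ G F ≗ T
    least : ∀ J → Off M (∂ G J) T → count F ≤ count J

module _ {G : Graph} {T : VSet G} {F : ESet G} where

  LamLe⇒join : ∂ G F ≗ T → ∀ {x y k} → LamLe G F x y k →
               ∃ λ J → ∂ G J ≗ T ⊕ ⁅ x ⁆ ⊕ ⁅ y ⁆ × + count J ≤ℤ + count F +ℤ k
  LamLe⇒join ∂F {x} {y} {k} (w , p , w≤k) = F ⊕ edgeSet w , ∂J
    , subst (_≤ℤ + count F +ℤ k) (sym (count-path F w p)) (ℤ.+-monoʳ-≤ (+ count F) w≤k)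
    where
    ∂J : ∂ G (F ⊕ edgeSet w) ≗ T ⊕ ⁅ x ⁆ ⊕ ⁅ y ⁆
    ∂J z = trans (∂-⊕ G F (edgeSet w) z) (trans (cong₂ _xor_ (∂F z) (∂-path w p z)) (sym (xor-assoc (T z) _ _)))

  LamGe-0 : ∂ G F ≗ T → ∀ {x y} → (∀ J → ∂ G J ≗ T ⊕ ⁅ x ⁆ ⊕ ⁅ y ⁆ → count F ≤ count J) → LamGe G F x y (+ 0)
  LamGe-0 ∂F h w p = ℤ.≮⇒≥ λ w<0 → bad (LamLe⇒join ∂F (w , p , negative w<0))
    where
    negative : ∀ {i} → i ℤ.< + 0 → i ≤ℤ -[1+ 0 ]
    negative -<+ = -≤- z≤n
    negative (+<+ ())
    bad : (∃ λ J → ∂ G J ≗ T ⊕ ⁅ _ ⁆ ⊕ ⁅ _ ⁆ × + count J ≤ℤ + count F +ℤ -[1+ 0 ]) → ⊥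
    bad (J , ∂J , J<F) = <⇒≱ (≤ℤ⇒< J<F) (h J ∂J)

  LamGe⇒≤ : ∂ G F ≗ T → ∀ {x y} → LamGe G F x y (+ 0) → ¬ LamLe G F x y -[1+ 0 ]
  LamGe⇒≤ ∂F ge (w , p , le) with ℤ.≤-trans (ge w p) le
  ... | ()

  join⇒LamLe : IsLeast G ∅ T F → ∀ {x y} J {k} → ∂ G J ≗ T ⊕ ⁅ x ⁆ ⊕ ⁅ y ⁆ → + count J ≤ℤ + count F +ℤ k →
               LamLe G F x y k
  join⇒LamLe min {x} {y} J {k} ∂J J≤ with x ≟ y
  ... | yes refl = stop x , ([] ∷ []) , +ℤ-cancelˡ-≤ (+ count F)
          (ℤ.≤-trans (ℤ.≤-reflexive (ℤ.+-identityʳ _)) (ℤ.≤-trans (+≤+ F≤J) J≤))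
    where
    open IsLeast min
    F≤J : count F ≤ count J
    F≤J = least J λ z _ → trans (∂J z) (taut 2 (λ a b → (a xor b) xor b) (λ a b → a) refl (T z) (x == z))
  ... | no x≢y = subst (λ v → LamLe G F x v k) target≡y (walk , isPath , weight≤k)
    where
    open IsLeast min
    Δ : ESet G
    Δ = F ⊕ J
    ∂Δ : ∂ G Δ ≗ ⁅ x ⁆ ⊕ ⁅ y ⁆
    ∂Δ z = trans (∂-⊕ G F J z) (trans (cong₂ _xor_ (join z) (∂J z))
             (taut 3 (λ t a b → t xor ((t xor a) xor b)) (λ t a b → a xor b) refl (T z) (x == z) (y == z)))
    open OddPath (oddPath {G} Δ x (trans (∂Δ x) (cong₂ _xor_ (==-refl x) (==-≢ (x≢y ∘ sym)))))
    target≡y : target ≡ y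
    target≡y = sym (==-≡ (trans (sym (trans (∂Δ target) (cong (_xor (y == target)) (==-≢ (target≢ ∘ sym))))) target-odd))
    F≤J⊕P : count F ≤ count (J ⊕ path)
    F≤J⊕P = least (J ⊕ path) λ z _ → trans (∂-⊕ G J path z) (trans (cong₂ _xor_ (∂J z)
              (trans (∂path z) (cong (λ v → (x == z) xor (v == z)) target≡y)))
              (taut 3 (λ t a b → ((t xor a) xor b) xor (a xor b)) (λ t a b → t) refl (T z) (x == z) (y == z)))
    F⊕P≤J : count (F ⊕ path) ≤ count J
    F⊕P≤J = +-cancelʳ-≤ (count F) _ _ (≤-trans (+-monoʳ-≤ (count (F ⊕ path)) F≤J⊕P)
              (≤-reflexive (trans (count-exchange-⊕ F J path inside) (+-comm (count F) (count J)))))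
    weight≤k : weight F walk ≤ℤ k
    weight≤k = +ℤ-cancelˡ-≤ (+ count F)
      (ℤ.≤-trans (ℤ.≤-reflexive (sym (count-path F walk isPath))) (ℤ.≤-trans (+≤+ F⊕P≤J) J≤))

  -- Odd vertices of F ⊕ J lie in X; toggling a path of F ⊕ J between two of them does not
  -- enlarge J and brings it closer to F.
  pairwise⇒IsLeast : IsLeast G ∅ T F → (X : VSet G) →
    (∀ x y → X x ≡ true → X y ≡ true → ∀ J → ∂ G J ≗ T ⊕ ⁅ x ⁆ ⊕ ⁅ y ⁆ → count F ≤ count J) → IsLeast G X T F
  pairwise⇒IsLeast min X pair = record { join = join ; least = λ J → go (count (F ⊕ J)) J ≤-refl }
    where
    open IsLeast min
    go : ∀ m J → count (F ⊕ J) ≤ m → Off X (∂ G J) T → count F ≤ count J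
    go m J bound ∂J with any? (λ x → ∂ G (F ⊕ J) x 𝔹.≟ true)
    ... | no even = least J λ z _ → sym (same (trans (cong (_xor ∂ G J z) (sym (join z))) (trans (sym (∂-⊕ G F J z)) (¬-not (λ odd → even (z , odd))))))
      where
      same : ∀ {a b} → a xor b ≡ false → a ≡ b
      same {true}  {true}  _ = refl
      same {false} {false} _ = refl
    ... | yes (x , odd) = shrink m bound
      where
      open OddPath (oddPath {G} (F ⊕ J) x odd)
      odd⇒X : ∀ z → ∂ G (F ⊕ J) z ≡ true → X z ≡ true
      odd⇒X z h with X z in Xz
      ... | true  = refl
      ... | false = conflict h (trans (∂-⊕ G F J z) (trans (cong₂ _xor_ (join z) (∂J z Xz)) (xor-same (T z))))
      F≤F⊕P : count F ≤ count (F ⊕ path)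
      F≤F⊕P = pair x target (odd⇒X x odd) (odd⇒X target target-odd) (F ⊕ path)
        λ z → trans (∂-⊕ G F path z) (trans (cong₂ _xor_ (join z) (∂path z)) (sym (xor-assoc (T z) _ _)))
      J⊕P≤J : count (J ⊕ path) ≤ count J
      J⊕P≤J = +-cancelˡ-≤ (count F) _ _ (≤-trans (+-monoˡ-≤ (count (J ⊕ path)) F≤F⊕P)
                (≤-reflexive (count-exchange-⊕ F J path inside)))
      ∂J⊕P : Off X (∂ G (J ⊕ path)) T
      ∂J⊕P z Xz = trans (∂-⊕ G J path z) (trans (cong₂ _xor_ (∂J z Xz) (trans (∂path z)
          (cong₂ _xor_ (==-≢ (λ x≡z → conflict (odd⇒X x odd) (trans (cong X x≡z) Xz)))
                       (==-≢ (λ v≡z → conflict (odd⇒X target target-odd) (trans (cong X v≡z) Xz))))))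
          (xor-identityʳ (T z)))
      edge-of-path : ∃ λ e → path e ≡ true
      edge-of-path with ⨁-witness (λ e → path e ∧ inc G e x)
                          (trans (∂path x) (cong₂ _xor_ (==-refl x) (==-≢ target≢)))
      ... | e , h with path e in pe
      ...   | true = e , pe
      closer : suc (count (F ⊕ (J ⊕ path))) ≤ count (F ⊕ J)
      closer = begin
        suc (count (F ⊕ (J ⊕ path)))               ≤⟨ +-monoˡ-≤ _ (count-positive path _ (proj₂ edge-of-path)) ⟩
        count path + count (F ⊕ (J ⊕ path))        ≡⟨ +-comm (count path) _ ⟩
        count (F ⊕ (J ⊕ path)) + count path        ≡⟨ count-exchange (F ⊕ (J ⊕ path)) path (F ⊕ J) ∅ pointwise ⟩
        count (F ⊕ J) + count {nE G} ∅             ≡⟨ cong (λ c → count (F ⊕ J) + c) (count-∅ (nE G)) ⟩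
        count (F ⊕ J) + 0                          ≡⟨ +-identityʳ _ ⟩
        count (F ⊕ J)                              ∎
        where
        open ≤-Reasoning
        table : ∀ a b p → (p ≡ true → a xor b ≡ true) → ⟦ a xor (b xor p) ⟧ + ⟦ p ⟧ ≡ ⟦ a xor b ⟧ + 0
        table true  true  true  h = conflict (h refl) refl
        table true  false true  h = refl
        table false true  true  h = refl
        table false false true  h = conflict (h refl) refl
        table true  true  false h = refl
        table true  false false h = refl
        table false true  false h = refl
        table false false false h = refl
        pointwise : ∀ e → ⟦ F e xor (J e xor path e) ⟧ + ⟦ path e ⟧ ≡ ⟦ F e xor J e ⟧ + 0
        pointwise e = table (F e) (J e) (path e) (inside e)
      shrink : ∀ m → count (F ⊕ J) ≤ m → count F ≤ count J
      shrink zero    bound = ⊥-elim (n≮0 (≤-trans closer bound))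
      shrink (suc m) bound = ≤-trans (go m (J ⊕ path) (≤-pred (≤-trans closer bound)) ∂J⊕P) J⊕P≤J

  Off⇒≗ : ∀ {M} → IsLeast G M T F → ∀ {y} → M y ≡ false → ∀ J → Off M (∂ G J) (T ⊕ ⁅ y ⁆) →
          ∃ λ x → M x ≡ true × ∃ λ J′ → ∂ G J′ ≗ T ⊕ ⁅ x ⁆ ⊕ ⁅ y ⁆ × count J′ ≤ count J
  Off⇒≗ {M} min {y} My J ∂J = target , target∈M , F ⊕ path
      , (λ z → trans (∂-⊕ G F path z) (trans (cong₂ _xor_ (join z) (∂path z))
                 (taut 3 (λ t a b → t xor (a xor b)) (λ t a b → (t xor b) xor a) refl (T z) (y == z) (target == z))))
      , +-cancelʳ-≤ (count F) _ _ (≤-trans (+-monoʳ-≤ (count (F ⊕ path)) F≤J⊕P)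
          (≤-reflexive (trans (count-exchange-⊕ F J path inside) (+-comm (count F) (count J)))))
    where
    open IsLeast min
    ∂Δ : Off M (∂ G (F ⊕ J)) ⁅ y ⁆
    ∂Δ z Mz = trans (∂-⊕ G F J z) (trans (cong₂ _xor_ (join z) (∂J z Mz))
                (taut 2 (λ t a → t xor (t xor a)) (λ t a → a) refl (T z) (y == z)))
    open OddPath (oddPath {G} (F ⊕ J) y (trans (∂Δ y My) (==-refl y)))
    target∈M : M target ≡ true
    target∈M with M target in Mv
    ... | true  = refl
    ... | false = conflict target-odd (trans (∂Δ target Mv) (==-≢ (target≢ ∘ sym)))
    F≤J⊕P : count F ≤ count (J ⊕ path)
    F≤J⊕P = least (J ⊕ path) λ z Mz → trans (∂-⊕ G J path z) (trans (cong₂ _xor_ (∂J z Mz)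
              (trans (∂path z) (cong ((y == z) xor_) (==-≢ (λ v≡z → conflict target∈M (trans (cong M v≡z) Mz))))))
              (taut 2 (λ t a → (t xor a) xor (a xor false)) (λ t a → t) refl (T z) (y == z)))

-- Separation inside a component

≤-absurd : ∀ {a b} k → a ≤ b → a ≡ suc (b + k) → ⊥
≤-absurd {b = b} k a≤b a≡ = <⇒≱ (s≤s (m≤m+n b k)) (≤-trans (≤-reflexive (sym a≡)) a≤b)

infixr 5 _+≤_
_+≤_ : ∀ {a b c d} → a ≤ b → c ≤ d → a + c ≤ b + d
_+≤_ = +-mono-≤

one-of-two : ∀ {k} (y z : Fin k) {u v} → v ≢ u → ((⁅ y ⁆ ⊕ ⁅ z ⁆) ⊕ ⁅ u ⁆) v ≡ true → v ≡ y ⊎ v ≡ z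
one-of-two y z {u} {v} v≢u h with y ≟ v | z ≟ v
... | yes y≡v | _       = inj₁ (sym y≡v)
... | no _    | yes z≡v = inj₂ (sym z≡v)
... | no _    | no _    = conflict h (==-≢ (v≢u ∘ sym))

module _ (G : Graph) {M : VSet G} where

  Off-⊕ : ∀ {A B : ESet G} {U W R : VSet G} → Off M (∂ G A) U → Off M (∂ G B) W →
          (∀ x → U x xor W x ≡ R x) → Off M (∂ G (A ⊕ B)) R
  Off-⊕ {A} {B} ∂A ∂B h x Mx = trans (∂-⊕ G A B x) (trans (cong₂ _xor_ (∂A x Mx) (∂B x Mx)) (h x))

  Off-edge : ∀ {e y u} → Links G e y u → Off M (∂ G ⁅ e ⁆) (⁅ y ⁆ ⊕ ⁅ u ⁆)
  Off-edge {e} l x _ = trans (∂-⁅⁆ G e x) (inc-links {G} {e} l x)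

  Off-edge-M : ∀ {e y u} → Links G e y u → M y ≡ true → Off M (∂ G ⁅ e ⁆) ⁅ u ⁆
  Off-edge-M {e} {y} {u} l My x Mx = trans (Off-edge l x Mx)
    (cong (_xor (u == x)) (==-≢ (λ y≡x → conflict My (trans (cong M y≡x) Mx))))

module _ (𝔾 : BGraft) where

  links-col : ∀ {e x y} → Links (graph 𝔾) e x y → col 𝔾 y ≡ not (col 𝔾 x)
  links-col {e} (inj₁ refl) = bip 𝔾 e
  links-col {e} (inj₂ refl) = trans (sym (𝔹.not-involutive _)) (cong not (sym (bip 𝔾 e)))

  links-≢ : ∀ {e x y} → Links (graph 𝔾) e x y → x ≢ y
  links-≢ {x = x} l refl = 𝔹.not-¬ {col 𝔾 x} refl (links-col l)

-- All sizes are compared modulo M: a set of edges is a join when its degree parities are right off M.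
-- M lies in one colour class, so the other class, where all parities are known, fixes |J| mod 2.
module Parity (𝔾 : BGraft) {M : VSet (graph 𝔾)} {F : ESet (graph 𝔾)} (min : IsLeast (graph 𝔾) M (T 𝔾) F)
              (c : Bool) (M-col : ∀ x → M x ≡ true → col 𝔾 x ≡ c) where

  private
    Γ = graph 𝔾
    n = count F
    open IsLeast min

  χ : VSet Γ
  χ x = col 𝔾 x xor c

  parity : ∀ {U} J → Off M (∂ Γ J) U → isOdd (count J) ≡ ⨁ (χ ⊓ U)
  parity {U} J ∂J = begin
    isOdd (count J)    ≡⟨ isOdd-count J ⟩
    ⨁ J                ≡⟨ ⨁-cong (λ e → sym (trans (cong (J e ∧_) (crossing e)) (𝔹.∧-identityʳ (J e)))) ⟩
    ⨁ (J ⊓ cut Γ χ)    ≡⟨ ⨁-∂ Γ χ J ⟨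
    ⨁ (χ ⊓ ∂ Γ J)      ≡⟨ ⨁-cong agree ⟩
    ⨁ (χ ⊓ U)          ∎
    where
    open ≡-Reasoning
    crossing : ∀ e → cut Γ χ e ≡ true
    crossing e = trans (cong (λ b → (col 𝔾 (proj₁ (ends Γ e)) xor c) xor (b xor c)) (bip 𝔾 e))
      (taut 2 (λ a b → (a xor b) xor (not a xor b)) (λ a b → true) refl (col 𝔾 (proj₁ (ends Γ e))) c)
    agree : ∀ x → χ x ∧ ∂ Γ J x ≡ χ x ∧ U x
    agree x with M x in Mx
    ... | false = cong (χ x ∧_) (∂J x Mx)
    ... | true rewrite M-col x Mx | xor-same c = refl

  ⨁χ⊕ : ∀ U y → ⨁ (χ ⊓ (U ⊕ ⁅ y ⁆)) ≡ ⨁ (χ ⊓ U) xor χ y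
  ⨁χ⊕ U y = trans (⨁-cong (λ x → 𝔹.∧-distribˡ-xor (χ x) (U x) (y == x)))
                  (trans (⨁-⊕ (χ ⊓ U) (χ ⊓ ⁅ y ⁆)) (cong (⨁ (χ ⊓ U) xor_) (⨁-⁅⁆ y χ)))

  isOdd-n : isOdd n ≡ ⨁ (χ ⊓ T 𝔾)
  isOdd-n = parity F (≗⇒Off join)

module Levels (𝔾 : BGraft) {M : VSet (graph 𝔾)} {F : ESet (graph 𝔾)} (min : IsLeast (graph 𝔾) M (T 𝔾) F)
              (c : Bool) (M-col : ∀ x → M x ≡ true → col 𝔾 x ≡ c)
              (reach : ∀ u → ∃ λ J → Off M (∂ (graph 𝔾) J) (T 𝔾 ⊕ ⁅ u ⁆)) where

  private
    Γ = graph 𝔾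
    n = count F
    open IsLeast min

  open Parity 𝔾 min c M-col public

  Off-resp : ∀ {U : VSet Γ} {J K : ESet Γ} → J ≗ K → Off M (∂ Γ J) U → Off M (∂ Γ K) U
  Off-resp J≗K ∂J x Mx = trans (sym (∂-cong Γ J≗K x)) (∂J x Mx)

  abstract
    optimum : ∀ u → ∃ (Minimal (λ J → Off M (∂ Γ J) (T 𝔾 ⊕ ⁅ u ⁆)))
    optimum u = minimal _ Off-resp (λ J → off? M (∂ Γ J) (T 𝔾 ⊕ ⁅ u ⁆)) (reach u)

  nearest : Fin (nV Γ) → ESet Γ
  nearest u = proj₁ (optimum u)

  ∂nearest : ∀ u → Off M (∂ Γ (nearest u)) (T 𝔾 ⊕ ⁅ u ⁆)
  ∂nearest u = proj₁ (proj₂ (optimum u))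

  ℓ : Fin (nV Γ) → ℕ
  ℓ u = count (nearest u)

  ℓ-least : ∀ u J → Off M (∂ Γ J) (T 𝔾 ⊕ ⁅ u ⁆) → ℓ u ≤ count J
  ℓ-least u = proj₂ (proj₂ (optimum u))

  isOdd-ℓ : ∀ u → isOdd (ℓ u) ≡ isOdd n xor χ u
  isOdd-ℓ u = trans (parity (nearest u) (∂nearest u)) (trans (⨁χ⊕ (T 𝔾) u) (cong (_xor χ u) (sym isOdd-n)))

  links-ℓ≢ : ∀ {e y u} → Links Γ e y u → ℓ u ≢ ℓ y
  links-ℓ≢ {y = y} {u} l ℓ≡ = 𝔹.not-¬ {χ y} refl (trans (sym (xor-injʳ (isOdd n) (χ u) (χ y)
      (trans (sym (isOdd-ℓ u)) (trans (cong isOdd ℓ≡) (isOdd-ℓ y)))))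
      (trans (cong (_xor c) (links-col 𝔾 l)) (sym (𝔹.not-distribˡ-xor (col 𝔾 y) c))))
    where
    xor-injʳ : ∀ a b d → a xor b ≡ a xor d → b ≡ d
    xor-injʳ true  true  true  _ = refl
    xor-injʳ true  false false _ = refl
    xor-injʳ false b     d     h = h

  -- s = 0 when M is an extreme set of the whole graft; s = 1 when M is the root of a tooth, where ℓ u = n may occur.
  module Spread (s : ℕ) (s≤1 : s ≤ 1) where

    Close : Fin (nV Γ) → Set
    Close u = suc (ℓ u) ≤ n + s

    Apart : Fin (nV Γ) → Fin (nV Γ) → Set
    Apart y z = ∀ J → Off M (∂ Γ J) (T 𝔾 ⊕ ⁅ y ⁆ ⊕ ⁅ z ⁆) → suc (ℓ y + ℓ z) ≤ count J + (n + (s + s))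

    apart-refl : ∀ {z} → Close z → Apart z z
    apart-refl {z} close J ∂J = ≮⇒≥ λ lt → ≤-absurd 1 (lt +≤ close +≤ close +≤ n≤J) (arith (count J) (ℓ z) n s)
      where
      n≤J : n ≤ count J
      n≤J = least J λ x Mx → trans (∂J x Mx) (taut 2 (λ t a → (t xor a) xor a) (λ t a → t) refl (T 𝔾 x) (z == x))
      arith : ∀ j l n s → suc (j + (n + (s + s))) + (suc l + (suc l + n)) ≡ suc (suc (l + l) + ((n + s) + ((n + s) + j)) + 1)
      arith = solve-∀

    -- Suppose J violates Apart y z.  Then ℓ u < ℓ y, and J ⊕ nearest u contains a path from u to
    -- y, to z or into M.  Toggling that path in both J and nearest u keeps the total size, and
    -- after a further toggle of e the two new sets are again subject to the known lower bounds.
    apart-step : ∀ {e y u z} → Links Γ e y u → Close y → Close z → Apart u z → Apart y z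
    apart-step {e} {y} {u} {z} l close-y close-z apart J ∂J = ≮⇒≥ absurd
      where
      K = n + (s + s)
      J·e = J ⊕ ⁅ e ⁆
      ∂J·e : Off M (∂ Γ J·e) (T 𝔾 ⊕ ⁅ u ⁆ ⊕ ⁅ z ⁆)
      ∂J·e = Off-⊕ Γ ∂J (Off-edge Γ l) λ x → taut 4 (λ t a b d → ((t xor a) xor b) xor (a xor d)) (λ t a b d → (t xor d) xor b) refl
               (T 𝔾 x) (y == x) (z == x) (u == x)
      absurd : count J + K < suc (ℓ y + ℓ z) → ⊥
      absurd (s≤s violated) = finish (M target) refl
        where
        ℓu≤ℓy : ℓ u ≤ ℓ y
        ℓu≤ℓy = +-cancelʳ-≤ (ℓ z) _ _ (≤-pred (≤-trans (apart J·e ∂J·e)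
                  (≤-trans (+-monoˡ-≤ K (count-toggle-≤ J e)) (s≤s violated))))
        ℓu<ℓy : suc (ℓ u) ≤ ℓ y
        ℓu<ℓy = ≤∧≢⇒< ℓu≤ℓy (links-ℓ≢ l)
        ℓu : suc (suc (ℓ u)) ≤ n + s
        ℓu = ≤-trans (s≤s ℓu<ℓy) close-y
        u∉M : M u ≡ false
        u∉M = ¬-not λ Mu → <⇒≱ (≤-trans ℓu (≤-trans (+-monoʳ-≤ n s≤1) (≤-reflexive (+-comm n 1))))
          (s≤s (least (nearest u) λ x Mx → trans (∂nearest u x Mx)
            (trans (cong (T 𝔾 x xor_) (==-≢ (λ u≡x → conflict Mu (trans (cong M u≡x) Mx)))) (xor-identityʳ (T 𝔾 x)))))
        z≢u : z ≢ u
        z≢u refl = ≤-absurd 1 (n≤sucJ +≤ violated +≤ close-y +≤ ℓu) (arith (count J) (ℓ y) (ℓ u) n s)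
          where
          n≤sucJ : n ≤ suc (count J)
          n≤sucJ = ≤-trans (least J·e λ x Mx → trans (∂J·e x Mx) (taut 2 (λ t a → (t xor a) xor a) (λ t a → t) refl (T 𝔾 x) (u == x)))
                           (count-toggle-≤ J e)
          arith : ∀ j ly lu n s → n + ((j + (n + (s + s))) + (suc ly + suc (suc lu)))
                                ≡ suc (suc j + ((ly + lu) + ((n + s) + (n + s))) + 1)
          arith = solve-∀
        ∂Δ : Off M (∂ Γ (J ⊕ nearest u)) ((⁅ y ⁆ ⊕ ⁅ z ⁆) ⊕ ⁅ u ⁆)
        ∂Δ = Off-⊕ Γ ∂J (∂nearest u) λ x → taut 4 (λ t a b d → ((t xor a) xor b) xor (t xor d)) (λ t a b d → (a xor b) xor d) refl
               (T 𝔾 x) (y == x) (z == x) (u == x)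
        open OddPath (oddPath {Γ} (J ⊕ nearest u) u (trans (∂Δ u u∉M)
               (cong₂ _xor_ (cong₂ _xor_ (==-≢ (links-≢ 𝔾 l)) (==-≢ z≢u)) (==-refl u))))
        a = count (J ⊕ path)
        b = count (nearest u ⊕ path)
        swap : a + b ≤ count J + ℓ u
        swap = ≤-reflexive (count-exchange-⊕ J (nearest u) path inside)
        P : Off M (∂ Γ path) (⁅ u ⁆ ⊕ ⁅ target ⁆)
        P = ≗⇒Off ∂path

        into-M : M target ≡ true → ⊥
        into-M Mv = ≤-absurd 1 (n≤b +≤ ℓz≤a +≤ swap +≤ violated +≤ close-y +≤ ℓu) (arith a b (count J) (ℓ y) (ℓ u) (ℓ z) n s)
          where
          P-M : Off M (∂ Γ path) ⁅ u ⁆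
          P-M x Mx = trans (P x Mx) (trans (cong ((u == x) xor_) (==-≢ (λ v≡x → conflict Mv (trans (cong M v≡x) Mx)))) (xor-identityʳ _))
          n≤b : n ≤ b
          n≤b = least (nearest u ⊕ path) (Off-⊕ Γ (∂nearest u) P-M λ x → taut 2 (λ t d → (t xor d) xor d) (λ t d → t) refl (T 𝔾 x) (u == x))
          ℓz≤a : ℓ z ≤ suc a
          ℓz≤a = ≤-trans (ℓ-least z ((J ⊕ path) ⊕ ⁅ e ⁆)
                   (Off-⊕ Γ (Off-⊕ Γ ∂J P-M (λ x → refl)) (Off-edge Γ l) λ x →
                     taut 4 (λ t a b d → (((t xor a) xor b) xor d) xor (a xor d)) (λ t a b d → t xor b) refl (T 𝔾 x) (y == x) (z == x) (u == x)))
                   (count-toggle-≤ (J ⊕ path) e)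
          arith : ∀ a b j ly lu lz n s → n + (lz + ((a + b) + ((j + (n + (s + s))) + (suc ly + suc (suc lu)))))
                                       ≡ suc (b + (suc a + ((j + lu) + ((ly + lz) + ((n + s) + (n + s))))) + 1)
          arith = solve-∀

        to-y : target ≡ y → ⊥
        to-y v≡y = ≤-absurd 0 (ℓy≤b +≤ uz≤a +≤ swap +≤ violated) (arith a b (count J) (ℓ y) (ℓ u) (ℓ z) K)
          where
          ℓy≤b : ℓ y ≤ b
          ℓy≤b = ℓ-least y (nearest u ⊕ path) (Off-⊕ Γ (∂nearest u) P λ x → trans (cong (λ v → (T 𝔾 x xor (u == x)) xor ((u == x) xor (v == x))) v≡y)
                   (taut 3 (λ t d a → (t xor d) xor (d xor a)) (λ t d a → t xor a) refl (T 𝔾 x) (u == x) (y == x)))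
          uz≤a : suc (ℓ u + ℓ z) ≤ a + K
          uz≤a = apart (J ⊕ path) (Off-⊕ Γ ∂J P λ x → trans (cong (λ v → ((T 𝔾 x xor (y == x)) xor (z == x)) xor ((u == x) xor (v == x))) v≡y)
                   (taut 4 (λ t a b d → ((t xor a) xor b) xor (d xor a)) (λ t a b d → (t xor d) xor b) refl (T 𝔾 x) (y == x) (z == x) (u == x)))
          arith : ∀ a b j ly lu lz k → ly + (suc (lu + lz) + ((a + b) + (j + k))) ≡ suc (b + ((a + k) + ((j + lu) + (ly + lz))) + 0)
          arith = solve-∀

        to-z : target ≡ z → ⊥
        to-z v≡z = ≤-absurd 1 (ℓz≤b +≤ n≤a +≤ swap +≤ violated +≤ close-y +≤ ℓu) (arith a b (count J) (ℓ y) (ℓ u) (ℓ z) n s)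
          where
          ℓz≤b : ℓ z ≤ b
          ℓz≤b = ℓ-least z (nearest u ⊕ path) (Off-⊕ Γ (∂nearest u) P λ x → trans (cong (λ v → (T 𝔾 x xor (u == x)) xor ((u == x) xor (v == x))) v≡z)
                   (taut 3 (λ t d a → (t xor d) xor (d xor a)) (λ t d a → t xor a) refl (T 𝔾 x) (u == x) (z == x)))
          n≤a : n ≤ suc a
          n≤a = ≤-trans (least ((J ⊕ path) ⊕ ⁅ e ⁆) (Off-⊕ Γ (Off-⊕ Γ ∂J P λ x → refl) (Off-edge Γ l) λ x →
                  trans (cong (λ v → (((T 𝔾 x xor (y == x)) xor (z == x)) xor ((u == x) xor (v == x))) xor ((y == x) xor (u == x))) v≡z)
                    (taut 4 (λ t a b d → (((t xor a) xor b) xor (d xor b)) xor (a xor d)) (λ t a b d → t) refl (T 𝔾 x) (y == x) (z == x) (u == x))))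
                  (count-toggle-≤ (J ⊕ path) e)
          arith : ∀ a b j ly lu lz n s → lz + (n + ((a + b) + ((j + (n + (s + s))) + (suc ly + suc (suc lu)))))
                                       ≡ suc (b + (suc a + ((j + lu) + ((ly + lz) + ((n + s) + (n + s))))) + 1)
          arith = solve-∀

        finish : ∀ b → M target ≡ b → ⊥
        finish true  Mv = into-M Mv
        finish false Mv = [ to-y , to-z ]′ (one-of-two y z target≢ (trans (sym (∂Δ target Mv)) target-odd))

-- Induced subgraphs

in-image? : ∀ {m k} (κ : Fin m → Fin k) e → (∃ λ f → κ f ≡ e) ⊎ (∀ f → κ f ≢ e)
in-image? κ e with any? (λ f → κ f ≟ e)
... | yes p = inj₁ p
... | no ¬p = inj₂ λ f κf≡e → ¬p (f , κf≡e)

module Push {m k} (κ : Fin m → Fin k) (κ-inj : ∀ e f → κ e ≡ κ f → e ≡ f) where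

  push : Sub m → Sub k
  push J e = ⨁ (λ f → J f ∧ (κ f == e))

  push-κ : ∀ J f → push J (κ f) ≡ J f
  push-κ J f = trans (⨁-one f λ f′ f′≢f → trans (cong (J f′ ∧_) (==-≢ (f′≢f ∘ κ-inj f′ f))) (𝔹.∧-zeroʳ (J f′)))
                     (trans (cong (J f ∧_) (==-refl (κ f))) (𝔹.∧-identityʳ (J f)))

  push-out : ∀ J {e} → (∀ f → κ f ≢ e) → push J e ≡ false
  push-out J e∉ = ⨁-zero λ f → trans (cong (J f ∧_) (==-≢ (e∉ f))) (𝔹.∧-zeroʳ (J f))

  push-image : ∀ J {e} → push J e ≡ true → ∃ λ f → κ f ≡ e × J f ≡ true
  push-image J {e} h with in-image? κ e
  ... | inj₁ (f , refl) = f , refl , trans (sym (push-κ J f)) h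
  ... | inj₂ e∉ = conflict h (push-out J e∉)

  count-push : ∀ J → count (push J) ≡ count J
  count-push J = trans (count-reindex κ κ-inj (push J) (λ e h → let (f , p , _) = push-image J h in f , p))
                       (count-cong (push-κ J))

  ⨁-push : ∀ J (g : Sub k) → ⨁ (push J ⊓ g) ≡ ⨁ (λ f → J f ∧ g (κ f))
  ⨁-push J g = trans (⨁-reindex κ κ-inj (push J ⊓ g) supp) (⨁-cong λ f → cong (_∧ g (κ f)) (push-κ J f))
    where
    supp : ∀ e → (∃ λ f → κ f ≡ e) ⊎ push J e ∧ g e ≡ false
    supp e with in-image? κ e
    ... | inj₁ p  = inj₁ p
    ... | inj₂ e∉ = inj₂ (cong (_∧ g e) (push-out J e∉))

  push-∘⊆ : ∀ J → push (J ∘ κ) ⊆ J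
  push-∘⊆ J e h with push-image (J ∘ κ) h
  ... | f , refl , Jf = Jf

  count-∘ : ∀ J → count (J ∘ κ) ≤ count J
  count-∘ J = subst (_≤ count J) (count-push (J ∘ κ)) (count-mono (push-∘⊆ J))

  replace : Sub k → Sub m → Sub k
  replace F J = F ⊕ push ((F ∘ κ) ⊕ J)

  replace-out : ∀ F J {e} → (∀ f → κ f ≢ e) → replace F J e ≡ F e
  replace-out F J {e} e∉ = trans (cong (F e xor_) (push-out _ e∉)) (xor-identityʳ (F e))

  count-replace : ∀ F J → count (replace F J) + count (F ∘ κ) ≡ count F + count J
  count-replace F J = trans (cong (λ c → count (replace F J) + c) (sym (count-push (F ∘ κ))))
    (trans (count-exchange (replace F J) (push (F ∘ κ)) F (push J) pointwise)
           (cong (λ c → count F + c) (count-push J)))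
    where
    pointwise : ∀ e → ⟦ replace F J e ⟧ + ⟦ push (F ∘ κ) e ⟧ ≡ ⟦ F e ⟧ + ⟦ push J e ⟧
    pointwise e with in-image? κ e
    ... | inj₂ e∉ = cong₂ _+_ (cong ⟦_⟧ (replace-out F J e∉)) (cong ⟦_⟧ (trans (push-out _ e∉) (sym (push-out _ e∉))))
    ... | inj₁ (f , refl) = trans
      (cong₂ _+_ (cong ⟦_⟧ (trans (cong (F (κ f) xor_) (push-κ _ f))
                              (taut 2 (λ a b → a xor (a xor b)) (λ a b → b) refl (F (κ f)) (J f))))
                 (cong ⟦_⟧ (push-κ (F ∘ κ) f)))
      (trans (+-comm ⟦ J f ⟧ _) (cong (λ b → ⟦ F (κ f) ⟧ + ⟦ b ⟧) (sym (push-κ J f))))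

module Induced {Γ Η : Graph} {P : Fin (nV Γ) → Set} (E : InducedOn Γ P Η) where

  open Push (κ E) (κ-inj E) public

  inc-κ : ∀ f y → inc Γ (κ E f) (ι E y) ≡ inc Η f y
  inc-κ f y = trans (cong (λ p → (proj₁ p == ι E y) xor (proj₂ p == ι E y)) (κ-ends E f))
                    (cong₂ _xor_ (==-inj (ι E) (ι-inj E) _ y) (==-inj (ι E) (ι-inj E) _ y))

  inc-κ-out : ∀ f {x} → (∀ y → ι E y ≢ x) → inc Γ (κ E f) x ≡ false
  inc-κ-out f {x} x∉ = trans (cong (λ p → (proj₁ p == x) xor (proj₂ p == x)) (κ-ends E f))
                             (cong₂ _xor_ (==-≢ (x∉ _)) (==-≢ (x∉ _)))

  ∂-push : ∀ J y → ∂ Γ (push J) (ι E y) ≡ ∂ Η J y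
  ∂-push J y = trans (⨁-push J (λ e → inc Γ e (ι E y))) (⨁-cong λ f → cong (J f ∧_) (inc-κ f y))

  ∂-push-out : ∀ J {x} → (∀ y → ι E y ≢ x) → ∂ Γ (push J) x ≡ false
  ∂-push-out J {x} x∉ = trans (⨁-push J (λ e → inc Γ e x))
    (⨁-zero λ f → trans (cong (J f ∧_) (inc-κ-out f x∉)) (𝔹.∧-zeroʳ (J f)))

  ∂-restrict : ∀ J y → (∀ e → J e ≡ true → inc Γ e (ι E y) ≡ true → ∃ λ f → κ E f ≡ e) →
               ∂ Η (J ∘ κ E) y ≡ ∂ Γ J (ι E y)
  ∂-restrict J y supp = sym (trans (⨁-reindex (κ E) (κ-inj E) _ supp′)
                                   (⨁-cong λ f → cong (J (κ E f) ∧_) (inc-κ f y)))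
    where
    supp′ : ∀ e → (∃ λ f → κ E f ≡ e) ⊎ J e ∧ inc Γ e (ι E y) ≡ false
    supp′ e with J e in Je | inc Γ e (ι E y) in ie
    ... | false | _     = inj₂ refl
    ... | true  | false = inj₂ refl
    ... | true  | true  = inj₁ (supp e Je ie)

  ∂-replace : ∀ F J y → ∂ Γ (replace F J) (ι E y) ≡ ∂ Γ F (ι E y) xor (∂ Η (F ∘ κ E) y xor ∂ Η J y)
  ∂-replace F J y = trans (∂-⊕ Γ F _ (ι E y)) (cong (∂ Γ F (ι E y) xor_)
    (trans (∂-push ((F ∘ κ E) ⊕ J) y) (∂-⊕ Η (F ∘ κ E) J y)))

  ∂-replace-out : ∀ F J {x} → (∀ y → ι E y ≢ x) → ∂ Γ (replace F J) x ≡ ∂ Γ F x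
  ∂-replace-out F J {x} x∉ = trans (∂-⊕ Γ F _ x) (trans (cong (∂ Γ F x xor_) (∂-push-out _ x∉)) (xor-identityʳ _))

  links-κ : ∀ {f x y} → Links Η f x y → Links Γ (κ E f) (ι E x) (ι E y)
  links-κ {f} (inj₁ refl) = inj₁ (κ-ends E f)
  links-κ {f} (inj₂ refl) = inj₂ (κ-ends E f)

module _ (𝔾 : BGraft) where

  ends-≢ : ∀ e → proj₁ (ends (graph 𝔾) e) ≢ proj₂ (ends (graph 𝔾) e)
  ends-≢ e = links-≢ 𝔾 (inj₁ refl)

  incident≡inc : ∀ e x → incident (graph 𝔾) e x ≡ inc (graph 𝔾) e x
  incident≡inc e x with proj₁ (ends (graph 𝔾) e) ≟ x | proj₂ (ends (graph 𝔾) e) ≟ x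
  ... | yes p | yes q = ⊥-elim (ends-≢ e (trans p (sym q)))
  ... | yes _ | no _  = refl
  ... | no _  | yes _ = refl
  ... | no _  | no _  = refl

  isOdd-degIn : ∀ F x → isOdd (degIn (graph 𝔾) F x) ≡ ∂ (graph 𝔾) F x
  isOdd-degIn F x = trans (isOdd-count (λ e → F e ∧ incident (graph 𝔾) e x)) (⨁-cong λ e → cong (F e ∧_) (incident≡inc e x))

  MinJoin⇒IsLeast : ∀ {F} → MinJoin 𝔾 F → IsLeast (graph 𝔾) ∅ (T 𝔾) F
  MinJoin⇒IsLeast {F} (j , m) = record
    { join  = λ x → trans (sym (isOdd-degIn F x)) (j x)
    ; least = λ J ∂J → m J λ x → trans (isOdd-degIn J x) (∂J x refl) }

  IsLeast⇒MinJoin : ∀ {M F} → IsLeast (graph 𝔾) M (T 𝔾) F → MinJoin 𝔾 F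
  IsLeast⇒MinJoin {F = F} l = (λ x → trans (isOdd-degIn F x) (join x))
      , λ J ∂J → least J λ x _ → trans (sym (isOdd-degIn J x)) (∂J x)
    where open IsLeast l

  minJoin : (∃ λ J → ∂ (graph 𝔾) J ≗ T 𝔾) → ∃ (IsLeast (graph 𝔾) ∅ (T 𝔾))
  minJoin (J , ∂J) with minimal (λ J → Off ∅ (∂ (graph 𝔾) J) (T 𝔾)) (λ J≗K ∂J x _ → trans (sym (∂-cong (graph 𝔾) J≗K x)) (∂J x refl))
                          (λ J → off? ∅ (∂ (graph 𝔾) J) (T 𝔾)) (J , λ x _ → ∂J x)
  ... | F , ∂F , m = F , record { join = λ x → ∂F x refl ; least = m }

∂-local : (Γ : Graph) {J K : ESet Γ} {x : Fin (nV Γ)} → (∀ e → inc Γ e x ≡ true → J e ≡ K e) → ∂ Γ J x ≡ ∂ Γ K x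
∂-local Γ {J} {K} {x} h = ⨁-cong pointwise
  where
  pointwise : ∀ e → J e ∧ inc Γ e x ≡ K e ∧ inc Γ e x
  pointwise e with inc Γ e x in ie
  ... | true  = cong (_∧ true) (h e ie)
  ... | false = trans (𝔹.∧-zeroʳ (J e)) (sym (𝔹.∧-zeroʳ (K e)))

count-∪ : ∀ {k} (p q r : Sub k) → (∀ i → p i ≡ true → q i ≡ true ⊎ r i ≡ true) → count p ≤ count q + count r
count-∪ p q r h = begin
  count p                                 ≡⟨ count≡ p ⟩
  ℕΣ.sum (⟦_⟧ ∘ p)                        ≤⟨ sum-mono _ _ pointwise ⟩
  ℕΣ.sum (λ i → ⟦ q i ⟧ + ⟦ r i ⟧)        ≡⟨ ℕΣ.∑-distrib-+ (⟦_⟧ ∘ q) (⟦_⟧ ∘ r) ⟩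
  ℕΣ.sum (⟦_⟧ ∘ q) + ℕΣ.sum (⟦_⟧ ∘ r)     ≡⟨ cong₂ _+_ (count≡ q) (count≡ r) ⟨
  count q + count r                       ∎
  where
  open ≤-Reasoning
  table : ∀ a b c → (a ≡ true → b ≡ true ⊎ c ≡ true) → ⟦ a ⟧ ≤ ⟦ b ⟧ + ⟦ c ⟧
  table false b     c     _ = z≤n
  table true  true  c     _ = s≤s z≤n
  table true  false true  _ = s≤s z≤n
  table true  false false h with h refl
  ... | inj₁ ()
  ... | inj₂ ()
  pointwise : ∀ i → ⟦ p i ⟧ ≤ ⟦ q i ⟧ + ⟦ r i ⟧
  pointwise i = table (p i) (q i) (r i) (h i)

count≤1⇒unique : ∀ {k} (p : Sub k) → count p ≤ 1 → ∀ {i j} → p i ≡ true → p j ≡ true → j ≡ i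
count≤1⇒unique p p≤1 {i} {j} pi pj with i ≟ j
... | yes i≡j = sym i≡j
... | no  i≢j = ⊥-elim (<⇒≱ (≤-reflexive (sym two)) (≤-trans (count-mono {p = ⁅ i ⁆ ⊕ ⁅ j ⁆} sub) p≤1))
  where
  two : count (⁅ i ⁆ ⊕ ⁅ j ⁆) ≡ 2
  two = trans (count-toggle-out ⁅ i ⁆ j (==-≢ i≢j)) (cong suc (count-⁅⁆ i))
  sub : (⁅ i ⁆ ⊕ ⁅ j ⁆) ⊆ p
  sub a h with i ≟ a | j ≟ a
  ... | yes refl | _        = pi
  ... | no _     | yes refl = pj

-- With M = {r} and slack 1, Levels shows that the vertices at distance 0 from r are pairwise at
-- distance ≥ 0, so the minimum join stays minimum modulo all of them.
module Primal (ℍ : BGraft) (F : ESet (graph ℍ)) (F-min : MinJoin ℍ F)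
              (root : Fin (nV (graph ℍ))) (primality : PrimalWrt ℍ F root) where

  private
    Η = graph ℍ
    least∅ = MinJoin⇒IsLeast ℍ F-min
    open IsLeast least∅

  abstract
    fromRoot : ∀ u → ∃ λ J → ∂ Η J ≗ T ℍ ⊕ ⁅ root ⁆ ⊕ ⁅ u ⁆ × count J ≤ count F
    fromRoot u with LamLe⇒join join (primality u)
    ... | J , ∂J , J≤F = J , ∂J , ≤ℤ⇒≤ J≤F

  private
    least-root : IsLeast Η ⁅ root ⁆ (T ℍ) F
    least-root = pairwise⇒IsLeast least∅ ⁅ root ⁆ λ x y root≡x root≡y J ∂J → least J λ z _ →
      trans (∂J z) (trans (cong₂ (λ a b → (T ℍ z xor (a == z)) xor (b == z)) (sym (==-≡ root≡x)) (sym (==-≡ root≡y)))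
        (taut 2 (λ t a → (t xor a) xor a) (λ t a → t) refl (T ℍ z) (root == z)))

    drop-root : ∀ {J u} → ∂ Η J ≗ T ℍ ⊕ ⁅ root ⁆ ⊕ ⁅ u ⁆ → Off ⁅ root ⁆ (∂ Η J) (T ℍ ⊕ ⁅ u ⁆)
    drop-root {u = u} ∂J x root≢x = trans (∂J x) (cong (_xor (u == x)) (trans (cong (T ℍ x xor_) root≢x) (xor-identityʳ (T ℍ x))))

    module L = Levels ℍ least-root (col ℍ root) (λ x root≡x → cong (col ℍ) (sym (==-≡ root≡x)))
                 (λ u → proj₁ (fromRoot u) , drop-root (proj₁ (proj₂ (fromRoot u))))
    open L using (ℓ; nearest; ∂nearest; ℓ-least; χ; isOdd-ℓ)
    open L.Spread 1 ≤-refl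

    ℓ≤n : ∀ u → ℓ u ≤ count F
    ℓ≤n u = let (J , ∂J , J≤F) = fromRoot u in ≤-trans (ℓ-least u J (drop-root ∂J)) J≤F

    close : ∀ u → Close u
    close u = ≤-trans (s≤s (ℓ≤n u)) (≤-reflexive (+-comm 1 (count F)))

    apart-back : ∀ {y z} → Walk Η y z → Apart y z
    apart-back (stop z)     = apart-refl (close z)
    apart-back (step e l w) = apart-step l (close _) (close _) (apart-back w)

    apart-along : ∀ {a y z} → Walk Η a y → Apart a z → Apart y z
    apart-along (stop _)     h = h
    apart-along (step e l w) h = apart-along w (apart-step (links-sym {Η} {e} l) (close _) (close _) h)

    apart : ∀ y z → Apart y z
    apart y z = apart-along (proj₁ (primality y)) (apart-back (proj₁ (primality z)))

  atZero : VSet Η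
  atZero y = ⌊ ℓ y ≟ℕ count F ⌋

  private
    atZero⇒≡ : ∀ {y} → atZero y ≡ true → ℓ y ≡ count F
    atZero⇒≡ {y} h with ℓ y ≟ℕ count F
    ... | yes p = p

    ≤⇒atZero : ∀ {y} → count F ≤ ℓ y → atZero y ≡ true
    ≤⇒atZero {y} h with ℓ y ≟ℕ count F
    ... | yes _ = refl
    ... | no ≢n = ⊥-elim (≢n (≤-antisym (ℓ≤n y) h))

  root-atZero : atZero root ≡ true
  root-atZero = ≤⇒atZero (IsLeast.least least-root (nearest root) λ x root≢x →
    trans (∂nearest root x root≢x) (trans (cong (T ℍ x xor_) root≢x) (xor-identityʳ (T ℍ x))))

  InAr⇒atZero : ∀ y → InAr ℍ F root y → atZero y ≡ true
  InAr⇒atZero y (_ , ge) with root ≟ y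
  ... | yes refl = root-atZero
  ... | no root≢y = ≤⇒atZero (≮⇒≥ λ ℓ<n → LamGe⇒≤ join ge (below ℓ<n))
    where
    below : ℓ y < count F → LamLe Η F root y -[1+ 0 ]
    below ℓ<n = toPath (Off⇒≗ least-root {y} (==-≢ root≢y) (nearest y) (∂nearest y))
      where
      toPath : (∃ λ x → ⁅ root ⁆ x ≡ true × ∃ λ J → ∂ Η J ≗ T ℍ ⊕ ⁅ x ⁆ ⊕ ⁅ y ⁆ × count J ≤ ℓ y) → LamLe Η F root y -[1+ 0 ]
      toPath (x , root≡x , J , ∂J , J≤) = join⇒LamLe least∅ J
        (λ z → trans (∂J z) (cong (λ a → (T ℍ z xor (a == z)) xor (y == z)) (sym (==-≡ root≡x))))
        (<⇒≤ℤ (≤-trans (s≤s J≤) ℓ<n))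

  least-atZero : IsLeast Η atZero (T ℍ) F
  least-atZero = pairwise⇒IsLeast least∅ atZero pair
    where
    n = count F
    even : ∀ {y} → atZero y ≡ true → χ y ≡ false
    even {y} h = xor-zero (isOdd n) (χ y) (trans (sym (isOdd-ℓ y)) (cong isOdd (atZero⇒≡ h)))
      where
      xor-zero : ∀ a b → a xor b ≡ a → b ≡ false
      xor-zero true  false _ = refl
      xor-zero false b     h = h
    pair : ∀ x y → atZero x ≡ true → atZero y ≡ true → ∀ J → ∂ Η J ≗ T ℍ ⊕ ⁅ x ⁆ ⊕ ⁅ y ⁆ → n ≤ count J
    pair x y x0 y0 J ∂J = parity-gap n≤1+J same-parity
      where
      arith : ∀ j n → j + (n + 2) ≡ suc (suc j + n)
      arith = solve-∀
      n≤1+J : n ≤ suc (count J)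
      n≤1+J = +-cancelʳ-≤ n _ _ (≤-pred (≤-trans
        (subst (λ a → suc a ≤ count J + (n + 2)) (cong₂ _+_ (atZero⇒≡ x0) (atZero⇒≡ y0)) (apart x y J (≗⇒Off ∂J)))
        (≤-reflexive (arith (count J) n))))
      same-parity : isOdd (count J) ≡ isOdd n
      same-parity = trans (L.parity J (≗⇒Off ∂J)) (trans (L.⨁χ⊕ (T ℍ ⊕ ⁅ x ⁆) y)
        (trans (cong₂ _xor_ (trans (L.⨁χ⊕ (T ℍ) x) (cong₂ _xor_ (sym L.isOdd-n) (even x0))) (even y0))
               (trans (xor-identityʳ _) (xor-identityʳ _))))
      parity-gap : ∀ {a b} → a ≤ suc b → isOdd b ≡ isOdd a → a ≤ b
      parity-gap {a} {b} a≤ eq with m≤n⇒m<n∨m≡n a≤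
      ... | inj₁ a<  = ≤-pred a<
      ... | inj₂ refl = ⊥-elim (𝔹.not-¬ refl eq)

-- Grafts built by synthesis

∂-cut-odd : (Γ : Graph) (χ : VSet Γ) (J : ESet Γ) → ⨁ (χ ⊓ ∂ Γ J) ≡ true → ∃ λ e → J e ≡ true × cut Γ χ e ≡ true
∂-cut-odd Γ χ J h with ⨁-witness (J ⊓ cut Γ χ) (trans (sym (⨁-∂ Γ χ J)) h)
... | e , q with J e in Je | cut Γ χ e in ce
...   | true | true = e , Je , ce

cut-links : (Γ : Graph) (χ : VSet Γ) → ∀ {e x w} → Links Γ e x w → cut Γ χ e ≡ χ x xor χ w
cut-links Γ χ (inj₁ refl) = refl
cut-links Γ χ {w = w} (inj₂ refl) = xor-comm (χ w) _

toggled-in : ∀ {k} (J : Sub k) e {f} → (J ⊕ ⁅ e ⁆) f ≡ true → e ≡ f ⊎ J f ≡ true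
toggled-in J e {f} h with e ≟ f
... | yes e≡f = inj₁ e≡f
... | no _    = inj₂ (trans (sym (xor-identityʳ (J f))) h)

κ-links : ∀ {Γ Η P} (E : InducedOn Γ P Η) → ∀ {e x w} → Links Γ e x w → P x → P w → ∃ λ f → κ E f ≡ e
κ-links E (inj₁ refl) Px Pw = κ-img E _ Px Pw
κ-links E (inj₂ refl) Px Pw = κ-img E _ Pw Px

module _ {Γ Κ : Graph} {T̂ : VSet Γ} {TK : VSet Κ} {p : Fin (nV Γ) → Fin (nV Κ)} (ct : ContractsTo Γ T̂ Κ TK p) where

  term-parity : ∀ v → ⨁ ((λ x → p x == v) ⊓ T̂) ≡ TK v
  term-parity v = trans (sym (isOdd-count ((λ x → p x == v) ⊓ T̂))) (sym (term ct v))

  inc-σ : ∀ g v → inc Κ g v ≡ cut Γ (λ x → p x == v) (σ ct g)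
  inc-σ g v = cong (λ ab → (proj₁ ab == v) xor (proj₂ ab == v)) (σ-ends ct g)

  ∂-∘σ : ∀ J v → ∂ Κ (J ∘ σ ct) v ≡ ⨁ ((λ x → p x == v) ⊓ ∂ Γ J)
  ∂-∘σ J v = sym (trans (⨁-∂ Γ (λ x → p x == v) J) (trans (⨁-reindex (σ ct) (σ-inj ct) _ supp)
      (⨁-cong λ g → cong (J (σ ct g) ∧_) (sym (inc-σ g v)))))
    where
    supp : ∀ e → (∃ λ g → σ ct g ≡ e) ⊎ J e ∧ cut Γ (λ x → p x == v) e ≡ false
    supp e with p (proj₁ (ends Γ e)) ≟ p (proj₂ (ends Γ e))
    ... | yes eq = inj₂ (trans (cong (J e ∧_) (trans (cong (λ a → (a == v) xor (p (proj₂ (ends Γ e)) == v)) eq) (xor-same (p (proj₂ (ends Γ e)) == v)))) (𝔹.∧-zeroʳ (J e)))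
    ... | no ≢   = inj₁ (σ-img ct e ≢)

  join-∘σ : ∀ J → ∂ Γ J ≗ T̂ → ∂ Κ (J ∘ σ ct) ≗ TK
  join-∘σ J ∂J v = trans (∂-∘σ J v) (trans (⨁-cong λ x → cong ((p x == v) ∧_) (∂J x)) (term-parity v))

module FromSynthesis (Ĝ : BGraft) (S : VSet (graph Ĝ)) (syn : Synthesis Ĝ S) where

  Γ  = graph Ĝ
  𝕂  = G syn
  Κ  = graph 𝕂
  p  = π syn
  ct = contr syn

  tooth : Fin (nV Γ) → Bool
  tooth x = col 𝕂 (p x)

  tooth⇒∉S : ∀ {x} → tooth x ≡ true → S x ≡ false
  tooth⇒∉S {x} h = trans (spine syn x) (cong not h)

  ∉S⇒tooth : ∀ {x} → S x ≡ false → tooth x ≡ true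
  ∉S⇒tooth {x} h = trans (sym (𝔹.not-involutive _)) (cong not (trans (sym (spine syn x)) h))

  crossEdge : ∀ {e x w} → Links Γ e x w → p x ≢ p w → ∃ λ g → σ ct g ≡ e × Links Κ g (p x) (p w)
  crossEdge (inj₁ refl) x≢w with σ-img ct _ x≢w
  ... | g , refl = g , refl , inj₁ (σ-ends ct g)
  crossEdge (inj₂ refl) x≢w with σ-img ct _ (x≢w ∘ sym)
  ... | g , refl = g , refl , inj₂ (σ-ends ct g)

  cross-tooth : ∀ {e x w} → Links Γ e x w → p x ≢ p w → tooth w ≡ not (tooth x)
  cross-tooth {e} l x≢w with crossEdge {e} l x≢w
  ... | g , _ , l′ = links-col 𝕂 {g} l′

  spine-cross : ∀ {e x w} → Links Γ e x w → tooth x ≡ false → p x ≢ p w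
  spine-cross {e} {x} {w} l h px≡pw = links-≢ Ĝ {e} l (A-single syn x w h px≡pw)

  owner : Fin (nE Γ) → Fin (nV Κ)
  owner e = if tooth (proj₁ (ends Γ e)) then p (proj₁ (ends Γ e)) else p (proj₂ (ends Γ e))

  open Blocks owner

  owner-links : ∀ {e x w} → Links Γ e x w → tooth x ≡ true → owner e ≡ p x
  owner-links (inj₁ refl) h rewrite h = refl
  owner-links {e} {x} {w} l@(inj₂ refl) h with tooth w in tw
  ... | false = refl
  ... | true with p x ≟ p w
  ...   | yes eq = sym eq
  ...   | no ≢   = conflict (trans (sym (cross-tooth {e} l ≢)) tw) (cong not h)

  owner-tooth : ∀ e → col 𝕂 (owner e) ≡ true
  owner-tooth e with tooth (proj₁ (ends Γ e)) in t₁
  ... | true  = t₁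
  ... | false = trans (cross-tooth {e} (inj₁ refl) (spine-cross {e} (inj₁ refl) t₁)) (cong not t₁)

  owner-inc : ∀ {e x} → inc Γ e x ≡ true → tooth x ≡ true → owner e ≡ p x
  owner-inc {e} {x} ie h with other-end {Γ} e x ie
  ... | _ , l , _ = owner-links {e} l h

  fibre : Fin (nV Κ) → VSet Γ
  fibre v x = p x == v

  fibre-≡ : ∀ {v x} → p x ≡ v → fibre v x ≡ true
  fibre-≡ {v} refl = ==-refl v

  cross⇒owner : ∀ {v e} → col 𝕂 v ≡ true → cut Γ (fibre v) e ≡ true → owner e ≡ v
  cross⇒owner {v} {e} v∈B h with p (proj₁ (ends Γ e)) ≟ v | p (proj₂ (ends Γ e)) ≟ v
  ... | yes refl | no _     = owner-links {e} (inj₁ refl) v∈B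
  ... | no _     | yes refl = owner-links {e} (inj₂ refl) v∈B

  record ToothBound (v : Fin (nV Κ)) : Set where
    field
      size  : ℕ
      lower : ∀ J → Off S (∂ Γ J) (T Ĝ) → suc size ≤ count (J ⊓ block v)
      inner : ∀ y → p y ≡ v → ∃ λ I → (∀ x → p x ≡ v → ∂ Γ I x ≡ T Ĝ x xor (y == x))
                × (∀ e → I e ≡ true → ∀ x → inc Γ e x ≡ true → p x ≡ v) × count I ≤ size
  open ToothBound

  toothBound : ∀ v → col 𝕂 v ≡ true → T 𝕂 v ≡ true → ToothBound v
  toothBound v v∈B Tv = record { size = count (Fv t) ; lower = lower′ ; inner = inner′ }
    where
    t = teeth syn v v∈B
    ℍ = H t
    Η = graph ℍ
    E = emb t
    module E = Induced E
    module P = Primal ℍ (Fv t) (Fv-min t) (r t) (primal t)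

    ι∉S : ∀ y → S (ι E y) ≡ false
    ι∉S y = tooth⇒∉S (trans (cong (col 𝕂) (ι-in E y)) v∈B)

    inner′ : ∀ y → p y ≡ v → ∃ λ I → (∀ x → p x ≡ v → ∂ Γ I x ≡ T Ĝ x xor (y == x))
               × (∀ e → I e ≡ true → ∀ x → inc Γ e x ≡ true → p x ≡ v) × count I ≤ count (Fv t)
    inner′ y py with ι-img E y py
    ... | y′ , refl with P.fromRoot y′
    ...   | J , ∂J , J≤ = E.push J , ∂I , inside , ≤-trans (≤-reflexive (E.count-push J)) J≤
      where
      ∂I : ∀ x → p x ≡ v → ∂ Γ (E.push J) x ≡ T Ĝ x xor (ι E y′ == x)
      ∂I x px with ι-img E x px
      ... | x′ , refl = trans (E.∂-push J x′) (trans (∂J x′)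
              (cong₂ _xor_ (trans (cong (T ℍ x′ xor_) (==-sym (r t) x′)) (sym (termv t x′)))
                           (sym (==-inj (ι E) (ι-inj E) y′ x′))))
      inside : ∀ e → E.push J e ≡ true → ∀ x → inc Γ e x ≡ true → p x ≡ v
      inside e h x ie with E.push-image J h
      ... | f , refl , _ with inc-end {Γ} {κ E f} x (inj₁ (κ-ends E f)) ie
      ...   | inj₁ refl = ι-in E _
      ...   | inj₂ refl = ι-in E _

    lower′ : ∀ J → Off S (∂ Γ J) (T Ĝ) → suc (count (Fv t)) ≤ count (J ⊓ block v)
    lower′ J ∂J = ≤-trans (s≤s Fv≤) (≤-trans (≤-reflexive (sym (count-toggle-out Jv e₀ e₀∉Jv))) (count-mono sub))
      where
      Jv : ESet Γ
      Jv = E.push (J ∘ κ E)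
      agree : ∀ x → fibre v x ∧ ∂ Γ J x ≡ fibre v x ∧ T Ĝ x
      agree x with p x ≟ v
      ... | yes refl = ∂J x (tooth⇒∉S v∈B)
      ... | no _     = refl
      crossing : ∃ λ e → J e ≡ true × cut Γ (fibre v) e ≡ true
      crossing = ∂-cut-odd Γ (fibre v) J (trans (⨁-cong agree) (trans (term-parity ct v) Tv))
      e₀ = proj₁ crossing
      inner-uncut : ∀ f → cut Γ (fibre v) (κ E f) ≡ false
      inner-uncut f = trans (cong (λ ab → fibre v (proj₁ ab) xor fibre v (proj₂ ab)) (κ-ends E f))
                            (cong₂ _xor_ (fibre-≡ (ι-in E _)) (fibre-≡ (ι-in E _)))
      e₀∉Jv : Jv e₀ ≡ false
      e₀∉Jv = E.push-out _ λ f κf≡e₀ → conflict (proj₂ (proj₂ crossing)) (trans (cong (cut Γ (fibre v)) (sym κf≡e₀)) (inner-uncut f))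
      sub : (Jv ⊕ ⁅ e₀ ⁆) ⊆ (J ⊓ block v)
      sub e h = [ (λ e₀≡e → subst (λ e → (J ⊓ block v) e ≡ true) e₀≡e e₀-in)
                , (λ h′ → image-in (E.push-image (J ∘ κ E) h′)) ]′ (toggled-in Jv e₀ h)
        where
        e₀-in : (J ⊓ block v) e₀ ≡ true
        e₀-in = cong₂ _∧_ (proj₁ (proj₂ crossing))
                  (trans (cong (_== v) (cross⇒owner v∈B (proj₂ (proj₂ crossing)))) (==-refl v))
        image-in : (∃ λ f → κ E f ≡ e × J (κ E f) ≡ true) → (J ⊓ block v) e ≡ true
        image-in (f , refl , Jf) = cong₂ _∧_ Jf (trans (cong (_== v)
          (trans (owner-links {κ E f} (inj₁ (κ-ends E f)) (trans (cong (col 𝕂) (ι-in E _)) v∈B)) (ι-in E _))) (==-refl v))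
      ∂Jκ : Off P.atZero (∂ Η (J ∘ κ E)) (T ℍ)
      ∂Jκ y y∉0 = trans (E.∂-restrict J y supp) (trans (∂J (ι E y) (ι∉S y)) (trans (termv t y)
          (trans (cong (T ℍ y xor_) (==-≢ y≢r)) (xor-identityʳ (T ℍ y)))))
        where
        y≢r : y ≢ r t
        y≢r refl = conflict P.root-atZero y∉0
        contact : ∀ e {w} → Links Γ e (ι E y) w → p w ≢ v → ⊥
        contact e {w} l pw≢v with proj₁ (cond3 t e) cutv
          where
          cutv : cut Γ (fibre v) e ≡ true
          cutv = trans (cut-links Γ (fibre v) {e} l) (cong₂ _xor_ (fibre-≡ (ι-in E y)) (==-≢ pw≢v))
        ... | a , y′ , Sa , y′∈A , l′ with inc-end {Γ} {e} (ι E y) l′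
                (trans (inc-links {Γ} {e} l (ι E y)) (cong₂ _xor_ (==-refl (ι E y)) (==-≢ (links-≢ Ĝ {e} l ∘ sym))))
        ...   | inj₁ refl = conflict Sa (ι∉S y)
        ...   | inj₂ ιy≡ιy′ with ι-inj E y y′ ιy≡ιy′
        ...     | refl = conflict (P.InAr⇒atZero y y′∈A) y∉0
        supp : ∀ e → J e ≡ true → inc Γ e (ι E y) ≡ true → ∃ λ f → κ E f ≡ e
        supp e Je ie with other-end {Γ} e (ι E y) ie
        ... | w , l , _ with p w ≟ v
        ...   | no pw≢v = ⊥-elim (contact e l pw≢v)
        ...   | yes pw≡v = κ-links E l (ι-in E y) pw≡v
      Fv≤ : count (Fv t) ≤ count Jv
      Fv≤ = ≤-trans (IsLeast.least P.least-atZero (J ∘ κ E) ∂Jκ) (≤-reflexive (sym (E.count-push (J ∘ κ E))))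

cut-end : (Γ : Graph) (χ : VSet Γ) → ∀ {e} → cut Γ χ e ≡ true → ∃ λ x → ∃ λ w → Links Γ e x w × χ x ≡ true × χ w ≡ false
cut-end Γ χ {e} h with χ (proj₁ (ends Γ e)) in h₁ | χ (proj₂ (ends Γ e)) in h₂
... | true  | false = _ , _ , inj₁ refl , h₁ , h₂
... | false | true  = _ , _ , inj₂ refl , h₂ , h₁

module SynthesisExtreme (Ĝ : BGraft) (S : VSet (graph Ĝ)) (syn : Synthesis Ĝ S)
                        (F : ESet (graph Ĝ)) (F-least : IsLeast (graph Ĝ) ∅ (T Ĝ) F) where

  open FromSynthesis Ĝ S syn
  open ToothBound
  open Blocks owner

  open IsLeast F-least
  open Push (σ ct) (σ-inj ct)

  abstract
    skeletonJoin : ∃ (IsLeast Κ ∅ (T 𝕂))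
    skeletonJoin = minJoin 𝕂 (F ∘ σ ct , join-∘σ ct F join)

  private
    M = proj₁ skeletonJoin
    M-least = proj₂ skeletonJoin

    degree-one : ∀ v → col 𝕂 v ≡ true → count (λ g → M g ∧ incident Κ g v) ≡ 1
    degree-one = comb syn M (IsLeast⇒MinJoin 𝕂 M-least)

    T-odd : ∀ v → col 𝕂 v ≡ true → T 𝕂 v ≡ true
    T-odd v v∈B = trans (sym (proj₁ (IsLeast⇒MinJoin 𝕂 M-least) v)) (cong isOdd (degree-one v v∈B))

    bound : ∀ v → col 𝕂 v ≡ true → ToothBound v
    bound v v∈B = toothBound v v∈B (T-odd v v∈B)

    matched-unique : ∀ v → col 𝕂 v ≡ true → ∀ {g g′} → M g ≡ true → inc Κ g v ≡ true →
                     M g′ ≡ true → inc Κ g′ v ≡ true → g′ ≡ g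
    matched-unique v v∈B {g} {g′} Mg ig Mg′ ig′ =
      count≤1⇒unique (λ g → M g ∧ incident Κ g v) (≤-reflexive (degree-one v v∈B))
        (cong₂ _∧_ Mg (trans (incident≡inc 𝕂 g v) ig)) (cong₂ _∧_ Mg′ (trans (incident≡inc 𝕂 g′ v) ig′))

    inc-lift : ∀ g z → inc Γ (σ ct g) z ≡ true → inc Κ g (p z) ≡ true
    inc-lift g z ie with other-end {Γ} (σ ct g) z ie
    ... | w , l , _ = trans (inc-σ ct g (p z)) (trans (cut-links Γ (λ x → p x == p z) {σ ct g} l)
            (cong₂ _xor_ (==-refl (p z)) (==-≢ (leaves l ∘ sym))))
      where
      leaves : ∀ {x w} → Links Γ (σ ct g) x w → p x ≢ p w
      leaves (inj₁ q) = λ eq → σ-out ct g (trans (cong (p ∘ proj₁) q) (trans eq (sym (cong (p ∘ proj₂) q))))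
      leaves (inj₂ q) = λ eq → σ-out ct g (trans (cong (p ∘ proj₁) q) (trans (sym eq) (sym (cong (p ∘ proj₂) q))))

    M̂ : ESet Γ
    M̂ = push M

    record Match (v : Fin (nV Κ)) : Set where
      field
        edge    : Fin (nE Κ)
        matched : M edge ≡ true
        at      : inc Κ edge v ≡ true
        contact : Fin (nV Γ)
        contact∈ : p contact ≡ v
        ∂M̂      : ∀ z → p z ≡ v → ∂ Γ M̂ z ≡ (contact == z)
    open Match

    match : ∀ v → col 𝕂 v ≡ true → Match v
    match v v∈B with ⨁-witness (λ g → M g ∧ inc Κ g v) (trans (IsLeast.join M-least v) (T-odd v v∈B))
    ... | g , h with M g in Mg | inc Κ g v in ig
    ...   | true | true with cut-end Γ (λ x → p x == v) {σ ct g} (trans (sym (inc-σ ct g v)) ig)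
    ...     | x , w , l , px , pw = record
              { edge = g ; matched = Mg ; at = ig ; contact = x ; contact∈ = ==-≡ px ; ∂M̂ = ∂M̂′ }
      where
      only : ∀ z → p z ≡ v → ∀ g′ → g′ ≢ g → M g′ ∧ inc Γ (σ ct g′) z ≡ false
      only z pz g′ g′≢g with M g′ in Mg′ | inc Γ (σ ct g′) z in ie
      ... | false | _     = refl
      ... | true  | false = refl
      ... | true  | true  = ⊥-elim (g′≢g (matched-unique v v∈B Mg ig Mg′ (subst (λ v → inc Κ g′ v ≡ true) pz (inc-lift g′ z ie))))
      ∂M̂′ : ∀ z → p z ≡ v → ∂ Γ M̂ z ≡ (x == z)
      ∂M̂′ z pz = trans (⨁-push M (λ e → inc Γ e z)) (trans (⨁-one g (only z pz))
        (trans (cong (_∧ inc Γ (σ ct g) z) Mg) (trans (inc-links {Γ} {σ ct g} l z)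
          (trans (cong ((x == z) xor_) (==-≢ (λ w≡z → ==-≢⁻ pw (trans (cong p w≡z) pz)))) (xor-identityʳ _)))))

    filling : ∀ v → (v∈B : col 𝕂 v ≡ true) → ∃ λ I → (∀ x → p x ≡ v → ∂ Γ I x ≡ T Ĝ x xor (contact (match v v∈B) == x))
                × (∀ e → I e ≡ true → ∀ x → inc Γ e x ≡ true → p x ≡ v) × count I ≤ size (bound v v∈B)
    filling v v∈B = inner (bound v v∈B) (contact (match v v∈B)) (contact∈ (match v v∈B))

    local : ∀ v → col 𝕂 v ≡ true → ESet Γ
    local v v∈B = M̂ ⊕ proj₁ (filling v v∈B)

  assembled : ESet Γ
  assembled e = local (owner e) (owner-tooth e) e

  private
    assembled-at : ∀ {e v} → owner e ≡ v → (v∈B : col 𝕂 v ≡ true) → assembled e ≡ local v v∈B e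
    assembled-at {e} refl v∈B = cong (λ q → local (owner e) q e) (uip (owner-tooth e) v∈B)

    spine-== : ∀ {x} → tooth x ≡ false → ∀ y → (p y == p x) ≡ (y == x)
    spine-== {x} tx y with y ≟ x
    ... | yes refl = ==-refl (p x)
    ... | no y≢x   = ==-≢ (λ eq → y≢x (sym (A-single syn x y tx (sym eq))))

  ∂assembled : ∂ Γ assembled ≗ T Ĝ
  ∂assembled z = byKind (tooth z) refl
    where
    byKind : ∀ b → tooth z ≡ b → ∂ Γ assembled z ≡ T Ĝ z
    byKind true tz = begin
      ∂ Γ assembled z            ≡⟨ ∂-local Γ (λ e ie → assembled-at (owner-inc {e} ie tz) tz) ⟩
      ∂ Γ (local (p z) tz) z     ≡⟨ ∂-⊕ Γ M̂ _ z ⟩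
      ∂ Γ M̂ z xor ∂ Γ (proj₁ (filling (p z) tz)) z
                                 ≡⟨ cong₂ _xor_ (∂M̂ (match (p z) tz) z refl) (proj₁ (proj₂ (filling (p z) tz)) z refl) ⟩
      (contact (match (p z) tz) == z) xor (T Ĝ z xor (contact (match (p z) tz) == z))
                                 ≡⟨ taut 2 (λ a t → a xor (t xor a)) (λ a t → t) refl (contact (match (p z) tz) == z) (T Ĝ z) ⟩
      T Ĝ z                      ∎
      where open ≡-Reasoning
    byKind false tz = begin
      ∂ Γ assembled z                            ≡⟨ ∂-local Γ {assembled} {M̂} unfilled ⟩
      ∂ Γ M̂ z                                    ≡⟨ ⨁-push M (λ e → inc Γ e z) ⟩
      ⨁ (λ g → M g ∧ inc Γ (σ ct g) z)           ≡⟨ ⨁-cong (λ g → cong (M g ∧_) (same g)) ⟩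
      ∂ Κ M (p z)                                ≡⟨ IsLeast.join M-least (p z) ⟩
      T 𝕂 (p z)                                  ≡⟨ term-parity ct (p z) ⟨
      ⨁ ((λ x → p x == p z) ⊓ T Ĝ)               ≡⟨ ⨁-cong (λ x → trans (cong (_∧ T Ĝ x) (trans (spine-== tz x) (==-sym x z))) (𝔹.∧-comm (z == x) _)) ⟩
      ⨁ (T Ĝ ⊓ ⁅ z ⁆)                            ≡⟨ ⨁-⁅⁆ z (T Ĝ) ⟩
      T Ĝ z                                      ∎
      where
      open ≡-Reasoning
      unfilled : ∀ e → inc Γ e z ≡ true → assembled e ≡ M̂ e
      unfilled e ie = trans (cong (M̂ e xor_) (¬-not λ h → conflict (owner-tooth e)
        (trans (cong (col 𝕂) (sym (proj₁ (proj₂ (proj₂ (filling (owner e) (owner-tooth e)))) e h z ie))) tz))) (xor-identityʳ (M̂ e))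
      same : ∀ g → inc Γ (σ ct g) z ≡ inc Κ g (p z)
      same g = trans (cong₂ _xor_ (sym (spine-== tz _)) (sym (spine-== tz _))) (sym (inc-σ ct g (p z)))

  block-empty : ∀ v → col 𝕂 v ≡ false → ∀ (J K : ESet Γ) → count (J ⊓ block v) ≤ count (K ⊓ block v)
  block-empty v v∉B J K = count-mono λ e h → conflict (owner-tooth e) (trans (cong (col 𝕂) (owned (J e) h)) v∉B)
    where
    owned : ∀ {e} b → b ∧ (owner e == v) ≡ true → owner e ≡ v
    owned true h = ==-≡ h

  private
    owner-cut : ∀ {v e} → owner e ≡ v → p (proj₁ (ends Γ e)) ≢ p (proj₂ (ends Γ e)) → cut Γ (fibre v) e ≡ true
    owner-cut {v} {e} oe ne with tooth (proj₁ (ends Γ e))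
    ... | true  = trans (cong₂ _xor_ (fibre-≡ oe) (==-≢ (λ q → ne (trans oe (sym q))))) refl
    ... | false = trans (cong₂ _xor_ (==-≢ (λ q → ne (trans q (sym oe)))) (fibre-≡ oe)) refl

  count-assembled : ∀ v → (v∈B : col 𝕂 v ≡ true) → count (assembled ⊓ block v) ≤ suc (size (bound v v∈B))
  count-assembled v v∈B = ≤-trans (count-∪ (assembled ⊓ block v) ⁅ σ ct (edge m) ⁆ (proj₁ f) split)
      (+-mono-≤ (≤-reflexive (count-⁅⁆ (σ ct (edge m)))) (proj₂ (proj₂ (proj₂ f))))
    where
    m = match v v∈B
    f = filling v v∈B
    split : ∀ e → (assembled ⊓ block v) e ≡ true → ⁅ σ ct (edge m) ⁆ e ≡ true ⊎ proj₁ f e ≡ true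
    split e h = helper (∧-true (assembled e) h)
      where
      xor-true : ∀ a {b} → a xor b ≡ true → a ≡ true ⊎ b ≡ true
      xor-true true  _ = inj₁ refl
      xor-true false h = inj₂ h
      fromM : owner e ≡ v → (∃ λ g → σ ct g ≡ e × M g ≡ true) → ⁅ σ ct (edge m) ⁆ e ≡ true
      fromM oe (g , refl , Mg) = subst (λ g → (σ ct (edge m) == σ ct g) ≡ true)
        (sym (matched-unique v v∈B (matched m) (at m) Mg
          (trans (inc-σ ct g v) (owner-cut oe (σ-out ct g)))))
        (==-refl _)
      helper : assembled e ≡ true × (owner e == v) ≡ true → ⁅ σ ct (edge m) ⁆ e ≡ true ⊎ proj₁ f e ≡ true
      helper (ae , oe) = [ (λ h → inj₁ (fromM (==-≡ oe) (push-image M h))) , inj₂ ]′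
                           (xor-true (M̂ e) (trans (sym (assembled-at (==-≡ oe) v∈B)) ae))

  abstract

    least-S : IsLeast Γ S (T Ĝ) F
    least-S = record { join = join ; least = λ J ∂J →
      ≤-trans (least assembled (≗⇒Off ∂assembled)) (count-blocks-≤ assembled J (perBlock J ∂J)) }
      where
      perBlock : ∀ J → Off S (∂ Γ J) (T Ĝ) → ∀ v → count (assembled ⊓ block v) ≤ count (J ⊓ block v)
      perBlock J ∂J v = byKind (col 𝕂 v) refl
        where
        byKind : ∀ b → col 𝕂 v ≡ b → count (assembled ⊓ block v) ≤ count (J ⊓ block v)
        byKind true  v∈B = ≤-trans (count-assembled v v∈B) (lower (bound v v∈B) J ∂J)
        byKind false v∉B = block-empty v v∉B assembled J

  near : ∀ y → S y ≡ false → ∃ λ J → Off S (∂ Γ J) (T Ĝ ⊕ ⁅ y ⁆) × suc (count J) ≤ count F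
  near y Sy = J , ∂J , count-blocks-< J F perBlock v strict
    where
    v = p y
    v∈B = ∉S⇒tooth Sy
    b = bound v v∈B
    fill = inner b y refl
    I = proj₁ fill
    J : ESet Γ
    J e = if owner e == v then I e else F e
    J-in : ∀ {e} → (owner e == v) ≡ true → J e ≡ I e
    J-in h rewrite h = refl
    J-out : ∀ {e} → (owner e == v) ≡ false → J e ≡ F e
    J-out h rewrite h = refl
    ∂J : Off S (∂ Γ J) (T Ĝ ⊕ ⁅ y ⁆)
    ∂J x Sx = byBlock (p x ≟ v)
      where
      tx = ∉S⇒tooth Sx
      byBlock : Dec (p x ≡ v) → ∂ Γ J x ≡ T Ĝ x xor (y == x)
      byBlock (yes px≡v) = trans (∂-local Γ {J} {I} λ e ie → J-in {e} (trans (cong (_== v) (trans (owner-inc {e} ie tx) px≡v)) (==-refl v)))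
                                 (proj₁ (proj₂ fill) x px≡v)
      byBlock (no px≢v)  = trans (∂-local Γ {J} {F} λ e ie → J-out {e} (trans (cong (_== v) (owner-inc {e} ie tx)) (==-≢ px≢v)))
                                 (trans (join x) (trans (sym (xor-identityʳ _)) (cong (T Ĝ x xor_) (sym (==-≢ (λ y≡x → px≢v (cong p (sym y≡x))))))))
    strict : count (J ⊓ block v) < count (F ⊓ block v)
    strict = ≤-trans (s≤s (≤-trans (count-mono sub) (proj₂ (proj₂ (proj₂ fill))))) (lower b F (≗⇒Off join))
      where
      sub : (J ⊓ block v) ⊆ I
      sub e h = inBlock (owner e == v) refl h
        where
        inBlock : ∀ c → (owner e == v) ≡ c → J e ∧ c ≡ true → I e ≡ true
        inBlock true  oe h = trans (sym (J-in {e} oe)) (trans (sym (𝔹.∧-identityʳ (J e))) h)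
        inBlock false oe h = conflict h (𝔹.∧-zeroʳ (J e))
    perBlock : ∀ u → count (J ⊓ block u) ≤ count (F ⊓ block u)
    perBlock u with u ≟ v
    ... | yes refl = <⇒≤ strict
    ... | no u≢v = ≤-reflexive (count-cong λ e → same e (owner e ≟ u))
      where
      same : ∀ e → Dec (owner e ≡ u) → J e ∧ (owner e == u) ≡ F e ∧ (owner e == u)
      same e (yes oe) = cong (_∧ (owner e == u)) (J-out {e} (==-≢ (λ q → u≢v (trans (sym oe) q))))
      same e (no oe)  = trans (cong (J e ∧_) (==-≢ oe)) (trans (𝔹.∧-zeroʳ (J e)) (sym (trans (cong (F e ∧_) (==-≢ oe)) (𝔹.∧-zeroʳ (F e)))))

  abstract

    all-InD : ∀ y → S y ≡ false → InD Ĝ F S y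
    all-InD y Sy = Sy , toPath (near y Sy)
      where
      toPath : (∃ λ J → Off S (∂ Γ J) (T Ĝ ⊕ ⁅ y ⁆) × suc (count J) ≤ count F) → ∃ λ x → S x ≡ true × LamLe Γ F x y -[1+ 0 ]
      toPath (J , ∂J , J<F) = let (x , Sx , J′ , ∂J′ , J′≤J) = Off⇒≗ least-S Sy J ∂J in
        x , Sx , join⇒LamLe F-least J′ ∂J′ (<⇒≤ℤ (≤-trans (s≤s J′≤J) J<F))

synthesis⇒extreme : (Ĝ : BGraft) → HasJoin (graph Ĝ) (T Ĝ) → (S : VSet (graph Ĝ)) → Synthesis Ĝ S →
                    MaxBipExtreme Ĝ S × FringeEmpty Ĝ S
synthesis⇒extreme Ĝ (F₀ , ∂F₀) S syn =
  ( (proj₁ (colour syn) , proj₁ (proj₂ (colour syn)))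
  , (F , IsLeast⇒MinJoin Ĝ F-least , λ x y Sx Sy → LamGe-0 join λ J ∂J → IsLeast.least E.least-S J (drop Sx Sy ∂J))
  , maximal )
  , λ F′ F′-min y (Sy , y∉D) → y∉D (SynthesisExtreme.all-InD Ĝ S syn F′ (MinJoin⇒IsLeast Ĝ F′-min) y Sy)
  where
  Γ = graph Ĝ
  smallest : ∃ (IsLeast Γ ∅ (T Ĝ))
  smallest = minJoin Ĝ (F₀ , λ x → trans (sym (isOdd-degIn Ĝ F₀ x)) (∂F₀ x))
  F = proj₁ smallest
  F-least = proj₂ smallest
  open IsLeast F-least
  module E = SynthesisExtreme Ĝ S syn F F-least
  drop : ∀ {x y J} → S x ≡ true → S y ≡ true → ∂ Γ J ≗ T Ĝ ⊕ ⁅ x ⁆ ⊕ ⁅ y ⁆ → Off S (∂ Γ J) (T Ĝ)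
  drop {x} {y} Sx Sy ∂J z Sz = trans (∂J z) (trans (cong₂ _xor_ (trans (cong (T Ĝ z xor_) (off Sx)) (xor-identityʳ (T Ĝ z))) (off Sy)) (xor-identityʳ (T Ĝ z)))
    where
    off : ∀ {a} → S a ≡ true → (a == z) ≡ false
    off Sa = ==-≢ λ a≡z → conflict Sa (trans (cong S a≡z) Sz)
  maximal : ∀ Y → Bipartitic Ĝ Y → IsExtreme Ĝ Y → S ⊆ Y → Y ⊆ S
  maximal Y _ (F′ , F′-min , ext) S⊆Y y Yy = inS (S y) refl
    where
    inS : ∀ b → S y ≡ b → b ≡ true
    inS true  _  = refl
    inS false Sy = let (_ , x , Sx , le) = SynthesisExtreme.all-InD Ĝ S syn F′ (MinJoin⇒IsLeast Ĝ F′-min) y Sy in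
      ⊥-elim (LamGe⇒≤ (IsLeast.join (MinJoin⇒IsLeast Ĝ F′-min)) (ext x y (S⊆Y x Sx) Yy) le)

-- Components of the complement of an extreme set

record Labelling {n k} (pairs : Fin k → Fin n × Fin n) : Set₁ where
  field
    label    : Fin n → Fin n
    joined   : ∀ i → label (proj₁ (pairs i)) ≡ label (proj₂ (pairs i))
    -- Vertices with equal labels are connected: no closed predicate separates them.
    carry    : (P : Fin n → Set) → (∀ i → P (proj₁ (pairs i)) → P (proj₂ (pairs i))) →
               (∀ i → P (proj₂ (pairs i)) → P (proj₁ (pairs i))) → ∀ {x y} → label x ≡ label y → P x → P y

labelling : ∀ {n k} (pairs : Fin k → Fin n × Fin n) → Labelling pairs
labelling {k = zero}  pairs = record { label = λ x → x ; joined = λ () ; carry = λ P _ _ x≡y → subst P x≡y }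
labelling {n} {suc k} pairs = record { label = label′ ; joined = joined′ ; carry = carry′ }
  where
  open Labelling (labelling (pairs ∘ fs))
  a = proj₁ (pairs fz)
  b = proj₂ (pairs fz)
  merge : Fin n → Fin n
  merge l = if l == label a then label b else l
  label′ : Fin n → Fin n
  label′ x = merge (label x)
  merge-b : ∀ c → (if c then label b else label b) ≡ label b
  merge-b true  = refl
  merge-b false = refl
  joined′ : ∀ i → label′ (proj₁ (pairs i)) ≡ label′ (proj₂ (pairs i))
  joined′ fz     = trans (cong (if_then label b else label a) (==-refl (label a))) (sym (merge-b _))
  joined′ (fs i) = cong merge (joined i)
  carry′ : (P : Fin n → Set) → (∀ i → P (proj₁ (pairs i)) → P (proj₂ (pairs i))) →
           (∀ i → P (proj₂ (pairs i)) → P (proj₁ (pairs i))) → ∀ {x y} → label′ x ≡ label′ y → P x → P y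
  carry′ P f g {x} {y} eq Px with label x ≟ label a | label y ≟ label a
  ... | yes x~a | yes y~a = carry P (f ∘ fs) (g ∘ fs) (trans x~a (sym y~a)) Px
  ... | yes x~a | no _    = carry P (f ∘ fs) (g ∘ fs) eq (f fz (carry P (f ∘ fs) (g ∘ fs) x~a Px))
  ... | no _    | yes y~a = carry P (f ∘ fs) (g ∘ fs) (sym y~a) (g fz (carry P (f ∘ fs) (g ∘ fs) eq Px))
  ... | no _    | no _    = carry P (f ∘ fs) (g ∘ fs) eq Px

-- The hypothesis near says that every vertex outside S has negative distance to S.
module Dominating (𝔾 : BGraft) (S : VSet (graph 𝔾)) (c : Bool) (S-col : ∀ x → S x ≡ true → col 𝔾 x ≡ c)
                  (F : ESet (graph 𝔾)) (F-least : IsLeast (graph 𝔾) S (T 𝔾) F)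
                  (near : ∀ y → S y ≡ false → ∃ λ J → Off S (∂ (graph 𝔾) J) (T 𝔾 ⊕ ⁅ y ⁆) × suc (count J) ≤ count F) where

  Γ = graph 𝔾
  n = count F
  open IsLeast F-least

  private
    off-S : ∀ {a x} → S a ≡ true → S x ≡ false → (a == x) ≡ false
    off-S Sa Sx = ==-≢ λ a≡x → conflict Sa (trans (cong S a≡x) Sx)

  abstract
    reach : ∀ u → ∃ λ J → Off S (∂ Γ J) (T 𝔾 ⊕ ⁅ u ⁆)
    reach u with S u in Su
    ... | true  = F , λ x Sx → trans (join x) (sym (trans (cong (T 𝔾 x xor_) (off-S Su Sx)) (xor-identityʳ (T 𝔾 x))))
    ... | false = let (J , ∂J , _) = near u Su in J , ∂J

  open Levels 𝔾 F-least c S-col reach public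
  open Spread 0 z≤n public

  abstract
    close : ∀ {u} → S u ≡ false → Close u
    close {u} Su = let (J , ∂J , J<n) = near u Su in
      ≤-trans (s≤s (ℓ-least u J ∂J)) (≤-trans J<n (≤-reflexive (sym (+-identityʳ n))))

    contact : ∀ {e a u} → Links Γ e a u → S a ≡ true → n ≤ suc (ℓ u)
    contact {e} {a} {u} l Sa = ≤-trans (least (nearest u ⊕ ⁅ e ⁆) (Off-⊕ Γ (∂nearest u) (Off-edge-M Γ {S} {e} l Sa)
      λ x → taut 2 (λ t b → (t xor b) xor b) (λ t b → t) refl (T 𝔾 x) (u == x))) (count-toggle-≤ (nearest u) e)

    -- Edges meeting S are replaced by trivial pairs, so the classes are the components of the graph minus S.
    pairs : Fin (nE Γ) → Fin (nV Γ) × Fin (nV Γ)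
    pairs e = if S (proj₁ (ends Γ e)) ∨ S (proj₂ (ends Γ e)) then (proj₁ (ends Γ e) , proj₁ (ends Γ e)) else ends Γ e

    components : Labelling pairs
    components = labelling pairs

    lab : Fin (nV Γ) → Fin (nV Γ)
    lab = Labelling.label components

    lab-edge : ∀ {e x y} → Links Γ e x y → S x ≡ false → S y ≡ false → lab x ≡ lab y
    lab-edge {e} (inj₁ refl) Sx Sy with Labelling.joined components e
    ... | h rewrite Sx | Sy = h
    lab-edge {e} (inj₂ refl) Sx Sy with Labelling.joined components e
    ... | h rewrite Sx | Sy = sym h

    lab-carry : (P : Fin (nV Γ) → Set) → (∀ {e x y} → Links Γ e x y → S x ≡ false → S y ≡ false → P x → P y) →
                ∀ {x y} → lab x ≡ lab y → P x → P y
    lab-carry P h = Labelling.carry components P forth back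
      where
      forth : ∀ e → P (proj₁ (pairs e)) → P (proj₂ (pairs e))
      forth e with S (proj₁ (ends Γ e)) in S₁ | S (proj₂ (ends Γ e)) in S₂
      ... | true  | _     = λ q → q
      ... | false | true  = λ q → q
      ... | false | false = h {e} (inj₁ refl) S₁ S₂
      back : ∀ e → P (proj₂ (pairs e)) → P (proj₁ (pairs e))
      back e with S (proj₁ (ends Γ e)) in S₁ | S (proj₂ (ends Γ e)) in S₂
      ... | true  | _     = λ q → q
      ... | false | true  = λ q → q
      ... | false | false = h {e} (inj₂ refl) S₂ S₁

  lab-S : ∀ {x y} → lab x ≡ lab y → S x ≡ true → y ≡ x
  lab-S {x} eq Sx = lab-carry (_≡ x) (λ _ Su _ u≡x → conflict Sx (trans (cong S (sym u≡x)) Su)) eq refl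

  lab-∉S : ∀ {x y} → lab x ≡ lab y → S x ≡ false → S y ≡ false
  lab-∉S {x} {y} eq Sx = ¬-not λ Sy → conflict Sy (trans (cong S (sym (lab-S (sym eq) Sy))) Sx)

  lab-apart : ∀ {y z} → lab z ≡ lab y → S z ≡ false → Apart y z
  lab-apart {y} {z} eq Sz = lab-carry (λ a → Apart a z)
    (λ {e} l Sx Sy h → apart-step (links-sym {Γ} {e} l) (close Sy) (close Sz) h) eq (apart-refl (close Sz))

  module Component (y₀ : Fin (nV Γ)) (y₀∉S : S y₀ ≡ false) where

    inK : VSet Γ
    inK x = lab x == lab y₀

    K-lab : ∀ {x y} → inK x ≡ true → inK y ≡ true → lab x ≡ lab y
    K-lab Kx Ky = trans (==-≡ Kx) (sym (==-≡ Ky))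

    K∉S : ∀ {x} → inK x ≡ true → S x ≡ false
    K∉S Kx = lab-∉S (sym (==-≡ Kx)) y₀∉S

    K-apart : ∀ {x y} → inK x ≡ true → inK y ≡ true → Apart x y
    K-apart Kx Ky = lab-apart (K-lab Ky Kx) (K∉S Ky)

    ∂K : ESet Γ
    ∂K = cut Γ inK

    record Crossing (e : Fin (nE Γ)) : Set where
      field
        {foot tip} : Fin (nV Γ)
        links : Links Γ e tip foot
        foot∈ : inK foot ≡ true
        tip∈  : S tip ≡ true

      n≤ : n ≤ suc (ℓ foot)
      n≤ = contact links tip∈

      ∂edge : Off S (∂ Γ ⁅ e ⁆) ⁅ foot ⁆
      ∂edge = Off-edge-M Γ {S} {e} links tip∈

    crossing : ∀ {e} → ∂K e ≡ true → Crossing e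
    crossing {e} h = let (x , w , l , Kx , Kw) = cut-end Γ inK {e} h in record
      { links = links-sym {Γ} {e} l ; foot∈ = Kx
      ; tip∈ = 𝔹.¬-not {x = S w} {y = false} λ Sw → ==-≢⁻ Kw (trans (sym (lab-edge {e} l (K∉S Kx) Sw)) (==-≡ Kx)) }

    open Crossing

    module _ {J : ESet Γ} {e₁ e₂ : Fin (nE Γ)} (e₁≢e₂ : e₁ ≢ e₂) (J₁ : J e₁ ≡ true) (J₂ : J e₂ ≡ true) where

      count-minus-two : suc (suc (count (J ⊕ ⁅ e₁ ⁆ ⊕ ⁅ e₂ ⁆))) ≡ count J
      count-minus-two = trans (cong suc (count-toggle-in (J ⊕ ⁅ e₁ ⁆) e₂ (trans (cong (J e₂ xor_) (==-≢ e₁≢e₂)) (trans (xor-identityʳ _) J₂))))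
                              (count-toggle-in J e₁ J₁)

      one-crossing : Off S (∂ Γ J) (T 𝔾) → count J ≤ n → Crossing e₁ → Crossing e₂ → ⊥
      one-crossing ∂J J≤n c₁ c₂ = ≤-absurd 0
        (K-apart (foot∈ c₁) (foot∈ c₂) J′ ∂J′ +≤ n≤ c₁ +≤ n≤ c₂ +≤ (≤-trans (≤-reflexive count-minus-two) J≤n))
        (arith (ℓ (foot c₁)) (ℓ (foot c₂)) (count J′) n)
        where
        J′ = J ⊕ ⁅ e₁ ⁆ ⊕ ⁅ e₂ ⁆
        ∂J′ : Off S (∂ Γ J′) (T 𝔾 ⊕ ⁅ foot c₁ ⁆ ⊕ ⁅ foot c₂ ⁆)
        ∂J′ = Off-⊕ Γ (Off-⊕ Γ ∂J (∂edge c₁) λ _ → refl) (∂edge c₂) λ _ → refl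
        arith : ∀ a b j n → suc (a + b) + (n + (n + suc (suc j))) ≡ suc ((j + (n + 0)) + (suc a + (suc b + n)) + 0)
        arith = solve-∀

    -- Same exchange as in apart-step: compare nearest y minus the two crossing edges with F.
    nearest-crossing : ∀ {y e₁ e₂} → inK y ≡ true → e₁ ≢ e₂ → nearest y e₁ ≡ true → nearest y e₂ ≡ true →
                       Crossing e₁ → Crossing e₂ → ⊥
    nearest-crossing {y} {e₁} {e₂} Ky e₁≢e₂ J₁ J₂ c₁ c₂ = byPosition (y ≟ r₁) (y ≟ r₂)
      where
      r₁ = foot c₁
      r₂ = foot c₂
      J′ : ESet Γ
      J′ = nearest y ⊕ ⁅ e₁ ⁆ ⊕ ⁅ e₂ ⁆
      ∂J′ : Off S (∂ Γ J′) (T 𝔾 ⊕ ⁅ y ⁆ ⊕ ⁅ r₁ ⁆ ⊕ ⁅ r₂ ⁆)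
      ∂J′ = Off-⊕ Γ (Off-⊕ Γ (∂nearest y) (∂edge c₁) λ _ → refl) (∂edge c₂) λ _ → refl
      J′≤ : suc (suc (count J′)) ≤ ℓ y
      J′≤ = ≤-reflexive (count-minus-two e₁≢e₂ J₁ J₂)
      ℓy : suc (ℓ y) ≤ n + 0
      ℓy = close (K∉S Ky)

      atFoot : ∀ {r} → n ≤ suc (ℓ r) → Off S (∂ Γ J′) (T 𝔾 ⊕ ⁅ r ⁆) → ⊥
      atFoot {r} n≤r ∂r = ≤-absurd 1 (n≤r +≤ ℓ-least r J′ ∂r +≤ J′≤ +≤ ℓy) (arith n (ℓ r) (count J′) (ℓ y))
        where
        arith : ∀ n l j m → n + (l + (suc (suc j) + suc m)) ≡ suc (suc l + (j + (m + (n + 0))) + 1)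
        arith = solve-∀

      away : y ≢ r₁ → y ≢ r₂ → ⊥
      away y≢r₁ y≢r₂ = byTarget (S target) refl
        where
        ∂Δ : Off S (∂ Γ (F ⊕ J′)) ((⁅ r₁ ⁆ ⊕ ⁅ r₂ ⁆) ⊕ ⁅ y ⁆)
        ∂Δ = Off-⊕ Γ (≗⇒Off join) ∂J′ λ x → taut 4 (λ t a b d → t xor (((t xor a) xor b) xor d)) (λ t a b d → (b xor d) xor a) refl
               (T 𝔾 x) (y == x) (r₁ == x) (r₂ == x)
        open OddPath (oddPath {Γ} (F ⊕ J′) y (trans (∂Δ y (K∉S Ky))
               (cong₂ _xor_ (cong₂ _xor_ (==-≢ (y≢r₁ ∘ sym)) (==-≢ (y≢r₂ ∘ sym))) (==-refl y))))
        a = count (F ⊕ path)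
        b = count (J′ ⊕ path)
        swap : a + b ≤ n + count J′
        swap = ≤-reflexive (count-exchange-⊕ F J′ path inside)

        toFoot : ∀ {r r′} → target ≡ r → inK r ≡ true → n ≤ suc (ℓ r) → n ≤ suc (ℓ r′) →
                 Off S (∂ Γ J′) (T 𝔾 ⊕ ⁅ y ⁆ ⊕ ⁅ r ⁆ ⊕ ⁅ r′ ⁆) → ⊥
        toFoot {r} {r′} v≡r Kr n≤r n≤r′ ∂J″ = ≤-absurd 0 (yr≤a +≤ r′≤b +≤ n≤r +≤ n≤r′ +≤ swap +≤ J′≤)
            (arith (ℓ y) (ℓ r) (ℓ r′) n a b (count J′))
          where
          P : Off S (∂ Γ path) (⁅ y ⁆ ⊕ ⁅ r ⁆)
          P x _ = trans (∂path x) (cong (λ v → (y == x) xor (v == x)) v≡r)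
          yr≤a : suc (ℓ y + ℓ r) ≤ a + (n + 0)
          yr≤a = K-apart Ky Kr (F ⊕ path) (Off-⊕ Γ (≗⇒Off join) P λ x → sym (xor-assoc (T 𝔾 x) _ _))
          r′≤b : ℓ r′ ≤ b
          r′≤b = ℓ-least r′ (J′ ⊕ path) (Off-⊕ Γ ∂J″ P λ x → taut 4 (λ t a b d → (((t xor a) xor b) xor d) xor (a xor b)) (λ t a b d → t xor d) refl
                   (T 𝔾 x) (y == x) (r == x) (r′ == x))
          arith : ∀ y r s n a b j → suc (y + r) + (s + (n + (n + ((a + b) + suc (suc j)))))
                                  ≡ suc ((a + (n + 0)) + (b + (suc r + (suc s + ((n + j) + y)))) + 0)
          arith = solve-∀

        toS : S target ≡ true → ⊥
        toS Sv = ≤-absurd 0 (y≤a +≤ rr≤b +≤ n≤ c₁ +≤ n≤ c₂ +≤ swap +≤ J′≤) (arith (ℓ y) (ℓ r₁) (ℓ r₂) n a b (count J′))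
          where
          P : Off S (∂ Γ path) ⁅ y ⁆
          P x Sx = trans (∂path x) (trans (cong ((y == x) xor_) (off-S Sv Sx)) (xor-identityʳ _))
          y≤a : ℓ y ≤ a
          y≤a = ℓ-least y (F ⊕ path) (Off-⊕ Γ (≗⇒Off join) P λ _ → refl)
          rr≤b : suc (ℓ r₁ + ℓ r₂) ≤ b + (n + 0)
          rr≤b = K-apart (foot∈ c₁) (foot∈ c₂) (J′ ⊕ path) (Off-⊕ Γ ∂J′ P λ x →
                   taut 4 (λ t a b d → (((t xor a) xor b) xor d) xor a) (λ t a b d → (t xor b) xor d) refl
                     (T 𝔾 x) (y == x) (r₁ == x) (r₂ == x))
          arith : ∀ y r s n a b j → y + (suc (r + s) + (n + (n + ((a + b) + suc (suc j)))))
                                  ≡ suc (a + ((b + (n + 0)) + (suc r + (suc s + ((n + j) + y)))) + 0)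
          arith = solve-∀

        byTarget : ∀ s → S target ≡ s → ⊥
        byTarget true  Sv = toS Sv
        byTarget false Sv = [ (λ v≡r₁ → toFoot v≡r₁ (foot∈ c₁) (n≤ c₁) (n≤ c₂) ∂J′)
                            , (λ v≡r₂ → toFoot v≡r₂ (foot∈ c₂) (n≤ c₂) (n≤ c₁)
                                (Off-trans ∂J′ λ x _ → taut 4 (λ t a b d → ((t xor a) xor b) xor d) (λ t a b d → ((t xor a) xor d) xor b) refl
                                   (T 𝔾 x) (y == x) (r₁ == x) (r₂ == x))) ]′
                            (one-of-two r₁ r₂ target≢ (trans (sym (∂Δ target Sv)) target-odd))

      byPosition : Dec (y ≡ r₁) → Dec (y ≡ r₂) → ⊥
      byPosition (yes y≡r₁) _ = atFoot (n≤ c₂) (Off-trans ∂J′ λ x _ →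
        trans (cong (λ v → ((T 𝔾 x xor (v == x)) xor (r₁ == x)) xor (r₂ == x)) y≡r₁)
              (taut 3 (λ t a b → ((t xor a) xor a) xor b) (λ t a b → t xor b) refl (T 𝔾 x) (r₁ == x) (r₂ == x)))
      byPosition (no _) (yes y≡r₂) = atFoot (n≤ c₁) (Off-trans ∂J′ λ x _ →
        trans (cong (λ v → ((T 𝔾 x xor (v == x)) xor (r₁ == x)) xor (r₂ == x)) y≡r₂)
              (taut 3 (λ t a b → ((t xor b) xor a) xor b) (λ t a b → t xor a) refl (T 𝔾 x) (r₁ == x) (r₂ == x)))
      byPosition (no y≢r₁) (no y≢r₂) = away y≢r₁ y≢r₂

    parityK : Bool
    parityK = ⨁ (inK ⊓ T 𝔾)

    private
      ⨁-∂K : ∀ {U} J → Off S (∂ Γ J) U → ⨁ (J ⊓ ∂K) ≡ ⨁ (inK ⊓ U)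
      ⨁-∂K {U} J ∂J = trans (sym (⨁-∂ Γ inK J)) (⨁-cong λ x → agree x (inK x) refl)
        where
        agree : ∀ x b → inK x ≡ b → b ∧ ∂ Γ J x ≡ b ∧ U x
        agree x true  Kx = ∂J x (K∉S Kx)
        agree x false _  = refl

      nearest-parity : ∀ {y} → inK y ≡ true → ⨁ (nearest y ⊓ ∂K) ≡ parityK xor true
      nearest-parity {y} Ky = trans (⨁-∂K (nearest y) (∂nearest y))
        (trans (⨁-cong λ x → 𝔹.∧-distribˡ-xor (inK x) (T 𝔾 x) (y == x))
          (trans (⨁-⊕ (inK ⊓ T 𝔾) (inK ⊓ ⁅ y ⁆)) (cong (parityK xor_) (trans (⨁-⁅⁆ y inK) Ky))))

      crossing-of : ∀ J → ⨁ (J ⊓ ∂K) ≡ true → ∃ λ e → J e ≡ true × ∂K e ≡ true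
      crossing-of J h = let (e , q) = ⨁-witness (J ⊓ ∂K) h in e , ∧-true (J e) q

    abstract
      parityK-odd : parityK ≡ true
      parityK-odd = 𝔹.¬-not {x = parityK} {y = false} absurd
        where
        absurd : parityK ≢ false
        absurd even = clash (nearest r₀ e₀) refl
          where
          odd : ∀ {y} → inK y ≡ true → ∃ λ e → nearest y e ≡ true × ∂K e ≡ true
          odd {y} Ky = crossing-of (nearest y) (trans (nearest-parity Ky) (cong (_xor true) even))
          first : ∃ λ e → nearest y₀ e ≡ true × ∂K e ≡ true
          first = odd (==-refl (lab y₀))
          e₀ : Fin (nE Γ)
          e₀ = proj₁ first
          c₀ : Crossing e₀
          c₀ = crossing (proj₂ (proj₂ first))
          r₀ : Fin (nV Γ)
          r₀ = foot c₀
          second : ∃ λ e → nearest r₀ e ≡ true × ∂K e ≡ true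
          second = odd (foot∈ c₀)
          J : ESet Γ
          J = nearest r₀ ⊕ ⁅ e₀ ⁆
          ∂J : Off S (∂ Γ J) (T 𝔾)
          ∂J = Off-⊕ Γ (∂nearest r₀) (∂edge c₀) λ x → taut 2 (λ t a → (t xor a) xor a) (λ t a → t) refl (T 𝔾 x) (r₀ == x)
          ℓ<n : suc (ℓ r₀) ≤ n
          ℓ<n = ≤-trans (close (K∉S (foot∈ c₀))) (≤-reflexive (+-identityʳ n))
          clash : ∀ b → nearest r₀ e₀ ≡ b → ⊥
          clash true  h = <⇒≱ (≤-trans (s≤s (≤-trans (n≤1+n _) (≤-reflexive (count-toggle-in (nearest r₀) e₀ h)))) ℓ<n) (least J ∂J)
          clash false h = one-crossing {J} e₀≢e₂ (cong₂ _xor_ h (==-refl e₀))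
              (trans (cong (nearest r₀ (proj₁ second) xor_) (==-≢ e₀≢e₂)) (trans (xor-identityʳ _) (proj₁ (proj₂ second))))
              ∂J (≤-trans (≤-reflexive (count-toggle-out (nearest r₀) e₀ h)) ℓ<n) c₀ (crossing (proj₂ (proj₂ second)))
            where
            e₀≢e₂ : e₀ ≢ proj₁ second
            e₀≢e₂ eq = conflict (proj₁ (proj₂ second)) (trans (cong (nearest r₀) (sym eq)) h)

      F-crossing : ∃ λ f → F f ≡ true × ∂K f ≡ true
      F-crossing = crossing-of F (trans (⨁-∂K F (≗⇒Off join)) parityK-odd)

      nearest-avoids : ∀ {y e} → inK y ≡ true → nearest y e ≡ true → ∂K e ≡ false
      nearest-avoids {y} {e} Ky Je = ¬-not λ cross → two cross
        where
        two : ∂K e ≡ true → ⊥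
        two cross = second (⨁-witness ((nearest y ⊓ ∂K) ⊕ ⁅ e ⁆) odd)
          where
          odd : ⨁ ((nearest y ⊓ ∂K) ⊕ ⁅ e ⁆) ≡ true
          odd = trans (⨁-⊕ (nearest y ⊓ ∂K) ⁅ e ⁆) (cong₂ _xor_ (trans (nearest-parity Ky) (cong (_xor true) parityK-odd))
                  (⨁-⁅⁆ e (λ _ → true)))
          second : (∃ λ e′ → ((nearest y ⊓ ∂K) ⊕ ⁅ e ⁆) e′ ≡ true) → ⊥
          second (e′ , h) = nearest-crossing Ky e≢e′ Je (proj₁ both) (crossing cross) (crossing (proj₂ both))
            where
            e≢e′ : e ≢ e′
            e≢e′ refl = conflict h (cong₂ _xor_ (cong₂ _∧_ Je cross) (==-refl e))
            both : nearest y e′ ≡ true × ∂K e′ ≡ true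
            both = ∧-true (nearest y e′) ([ (λ e≡e′ → ⊥-elim (e≢e′ e≡e′)) , (λ q → q) ]′ (toggled-in (nearest y ⊓ ∂K) e h))

    F-crossing-unique : ∀ {f f′} → F f ≡ true → ∂K f ≡ true → F f′ ≡ true → ∂K f′ ≡ true → f ≡ f′
    F-crossing-unique {f} {f′} Ff cf Ff′ cf′ = decide (f ≟ f′)
      where
      decide : Dec (f ≡ f′) → f ≡ f′
      decide (yes f≡f′) = f≡f′
      decide (no f≢f′) = ⊥-elim (one-crossing {F} f≢f′ Ff Ff′ (≗⇒Off join) ≤-refl (crossing cf) (crossing cf′))

    module Copy {Η : Graph} {P : Fin (nV Γ) → Set} (E : InducedOn Γ P Η)
                (P⇒K : ∀ {x} → P x → inK x ≡ true) (K⇒P : ∀ {x} → inK x ≡ true → P x) where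

      private
        module E = Induced E

        f : Fin (nE Γ)
        f = proj₁ F-crossing

        Ff : F f ≡ true
        Ff = proj₁ (proj₂ F-crossing)

        cf : Crossing f
        cf = crossing (proj₂ (proj₂ F-crossing))

        ιK : ∀ y → inK (ι E y) ≡ true
        ιK y = P⇒K (ι-in E y)

        ι∉S : ∀ y → S (ι E y) ≡ false
        ι∉S y = K∉S (ιK y)

        inner-uncut : ∀ g → ∂K (κ E g) ≡ false
        inner-uncut g = trans (cong (λ ab → inK (proj₁ ab) xor inK (proj₂ ab)) (κ-ends E g))
                              (cong₂ _xor_ (ιK _) (ιK _))

        f∉κ : ∀ g → κ E g ≢ f
        f∉κ g κg≡f = conflict (proj₂ (proj₂ F-crossing)) (trans (cong ∂K (sym κg≡f)) (inner-uncut g))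

        root-img : ∃ λ y → ι E y ≡ foot cf
        root-img = ι-img E (foot cf) (K⇒P (foot∈ cf))

      root : Fin (nV Η)
      root = proj₁ root-img

      private
        ι-root : ι E root ≡ foot cf
        ι-root = proj₂ root-img

        foot-== : ∀ y → (foot cf == ι E y) ≡ (root == y)
        foot-== y = trans (cong (_== ι E y) (sym ι-root)) (==-inj (ι E) (ι-inj E) root y)

      toothGraft : BGraft
      toothGraft = record
        { graph = Η
        ; T = λ y → T 𝔾 (ι E y) xor (y == root)
        ; col = λ y → col 𝔾 (ι E y) xor not c
        ; bip = λ g → trans (cong (_xor not c) (links-col 𝔾 {κ E g} (E.links-κ {g} (inj₁ refl))))
                            (sym (𝔹.not-distribˡ-xor (col 𝔾 (ι E (proj₁ (ends Η g)))) (not c))) }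

      Fᴷ : ESet Η
      Fᴷ = F ∘ κ E

      T-ι : ∀ y → T 𝔾 (ι E y) ≡ T toothGraft y xor (y == root)
      T-ι y = taut 2 (λ t a → t) (λ t a → (t xor a) xor a) refl (T 𝔾 (ι E y)) (y == root)

      root-col : col toothGraft root ≡ false
      root-col = trans (cong (λ x → col 𝔾 x xor not c) ι-root)
        (trans (cong (_xor not c) (trans (links-col 𝔾 {f} (links cf)) (cong not (S-col _ (tip∈ cf))))) (xor-same (not c)))

      private
        supported : ∀ {J : ESet Γ} → (∀ {e} → J e ≡ true → ∂K e ≡ false) →
                    ∀ y e → J e ≡ true → inc Γ e (ι E y) ≡ true → ∃ λ g → κ E g ≡ e
        supported {J} uncut y e Je ie = let (w , l , _) = other-end {Γ} e (ι E y) ie in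
          κ-links E l (ι-in E y) (K⇒P (trans (sym (xor-true (trans (sym (cut-links Γ inK {e} l)) (uncut Je)))) (ιK y)))
          where
          xor-true : ∀ {a b} → a xor b ≡ false → a ≡ b
          xor-true {true}  {true}  _ = refl
          xor-true {false} {false} _ = refl

        ∂Fᴷ : ∂ Η Fᴷ ≗ T toothGraft
        ∂Fᴷ y = begin
          ∂ Η Fᴷ y                                     ≡⟨ ∂-cong Η (λ g → sym (trans (cong (F (κ E g) xor_) (==-≢ (f∉κ g ∘ sym))) (xor-identityʳ _))) y ⟩
          ∂ Η ((F ⊕ ⁅ f ⁆) ∘ κ E) y                    ≡⟨ E.∂-restrict (F ⊕ ⁅ f ⁆) y (supported {F ⊕ ⁅ f ⁆} uncut y) ⟩
          ∂ Γ (F ⊕ ⁅ f ⁆) (ι E y)                      ≡⟨ Off-⊕ Γ (≗⇒Off join) (∂edge cf) (λ _ → refl) (ι E y) (ι∉S y) ⟩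
          T 𝔾 (ι E y) xor (foot cf == ι E y)           ≡⟨ cong (T 𝔾 (ι E y) xor_) (trans (foot-== y) (==-sym root y)) ⟩
          T toothGraft y                               ∎
          where
          open ≡-Reasoning
          uncut : ∀ {e} → (F ⊕ ⁅ f ⁆) e ≡ true → ∂K e ≡ false
          uncut {e} h = ¬-not λ ce → [ (λ f≡e → conflict h (subst (λ e → (F ⊕ ⁅ f ⁆) e ≡ false) f≡e (cong₂ _xor_ Ff (==-refl f))))
                                     , (λ Fe → conflict h (subst (λ e → (F ⊕ ⁅ f ⁆) e ≡ false) (F-crossing-unique Ff (proj₂ (proj₂ F-crossing)) Fe ce)
                                                                 (cong₂ _xor_ Ff (==-refl f)))) ]′ (toggled-in F f h)

        byCopy : ∀ {x} {Q : Fin (nV Γ) → Set} → (∀ y → Q (ι E y)) → ((∀ y → ι E y ≢ x) → Q x) → Q x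
        byCopy {x} {Q} inside outside with any? (λ y → ι E y ≟ x)
        ... | yes (y , ιy≡x) = subst Q ιy≡x (inside y)
        ... | no  none       = outside λ y ιy≡x → none (y , ιy≡x)

        ∂-glue : ∀ {J J′} {U : VSet Γ} → Off S (∂ Γ J) U → (∀ y → ∂ Η (J ∘ κ E) y ≡ ∂ Η J′ y) → Off S (∂ Γ (E.replace J J′)) U
        ∂-glue {J} {J′} {U} ∂J same x Sx = byCopy {x} {λ x → S x ≡ false → ∂ Γ (E.replace J J′) x ≡ U x}
          (λ y Sy → trans (E.∂-replace J J′ y) (trans (cong₂ _xor_ (∂J (ι E y) Sy) (trans (cong (_xor ∂ Η J′ y) (same y)) (xor-same (∂ Η J′ y)))) (xor-identityʳ _)))
          (λ x∉ Sx → trans (E.∂-replace-out J J′ x∉) (∂J x Sx)) Sx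

      Fᴷ-least : IsLeast Η ∅ (T toothGraft) Fᴷ
      Fᴷ-least = record { join = ∂Fᴷ ; least = λ J ∂J → +-cancelˡ-≤ n _ _
        (≤-trans (+-monoˡ-≤ (count Fᴷ) (least (E.replace F J) (∂-glue (≗⇒Off join) λ y → trans (∂Fᴷ y) (sym (∂J y refl)))))
                 (≤-reflexive (E.count-replace F J))) }

      primalᴷ : PrimalWrt toothGraft Fᴷ root
      primalᴷ y = join⇒LamLe Fᴷ-least J ∂J (≤⇒≤ℤ J≤)
        where
        N = nearest (ι E y)
        J : ESet Η
        J = N ∘ κ E
        ∂N : ∀ z → ∂ Η J z ≡ T 𝔾 (ι E z) xor (y == z)
        ∂N z = trans (E.∂-restrict N z (supported {N} (nearest-avoids (ιK y)) z))
                     (trans (∂nearest (ι E y) (ι E z) (ι∉S z)) (cong (T 𝔾 (ι E z) xor_) (==-inj (ι E) (ι-inj E) y z)))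
        ∂J : ∂ Η J ≗ T toothGraft ⊕ ⁅ root ⁆ ⊕ ⁅ y ⁆
        ∂J z = trans (∂N z) (cong (_xor (y == z)) (trans (T-ι z) (cong (T toothGraft z xor_) (==-sym z root))))
        R = E.replace N Fᴷ ⊕ ⁅ f ⁆
        ∂R : Off S (∂ Γ R) (T 𝔾)
        ∂R = Off-⊕ Γ {U = T 𝔾 ⊕ ⁅ foot cf ⁆} replaced (∂edge cf) λ x → taut 2 (λ t a → (t xor a) xor a) (λ t a → t) refl (T 𝔾 x) (foot cf == x)
          where
          replaced : Off S (∂ Γ (E.replace N Fᴷ)) (T 𝔾 ⊕ ⁅ foot cf ⁆)
          replaced x Sx = byCopy {x} {λ x → S x ≡ false → ∂ Γ (E.replace N Fᴷ) x ≡ T 𝔾 x xor (foot cf == x)}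
            (λ z Sz → trans (E.∂-replace N Fᴷ z) (trans
              (cong₂ _xor_ (trans (∂nearest (ι E y) (ι E z) Sz) (cong (T 𝔾 (ι E z) xor_) (==-inj (ι E) (ι-inj E) y z)))
                           (cong₂ _xor_ (∂N z) (∂Fᴷ z)))
              (trans (taut 3 (λ t a b → (t xor a) xor ((t xor a) xor (t xor b))) (λ t a b → t xor b) refl (T 𝔾 (ι E z)) (y == z) (z == root))
                     (cong (T 𝔾 (ι E z) xor_) (trans (==-sym z root) (sym (foot-== z)))))))
            (λ x∉ Sx → trans (E.∂-replace-out N Fᴷ x∉) (trans (∂nearest (ι E y) x Sx)
              (cong (T 𝔾 x xor_) (trans (==-≢ (x∉ y)) (sym (==-≢ (λ q → x∉ root (trans ι-root q)))))))) Sx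
        J≤ : count J ≤ count Fᴷ
        J≤ = +-cancelˡ-≤ n _ _ (≤-pred (begin
          suc (n + count J)                              ≤⟨ s≤s (+-monoˡ-≤ (count J) (≤-trans (least R ∂R) (count-toggle-≤ (E.replace N Fᴷ) f))) ⟩
          suc (suc (count (E.replace N Fᴷ)) + count J)   ≡⟨ cong (suc ∘ suc) (E.count-replace N Fᴷ) ⟩
          suc (suc (ℓ (ι E y) + count Fᴷ))               ≤⟨ s≤s (+-monoˡ-≤ (count Fᴷ) (≤-trans (close (ι∉S y)) (≤-reflexive (+-identityʳ n)))) ⟩
          suc (n + count Fᴷ)                             ∎))
          where open ≤-Reasoning

      contactᴷ : ∀ {e a} y → Links Γ e a (ι E y) → S a ≡ true → InAr toothGraft Fᴷ root y
      contactᴷ {e} y l Sa = primalᴷ y , LamGe-0 ∂Fᴷ bound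
        where
        bound : ∀ J → ∂ Η J ≗ T toothGraft ⊕ ⁅ root ⁆ ⊕ ⁅ y ⁆ → count Fᴷ ≤ count J
        bound J ∂J = +-cancelˡ-≤ n _ _ (begin
          n + count Fᴷ                       ≤⟨ +-monoˡ-≤ (count Fᴷ) (contact {e} l Sa) ⟩
          suc (ℓ (ι E y)) + count Fᴷ         ≤⟨ +-monoˡ-≤ (count Fᴷ) (s≤s (ℓ-least (ι E y) (R ⊕ ⁅ f ⁆) ∂R⊕f)) ⟩
          suc (count (R ⊕ ⁅ f ⁆)) + count Fᴷ ≡⟨ cong (λ k → k + count Fᴷ) (count-toggle-in R f (trans (E.replace-out F J f∉κ) Ff)) ⟩
          count R + count Fᴷ                 ≡⟨ E.count-replace F J ⟩
          n + count J                        ∎)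
          where
          open ≤-Reasoning
          R = E.replace F J
          ∂R : Off S (∂ Γ R) (T 𝔾 ⊕ ⁅ foot cf ⁆ ⊕ ⁅ ι E y ⁆)
          ∂R x Sx = byCopy {x} {λ x → ∂ Γ R x ≡ (T 𝔾 x xor (foot cf == x)) xor (ι E y == x)}
            (λ z → trans (E.∂-replace F J z) (trans (cong₂ _xor_ (join (ι E z)) (cong₂ _xor_ (∂Fᴷ z) (∂J z)))
              (trans (taut 4 (λ t h r y → t xor (h xor ((h xor r) xor y))) (λ t h r y → (t xor r) xor y) refl (T 𝔾 (ι E z)) (T toothGraft z) (root == z) (y == z))
                     (cong₂ (λ r y → (T 𝔾 (ι E z) xor r) xor y) (sym (foot-== z)) (sym (==-inj (ι E) (ι-inj E) y z))))))
            (λ x∉ → trans (E.∂-replace-out F J x∉) (trans (join x) (sym (trans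
              (cong₂ (λ r y → (T 𝔾 x xor r) xor y) (==-≢ (λ q → x∉ root (trans ι-root q))) (==-≢ (x∉ y)))
              (trans (xor-identityʳ _) (xor-identityʳ _))))))
          ∂R⊕f : Off S (∂ Γ (R ⊕ ⁅ f ⁆)) (T 𝔾 ⊕ ⁅ ι E y ⁆)
          ∂R⊕f = Off-⊕ Γ ∂R (∂edge cf) λ x → taut 3 (λ t a b → ((t xor a) xor b) xor a) (λ t a b → t xor b) refl (T 𝔾 x) (foot cf == x) (ι E y == x)

-- The skeleton and the teeth

record Enumeration {k} (P : Sub k) : Set where
  field
    size   : ℕ
    at     : Fin size → Fin k
    at-inj : ∀ i j → at i ≡ at j → i ≡ j
    at∈    : ∀ i → P (at i) ≡ true
    find   : ∀ x → P x ≡ true → ∃ λ i → at i ≡ x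

enumerate : ∀ {k} (P : Sub k) → Enumeration P
enumerate {zero}  P = record { size = 0 ; at = λ () ; at-inj = λ () ; at∈ = λ () ; find = λ () }
enumerate {suc k} P = byHead (P fz) refl
  where
  open Enumeration (enumerate (P ∘ fs))
  byHead : ∀ b → P fz ≡ b → Enumeration P
  byHead false P₀ = record
    { size = size ; at = fs ∘ at ; at-inj = λ i j eq → at-inj i j (suc-injective eq) ; at∈ = at∈
    ; find = λ { fz h → conflict h P₀ ; (fs x) h → let (i , q) = find x h in i , cong fs q } }
  byHead true P₀ = record
    { size = suc size
    ; at = λ { fz → fz ; (fs i) → fs (at i) }
    ; at-inj = λ { fz fz _ → refl ; fz (fs j) () ; (fs i) fz () ; (fs i) (fs j) eq → cong fs (at-inj i j (suc-injective eq)) }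
    ; at∈ = λ { fz → P₀ ; (fs i) → at∈ i }
    ; find = λ { fz _ → fz , refl ; (fs x) h → let (i , q) = find x h in fs i , cong fs q } }

inducedCopy : (Γ : Graph) (P : Fin (nV Γ) → Set) (K : VSet Γ) → (∀ {x} → P x → K x ≡ true) → (∀ {x} → K x ≡ true → P x) →
              Σ Graph (InducedOn Γ P)
inducedCopy Γ P K P⇒K K⇒P = Η , record
  { ι = V.at ; ι-inj = V.at-inj ; ι-img = λ x Px → V.find x (P⇒K Px) ; ι-in = λ y → K⇒P (V.at∈ y)
  ; κ = E.at ; κ-inj = E.at-inj
  ; κ-img = λ e P₁ P₂ → E.find e (cong₂ _∧_ (P⇒K P₁) (P⇒K P₂))
  ; κ-ends = λ f → cong₂ _,_ (sym (proj₂ (V.find _ (proj₁ (both f))))) (sym (proj₂ (V.find _ (proj₂ (both f))))) }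
  where
  module V = Enumeration (enumerate K)
  module E = Enumeration (enumerate (λ e → K (proj₁ (ends Γ e)) ∧ K (proj₂ (ends Γ e))))
  both : ∀ f → K (proj₁ (ends Γ (E.at f))) ≡ true × K (proj₂ (ends Γ (E.at f))) ≡ true
  both f = ∧-true (K (proj₁ (ends Γ (E.at f)))) (E.at∈ f)
  Η : Graph
  Η = record { nV = V.size ; nE = E.size
             ; ends = λ f → proj₁ (V.find _ (proj₁ (both f))) , proj₁ (V.find _ (proj₂ (both f))) }

-- Every tooth has odd degree in each join, so a join with tooth degrees 1 is smallest tooth by tooth:
-- each edge has exactly one tooth end.
degree-one⇒comb : (𝕂 : BGraft) (J : ESet (graph 𝕂)) → IsJoin (graph 𝕂) (T 𝕂) J →
                  (∀ v → col 𝕂 v ≡ true → degIn (graph 𝕂) J v ≡ 1) → IsComb 𝕂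
degree-one⇒comb 𝕂 J J-join one K (K-join , K-min) v v∈B = decide (degIn Κ K v ≟ℕ 1)
  where
  Κ = graph 𝕂
  owner : Fin (nE Κ) → Fin (nV Κ)
  owner e = if col 𝕂 (proj₁ (ends Κ e)) then proj₁ (ends Κ e) else proj₂ (ends Κ e)
  open Blocks owner
  owner-col : ∀ e → col 𝕂 (owner e) ≡ true
  owner-col e with col 𝕂 (proj₁ (ends Κ e)) in c₁
  ... | true  = c₁
  ... | false = trans (bip 𝕂 e) (cong not c₁)
  block≡incident : ∀ u → col 𝕂 u ≡ true → ∀ e → block u e ≡ incident Κ e u
  block≡incident u u∈B e with col 𝕂 (proj₁ (ends Κ e)) in c₁
  ... | true  = sym (trans (cong ((proj₁ (ends Κ e) == u) ∨_) (==-≢ (λ q → conflict u∈B (trans (cong (col 𝕂) (sym q)) (trans (bip 𝕂 e) (cong not c₁))))))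
                           (𝔹.∨-identityʳ _))
  ... | false = sym (cong (_∨ (proj₂ (ends Κ e) == u)) (==-≢ (λ q → conflict u∈B (trans (cong (col 𝕂) (sym q)) c₁))))
  degree : ∀ L u → col 𝕂 u ≡ true → count (L ⊓ block u) ≡ degIn Κ L u
  degree L u u∈B = count-cong λ e → cong (L e ∧_) (block≡incident u u∈B e)
  1≤ : ∀ u → col 𝕂 u ≡ true → 1 ≤ degIn Κ K u
  1≤ u u∈B = positive (trans (K-join u) (trans (sym (J-join u)) (cong isOdd (one u u∈B))))
    where
    positive : ∀ {d} → isOdd d ≡ true → 1 ≤ d
    positive {suc d} _ = s≤s z≤n
  perBlock : ∀ u → count (J ⊓ block u) ≤ count (K ⊓ block u)
  perBlock u = byColour (col 𝕂 u) refl
    where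
    byColour : ∀ b → col 𝕂 u ≡ b → count (J ⊓ block u) ≤ count (K ⊓ block u)
    byColour true  u∈B = ≤-trans (≤-reflexive (trans (degree J u u∈B) (one u u∈B))) (≤-trans (1≤ u u∈B) (≤-reflexive (sym (degree K u u∈B))))
    byColour false u∉B = count-mono λ e h → conflict (owner-col e)
      (trans (cong (col 𝕂) (==-≡ (proj₂ (∧-true (J e) h)))) u∉B)
  decide : Dec (degIn Κ K v ≡ 1) → degIn Κ K v ≡ 1
  decide (yes q) = q
  decide (no ≢1) = ⊥-elim (<⇒≱ (count-blocks-< J K perBlock v strict) (K-min J J-join))
    where
    strict : count (J ⊓ block v) < count (K ⊓ block v)
    strict = ≤-trans (≤-reflexive (cong suc (trans (degree J v v∈B) (one v v∈B))))
                     (≤-trans (≤∧≢⇒< (1≤ v v∈B) (≢1 ∘ sym)) (≤-reflexive (sym (degree K v v∈B))))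

module DominatingSynthesis
    (𝔾 : BGraft) (S : VSet (graph 𝔾)) (c : Bool) (S-col : ∀ x → S x ≡ true → col 𝔾 x ≡ c)
    (F : ESet (graph 𝔾)) (F-least : IsLeast (graph 𝔾) S (T 𝔾) F)
    (near : ∀ y → S y ≡ false → ∃ λ J → Off S (∂ (graph 𝔾) J) (T 𝔾 ⊕ ⁅ y ⁆) × suc (count J) ≤ count F) where

  open Dominating 𝔾 S c S-col F F-least near
  open IsLeast F-least

  private
    used : VSet Γ
    used l = ⌊ any? (λ x → lab x ≟ l) ⌋

    used-lab : ∀ x → used (lab x) ≡ true
    used-lab x with any? (λ z → lab z ≟ lab x)
    ... | yes _   = refl
    ... | no none = ⊥-elim (none (x , refl))

    used⁻ : ∀ {l} → used l ≡ true → ∃ λ x → lab x ≡ l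
    used⁻ {l} h with any? (λ x → lab x ≟ l)
    ... | yes q = q

    split : ESet Γ
    split e = not (lab (proj₁ (ends Γ e)) == lab (proj₂ (ends Γ e)))

    split-≢ : ∀ {e} → split e ≡ true → lab (proj₁ (ends Γ e)) ≢ lab (proj₂ (ends Γ e))
    split-≢ {e} h = ==-≢⁻ (trans (sym (𝔹.not-involutive _)) (cong not h))

  abstract
    classes : Enumeration used
    classes = enumerate used

    splitEdges : Enumeration split
    splitEdges = enumerate split

  private
    module V = Enumeration classes
    module E = Enumeration splitEdges

  abstract
    cls : Fin (nV Γ) → Fin V.size
    cls x = proj₁ (V.find (lab x) (used-lab x))

    cls⇒lab : ∀ {x y} → cls x ≡ cls y → lab x ≡ lab y
    cls⇒lab {x} {y} q = trans (sym (proj₂ (V.find (lab x) (used-lab x)))) (trans (cong V.at q) (proj₂ (V.find (lab y) (used-lab y))))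

    lab⇒cls : ∀ {x y} → lab x ≡ lab y → cls x ≡ cls y
    lab⇒cls {x} {y} q = V.at-inj _ _ (trans (proj₂ (V.find (lab x) (used-lab x))) (trans q (sym (proj₂ (V.find (lab y) (used-lab y))))))

    representative : ∀ w → ∃ λ x → cls x ≡ w
    representative w = let (x , q) = used⁻ (V.at∈ w) in
      x , V.at-inj _ _ (trans (proj₂ (V.find (lab x) (used-lab x))) q)

  private
    rep : Fin V.size → Fin (nV Γ)
    rep w = proj₁ (representative w)

    kind : Fin V.size → Bool
    kind w = not (S (rep w))

    S-lab : ∀ {x y} → lab x ≡ lab y → S x ≡ S y
    S-lab {x} {y} q = byCase (S x) refl
      where
      byCase : ∀ b → S x ≡ b → b ≡ S y
      byCase true  Sx = trans (sym Sx) (cong S (sym (lab-S q Sx)))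
      byCase false Sx = sym (lab-∉S q Sx)

    kind-cls : ∀ x → kind (cls x) ≡ not (S x)
    kind-cls x = cong not (S-lab (cls⇒lab (proj₂ (representative (cls x)))))

    S-split : ∀ {e} → split e ≡ true → S (proj₂ (ends Γ e)) ≡ not (S (proj₁ (ends Γ e)))
    S-split {e} h = table (S (proj₁ (ends Γ e))) (S (proj₂ (ends Γ e))) refl refl
      where
      table : ∀ a b → S (proj₁ (ends Γ e)) ≡ a → S (proj₂ (ends Γ e)) ≡ b → b ≡ not a
      table true  false _  _  = refl
      table false true  _  _  = refl
      table false false S₁ S₂ = ⊥-elim (split-≢ h (lab-edge {e} (inj₁ refl) S₁ S₂))
      table true  true  S₁ S₂ = ⊥-elim (𝔹.not-¬ {c} refl (trans (sym (S-col _ S₂)) (trans (bip 𝔾 e) (cong not (S-col _ S₁)))))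

  skeleton : BGraft
  skeleton = record
    { graph = record { nV = V.size ; nE = E.size
                     ; ends = λ g → cls (proj₁ (ends Γ (E.at g))) , cls (proj₂ (ends Γ (E.at g))) }
    ; T = λ w → isOdd (count (λ x → (cls x == w) ∧ T 𝔾 x))
    ; col = kind
    ; bip = λ g → trans (kind-cls _) (trans (cong not (S-split (E.at∈ g))) (cong not (sym (kind-cls _)))) }

  private
    Κ = graph skeleton

  contraction : ContractsTo Γ (T 𝔾) Κ (T skeleton) cls
  contraction = record
    { π-surj = representative
    ; σ = E.at ; σ-inj = E.at-inj
    ; σ-img = λ e ≢ → E.find e (cong not (==-≢ (≢ ∘ lab⇒cls)))
    ; σ-out = λ g q → split-≢ (E.at∈ g) (cls⇒lab q)
    ; σ-ends = λ g → refl
    ; term = λ w → refl }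

  private
    module Tooth-at (v : Fin V.size) (v∈B : kind v ≡ true) where

      rep∉S : S (rep v) ≡ false
      rep∉S = trans (sym (𝔹.not-involutive _)) (cong not v∈B)

      open Component (rep v) rep∉S public

      cls⇒K : ∀ {x} → cls x ≡ v → inK x ≡ true
      cls⇒K {x} q = trans (cong (_== lab (rep v)) (cls⇒lab (trans q (sym (proj₂ (representative v)))))) (==-refl _)

      K⇒cls : ∀ {x} → inK x ≡ true → cls x ≡ v
      K⇒cls Kx = trans (lab⇒cls (==-≡ Kx)) (proj₂ (representative v))

      inK≡ : ∀ x → (cls x == v) ≡ inK x
      inK≡ x = byCase (inK x) refl
        where
        byCase : ∀ b → inK x ≡ b → (cls x == v) ≡ b
        byCase true  Kx = trans (cong (_== v) (K⇒cls Kx)) (==-refl v)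
        byCase false Kx = ==-≢ λ q → conflict (cls⇒K q) Kx

      cut≡ : ∀ e → cut Γ (λ x → cls x == v) e ≡ ∂K e
      cut≡ e = cong₂ _xor_ (inK≡ _) (inK≡ _)

      copy : Σ Graph (InducedOn Γ (λ x → cls x ≡ v))
      copy = inducedCopy Γ (λ x → cls x ≡ v) inK cls⇒K K⇒cls

      open Copy (proj₂ copy) cls⇒K K⇒cls public

      tooth : Tooth 𝔾 S cls v
      tooth = record
        { H = toothGraft ; r = root ; r∈A = root-col ; emb = proj₂ copy ; termv = T-ι
        ; Fv = Fᴷ ; Fv-min = IsLeast⇒MinJoin toothGraft Fᴷ-least ; primal = primalᴷ
        ; cond3 = λ e → (λ h → touch e (crossing (trans (sym (cut≡ e)) h)))
                      , λ a y Sa _ l → trans (cut≡ e) (trans (cut-links Γ inK {e} l)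
                          (cong₂ _xor_ (¬-not λ Ka → conflict Sa (K∉S Ka)) (cls⇒K (ι-in (proj₂ copy) y)))) }
        where
        touch : ∀ e → Crossing e → Σ _ λ a → Σ _ λ y → S a ≡ true × InAr toothGraft Fᴷ root y × Links Γ e a (ι (proj₂ copy) y)
        touch e cr = let (y , ιy≡) = ι-img (proj₂ copy) foot (K⇒cls foot∈)
                         l = subst (Links Γ e tip) (sym ιy≡) links
                     in tip , y , tip∈ , contactᴷ {e} y l tip∈ , l
          where open Crossing cr

      degree-one : degIn Κ (F ∘ E.at) v ≡ 1
      degree-one = trans (count-cong only) (count-⁅⁆ g₀)
        where
        f = proj₁ F-crossing
        Ff = proj₁ (proj₂ F-crossing)
        cf = proj₂ (proj₂ F-crossing)
        g-img : ∃ λ g → E.at g ≡ f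
        g-img = E.find f (cong not (==-≢ λ q → conflict cf
          (trans (cong (_xor inK (proj₂ (ends Γ f))) (cong (_== lab (rep v)) q)) (xor-same (inK (proj₂ (ends Γ f)))))))
        g₀ : Fin E.size
        g₀ = proj₁ g-img
        inc≡ : ∀ g → incident Κ g v ≡ ∂K (E.at g)
        inc≡ g = trans (incident≡inc skeleton g v) (trans (inc-σ contraction g v) (cut≡ (E.at g)))
        only : ∀ g → F (E.at g) ∧ incident Κ g v ≡ (g₀ == g)
        only g = trans (cong (F (E.at g) ∧_) (inc≡ g)) (decide (g₀ ≟ g))
          where
          decide : Dec (g₀ ≡ g) → F (E.at g) ∧ ∂K (E.at g) ≡ (g₀ == g)
          decide (yes q) = trans (subst (λ e → F e ∧ ∂K e ≡ true) (trans (sym (proj₂ g-img)) (cong E.at q)) (cong₂ _∧_ Ff cf))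
                                 (sym (trans (cong (_== g) q) (==-refl g)))
          decide (no ≢)  = trans (¬-not λ h → ≢ (E.at-inj g₀ g (trans (proj₂ g-img)
                                   (F-crossing-unique Ff cf (proj₁ (∧-true (F (E.at g)) h)) (proj₂ (∧-true (F (E.at g)) h))))))
                                 (sym (==-≢ ≢))

  synthesis : Synthesis 𝔾 S
  synthesis = record
    { G = skeleton
    ; comb = degree-one⇒comb skeleton (F ∘ E.at)
               (λ w → trans (isOdd-degIn skeleton (F ∘ E.at) w) (join-∘σ contraction F join w))
               (λ v v∈B → Tooth-at.degree-one v v∈B)
    ; π = cls
    ; contr = contraction
    ; A-single = λ x y h q → sym (lab-S (cls⇒lab q) (trans (sym (𝔹.not-involutive _)) (cong not (trans (sym (kind-cls x)) h))))
    ; spine = λ x → trans (sym (𝔹.not-involutive _)) (cong not (sym (kind-cls x)))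
    ; teeth = Tooth-at.tooth
    ; colour = c , S-col , λ v v∈B y → taut 2 (λ a d → a) (λ a d → (a xor d) xor d) refl _ (not c) }

-- Fringe removal

module FringeRemoval (Ĝ : BGraft) (S : VSet (graph Ĝ)) (S-max : MaxBipExtreme Ĝ S)
                     (F : ESet (graph Ĝ)) (F-min : MinJoin Ĝ F) where

  private
    Γ = graph Ĝ
    n = count F
    F-least = MinJoin⇒IsLeast Ĝ F-min
    open IsLeast F-least

    c : Bool
    c = proj₁ (proj₁ S-max)

    S-col : ∀ x → S x ≡ true → col Ĝ x ≡ c
    S-col = proj₂ (proj₁ S-max)

    off-S : ∀ {a x} → S a ≡ true → S x ≡ false → (a == x) ≡ false
    off-S Sa Sx = ==-≢ λ a≡x → conflict Sa (trans (cong S a≡x) Sx)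

  abstract
    pairwise : ∀ x y → S x ≡ true → S y ≡ true → ∀ J → ∂ Γ J ≗ T Ĝ ⊕ ⁅ x ⁆ ⊕ ⁅ y ⁆ → n ≤ count J
    pairwise x y Sx Sy J ∂J = ≮⇒≥ λ J<n → LamGe⇒≤ (IsLeast.join F₀-least) (ext x y Sx Sy)
        (join⇒LamLe F₀-least J ∂J (<⇒≤ℤ (≤-trans J<n (least F₀ (≗⇒Off (IsLeast.join F₀-least))))))
      where
      F₀ : ESet Γ
      F₀ = proj₁ (proj₁ (proj₂ S-max))
      F₀-least : IsLeast Γ ∅ (T Ĝ) F₀
      F₀-least = MinJoin⇒IsLeast Ĝ (proj₁ (proj₂ (proj₁ (proj₂ S-max))))
      ext : ExtremeWrt Ĝ F₀ S
      ext = proj₂ (proj₂ (proj₁ (proj₂ S-max)))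

    least-S : IsLeast Γ S (T Ĝ) F
    least-S = pairwise⇒IsLeast F-least S pairwise

  Near : Fin (nV Γ) → Set
  Near y = ∃ λ J → Off S (∂ Γ J) (T Ĝ ⊕ ⁅ y ⁆) × suc (count J) ≤ n

  abstract
    near? : ∀ y → Dec (Near y)
    near? y = any-subset? (λ J → Off S (∂ Γ J) (T Ĝ ⊕ ⁅ y ⁆) × suc (count J) ≤ n)
      (λ J≗K (∂J , J<n) → (λ x Sx → trans (sym (∂-cong Γ J≗K x)) (∂J x Sx)) , subst (λ k → suc k ≤ n) (count-cong J≗K) J<n)
      (λ J → off? S (∂ Γ J) (T Ĝ ⊕ ⁅ y ⁆) ×-dec (suc (count J) ≤? n))

    near⇒InD : ∀ {y} → S y ≡ false → Near y → InD Ĝ F S y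
    near⇒InD Sy (J , ∂J , J<n) = let (x , Sx , J′ , ∂J′ , J′≤J) = Off⇒≗ least-S Sy J ∂J in
      Sy , x , Sx , join⇒LamLe F-least J′ ∂J′ (<⇒≤ℤ (≤-trans (s≤s J′≤J) J<n))

    InD⇒near : ∀ {y} → InD Ĝ F S y → Near y
    InD⇒near {y} (_ , x , Sx , le) = let (J , ∂J , J<n) = LamLe⇒join join le in
      J , (λ z Sz → trans (∂J z) (cong (_xor (y == z)) (trans (cong (T Ĝ z xor_) (off-S Sx Sz)) (xor-identityʳ (T Ĝ z))))) , ≤ℤ⇒< J<n

    InC⇒far : ∀ {y} → InC Ĝ F S y → ¬ Near y
    InC⇒far (Sy , y∉D) near = y∉D (near⇒InD Sy near)

    -- Otherwise S ∪ {z} would be a larger extreme set.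
    same-colour⇒near : ∀ {z} → S z ≡ false → col Ĝ z ≡ c → Near z
    same-colour⇒near {z} Sz cz = decide (near? z)
      where
      Y : VSet Γ
      Y x = S x ∨ (z == x)
      Y-case : ∀ {x} → Y x ≡ true → S x ≡ true ⊎ x ≡ z
      Y-case {x} h = ∨-case (S x) refl h
        where
        ∨-case : ∀ b → S x ≡ b → b ∨ (z == x) ≡ true → S x ≡ true ⊎ x ≡ z
        ∨-case true  Sx _ = inj₁ Sx
        ∨-case false _  q = inj₂ (sym (==-≡ q))
      Y-col : ∀ x → Y x ≡ true → col Ĝ x ≡ c
      Y-col x h = [ S-col x , (λ x≡z → trans (cong (col Ĝ) x≡z) cz) ]′ (Y-case h)
      far⇒≤ : ¬ Near z → ∀ J → Off S (∂ Γ J) (T Ĝ ⊕ ⁅ z ⁆) → n ≤ count J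
      far⇒≤ far J ∂J = ≮⇒≥ λ J<n → far (J , ∂J , J<n)
      Y-pair : ¬ Near z → ∀ x y → Y x ≡ true → Y y ≡ true → ∀ J → ∂ Γ J ≗ T Ĝ ⊕ ⁅ x ⁆ ⊕ ⁅ y ⁆ → n ≤ count J
      Y-pair far x y Yx Yy J ∂J = cases (Y-case Yx) (Y-case Yy)
        where
        cases : S x ≡ true ⊎ x ≡ z → S y ≡ true ⊎ y ≡ z → n ≤ count J
        cases (inj₁ Sx)  (inj₁ Sy)  = pairwise x y Sx Sy J ∂J
        cases (inj₁ Sx)  (inj₂ y≡z) = far⇒≤ far J λ u Su → trans (∂J u)
          (trans (cong₂ (λ a b → (T Ĝ u xor a) xor (b == u)) (off-S Sx Su) y≡z) (cong (_xor (z == u)) (xor-identityʳ (T Ĝ u))))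
        cases (inj₂ x≡z) (inj₁ Sy)  = far⇒≤ far J λ u Su → trans (∂J u)
          (trans (cong₂ (λ a b → (T Ĝ u xor (a == u)) xor b) x≡z (off-S Sy Su)) (xor-identityʳ _))
        cases (inj₂ x≡z) (inj₂ y≡z) = least J λ u _ → trans (∂J u)
          (trans (cong₂ (λ a b → (T Ĝ u xor (a == u)) xor (b == u)) x≡z y≡z) (taut 2 (λ t a → (t xor a) xor a) (λ t a → t) refl (T Ĝ u) (z == u)))
      decide : Dec (Near z) → Near z
      decide (yes near) = near
      decide (no far)   = conflict
        (proj₂ (proj₂ S-max) Y (c , Y-col) (F , F-min , λ x y Yx Yy → LamGe-0 join (Y-pair far x y Yx Yy))
           (λ x Sx → cong (_∨ (z == x)) Sx) z (trans (cong (S z ∨_) (==-refl z)) (𝔹.∨-zeroʳ (S z))))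
        Sz

    far-neighbour : ∀ {f x z} → Links Γ f x z → S x ≡ false → ¬ Near x → S z ≡ true
    far-neighbour {f} {x} {z} l Sx far = 𝔹.¬-not {x = S z} {y = false} λ Sz → far (step-back (same-colour⇒near Sz cz))
      where
      open Parity Ĝ least-S c S-col
      cz : col Ĝ z ≡ c
      cz = trans (links-col Ĝ {f} l) (trans (cong not (¬-not {col Ĝ x} {c} λ cx → far (same-colour⇒near Sx cx))) (𝔹.not-involutive c))
      step-back : Near z → Near x
      step-back (J , ∂J , J<n) = J ⊕ ⁅ f ⁆
          , Off-⊕ Γ ∂J (Off-edge Γ {S} {f} l) (λ u → taut 3 (λ t a b → (t xor a) xor (b xor a)) (λ t a b → t xor b) refl (T Ĝ u) (z == u) (x == u))
          , ≤-trans (s≤s (count-toggle-≤ J f)) (skip J<n even)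
        where
        even : isOdd (count J) ≡ isOdd n
        even = trans (parity J ∂J) (trans (⨁χ⊕ (T Ĝ) z) (trans (cong₂ _xor_ (sym isOdd-n) (trans (cong (_xor c) cz) (xor-same c))) (xor-identityʳ _)))
        skip : ∀ {j m} → suc j ≤ m → isOdd j ≡ isOdd m → suc (suc j) ≤ m
        skip {j} {m} j<m eq = ≤∧≢⇒< j<m λ q → 𝔹.not-¬ {isOdd j} refl (trans eq (cong isOdd (sym q)))

    far-edge : ∀ {f x} → inc Γ f x ≡ true → S x ≡ false → ¬ Near x → F f ≡ false
    far-edge {f} {x} ie Sx far = let (z , l , _) = other-end {Γ} f x ie in ¬-not λ Ff →
      far (F ⊕ ⁅ f ⁆ , Off-⊕ Γ (≗⇒Off join) (Off-edge-M Γ {S} {f} (links-sym {Γ} {f} l) (far-neighbour {f} l Sx far)) (λ _ → refl)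
          , ≤-reflexive (count-toggle-in F f Ff))

  module Remaining (H : BGraft) (E : InducedOn Γ (λ x → ¬ InC Ĝ F S x) (graph H))
                   (T-eq : ∀ y → T H y ≡ T Ĝ (ι E y)) (col-eq : ∀ y → col H y ≡ col Ĝ (ι E y)) where

    private
      Η = graph H
      module E = Induced E

      Sᴴ : VSet Η
      Sᴴ y = S (ι E y)

      Fᴴ : ESet Η
      Fᴴ = F ∘ κ E

      in-copy : ∀ f → F f ≡ true → ∃ λ g → κ E g ≡ f
      in-copy f Ff = κ-img E f (not-C (inj₁ refl)) (not-C (inj₂ refl))
        where
        not-C : ∀ {x w} → Links Γ f x w → ¬ InC Ĝ F S x
        not-C {x} l C = conflict Ff (far-edge {f} (≢⇒inc {Γ} {f} l (links-≢ Ĝ {f} l)) (proj₁ C) (InC⇒far C))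

      count-Fᴴ : count F ≡ count Fᴴ
      count-Fᴴ = count-reindex (κ E) (κ-inj E) F in-copy

      outside : ∀ {x} → S x ≡ false → (∀ y → ι E y ≢ x) → T Ĝ x ≡ false
      outside {x} Sx x∉ = trans (sym (join x)) (⨁-zero λ f → zero-at f (inc Γ f x) refl)
        where
        far : ¬ Near x
        far near = let (y , q) = ι-img E x (λ C → InC⇒far C near) in x∉ y q
        zero-at : ∀ f b → inc Γ f x ≡ b → F f ∧ b ≡ false
        zero-at f true  ie = cong (_∧ true) (far-edge {f} ie Sx far)
        zero-at f false _  = 𝔹.∧-zeroʳ (F f)

      leastᴴ : IsLeast Η Sᴴ (T H) Fᴴ
      leastᴴ = record
        { join  = λ y → trans (E.∂-restrict F y (λ f Ff _ → in-copy f Ff)) (trans (join (ι E y)) (sym (T-eq y)))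
        ; least = λ J ∂J → ≤-trans (≤-reflexive (sym count-Fᴴ))
            (≤-trans (IsLeast.least least-S (E.push J) (pushed J ∂J)) (≤-reflexive (E.count-push J))) }
        where
        pushed : ∀ J → Off Sᴴ (∂ Η J) (T H) → Off S (∂ Γ (E.push J)) (T Ĝ)
        pushed J ∂J x Sx = locate (in-image? (ι E) x)
          where
          locate : (∃ λ y → ι E y ≡ x) ⊎ (∀ y → ι E y ≢ x) → ∂ Γ (E.push J) x ≡ T Ĝ x
          locate (inj₁ (y , refl)) = trans (E.∂-push J y) (trans (∂J y Sx) (T-eq y))
          locate (inj₂ x∉)         = trans (E.∂-push-out J x∉) (sym (outside Sx x∉))

      nearᴴ : ∀ y → Sᴴ y ≡ false → ∃ λ J → Off Sᴴ (∂ Η J) (T H ⊕ ⁅ y ⁆) × suc (count J) ≤ count Fᴴ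
      nearᴴ y Sy = restrict (decide (near? (ι E y)))
        where
        decide : Dec (Near (ι E y)) → Near (ι E y)
        decide (yes near) = near
        decide (no far)   = ⊥-elim (ι-in E y (Sy , λ D → far (InD⇒near D)))
        restrict : Near (ι E y) → ∃ λ J → Off Sᴴ (∂ Η J) (T H ⊕ ⁅ y ⁆) × suc (count J) ≤ count Fᴴ
        restrict (J , ∂J , J<n) = J ∘ κ E
          , (λ z Sz → trans (E.∂-restrict J z (λ f _ ie → kept Sz ie)) (trans (∂J (ι E z) Sz)
              (cong₂ _xor_ (sym (T-eq z)) (==-inj (ι E) (ι-inj E) y z))))
          , ≤-trans (s≤s (E.count-∘ J)) (≤-trans J<n (≤-reflexive count-Fᴴ))
          where
          kept : ∀ {f z} → S (ι E z) ≡ false → inc Γ f (ι E z) ≡ true → ∃ λ g → κ E g ≡ f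
          kept {f} {z} Sz ie = let (w , l , _) = other-end {Γ} f (ι E z) ie in
            κ-links E l (ι-in E z) λ C → conflict (far-neighbour {f} (links-sym {Γ} {f} l) (proj₁ C) (InC⇒far C)) Sz

    synthesis : Synthesis H Sᴴ
    synthesis = DominatingSynthesis.synthesis H Sᴴ c (λ y Sy → trans (col-eq y) (S-col (ι E y) Sy)) Fᴴ leastᴴ nearᴴ

theorem7p9 : (Ĝ : BGraft) → HasJoin (graph Ĝ) (T Ĝ) →
    ((S : VSet (graph Ĝ)) → Synthesis Ĝ S → MaxBipExtreme Ĝ S × FringeEmpty Ĝ S)
    × ((S : VSet (graph Ĝ)) → MaxBipExtreme Ĝ S →
    (F : ESet (graph Ĝ)) → MinJoin Ĝ F →
    (H : BGraft) → (e : InducedOn (graph Ĝ) (λ x → ¬ InC Ĝ F S x) (graph H)) →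
    (∀ y → T H y ≡ T Ĝ (ι e y)) → (∀ y → col H y ≡ col Ĝ (ι e y)) →
    Synthesis H (λ y → S (ι e y)))
theorem7p9 Ĝ hasJoin = synthesis⇒extreme Ĝ hasJoin
  , λ S S-max F F-min → FringeRemoval.Remaining.synthesis Ĝ S S-max F F-min
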